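{- Let $(W,S)$ be an irreducible, nontrivially $\mathbf{a}(2)$-finite Coxeter system of type $X$, and for $x,y\in\mathcal{S}(W)$ let $I(x,y)=R_x\cap R_y^{ -1}$. Then: (1) if $X=A_n$, $n\ge3$: $I(13,13)=\{13\}$; (2) if $X=B_3$: $I(13,13)=\{13\}$; (3) if $X=B_n$, $n>3$: $I(24,24)=\{24,2124\}$; (4) if $X=\tilde C_{n-1}$, $n\ge5$: $I(24,24)=\{24,\ 2124,\ 2z,\ 212z\}$ where $z=45\cdots(n-1)n(n-1)\cdots54$; (5) if $X=E_{q,r}$, $r\ge q\ge1$: $I(x,x)=\{x\}$ for every $x\in\{(-1)v,\ 1v,\ (-1)1\}$; (6) if $X=F_4$: $I(24,24)=\{24\}$; (7) if $X=F_n$, $n>4$: $I(24,24)=\{24,243524\}$; (8) if $X=H_3$: $I(13,13)=\{13\}$; (9) if $X=H_n$, $n>3$: $I(24,24)=\{24,2124\}$.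
   Context: $\mathbf{a}$ is Lusztig's $\mathbf{a}$-function (boundedness conjecture assumed); nontrivially $\mathbf{a}(2)$-finite: $\{w:\mathbf{a}(w)=2\}$ finite and nonempty. Labels: $A_n$: path $1-\cdots-n$; $B_n$: same with $m(1,2)=4$; $\tilde C_{n-1}$: same with $m(1,2)=m(n-1,n)=4$; $F_n$: same with $m(2,3)=4$; $H_n$: same with $m(1,2)=5$; $E_{q,r}$: vertices $-q,\dots,0,\dots,r,v$, path $-q-\cdots-r$ plus edge $0-v$; remaining edge weights 3, non-adjacent generators commute; strings of generators denote products. Star operations: for $I=\{s,t\}$, $m=m(s,t)\ge3$, write $w=w^Iw_I$ (length-additive, $w_I\in\langle s,t\rangle$, no right descent of $w^I$ in $I$); if $w_I$ is alternating of length $i\in[1,m-1]$, the right upper (resp. lower) star operation is defined iff $i\le m-2$ (resp. $i\ge2$) and replaces $w_I$ by the alternating product of length $i+1$ (resp. $i-1$) with the same first letter. Left stub: no right lower star operation applies; $\mathcal{S}(W)$: left stubs of $\mathbf{a}$-value 2. $R_x$: elements obtainable from $x$ by finitely many right upper star operations; $R_y^{ -1}=\{z^{ -1}:z\in R_y\}$. -}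

module Defs where

open import Data.Nat using (ℕ; zero; suc; _+_; _∸_; _≤_; _<_; _≡ᵇ_)
open import Data.Bool using (Bool; true; false; if_then_else_; _∨_)
open import Data.Fin using (Fin; zero; suc; toℕ)
open import Data.List using (List; []; _∷_; _++_; [_]; reverse; map; upTo; length)
open import Data.List.Relation.Unary.Any using (Any)
open import Data.Product using (Σ; _×_; _,_)
open import Relation.Nullary using (¬_)
open import Relation.Binary.PropositionalEquality using (_≡_; _≢_)
open import Relation.Binary.Construct.Closure.ReflexiveTransitive using (Star)

-- A Coxeter matrix on the generating set Fin n (entry 0 would mean ∞;
-- all matrices used below have finite entries, m(s,s) = 1).
CoxeterMatrix : ℕ → Set
CoxeterMatrix n = Fin n → Fin n → ℕ

module Coxeter {n : ℕ} (M : CoxeterMatrix n) where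

  Word : Set
  Word = List (Fin n)

  pow : Word → ℕ → Word
  pow u zero    = []
  pow u (suc k) = u ++ pow u k

  alt : Fin n → Fin n → ℕ → Word
  alt s t zero    = []
  alt s t (suc i) = s ∷ alt t s i

  -- equality in W = ⟨ S | (st)^{m(s,t)} = 1 ⟩ (congruence generated by the
  -- Coxeter relators; since m(s,s)=1 all generators are involutions, so the
  -- presented monoid is the Coxeter group and w⁻¹ is the reversed word)
  infix 4 _≈_
  data _≈_ : Word → Word → Set where
    rel     : ∀ a b s t → (a ++ pow (s ∷ t ∷ []) (M s t) ++ b) ≈ (a ++ b)
    ≈-refl  : ∀ {u} → u ≈ u
    ≈-sym   : ∀ {u v} → u ≈ v → v ≈ u
    ≈-trans : ∀ {u v w} → u ≈ v → v ≈ w → u ≈ w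

  inv : Word → Word
  inv = reverse

  HasLength : Word → ℕ → Set
  HasLength w k = (Σ Word λ v → v ≈ w × length v ≡ k) × (∀ v → v ≈ w → k ≤ length v)

  RightDescent : Word → Fin n → Set
  RightDescent u s = Σ ℕ λ a → Σ ℕ λ b → HasLength u a × HasLength (u ++ [ s ]) b × b < a

  RightUpperStar : Word → Word → Set
  RightUpperStar w w' =
    Σ (Fin n) λ s → Σ (Fin n) λ t → Σ Word λ u → Σ ℕ λ i → Σ ℕ λ lu →
      s ≢ t × 3 ≤ M s t × 1 ≤ i × i + 2 ≤ M s t
      × ¬ RightDescent u s × ¬ RightDescent u t
      × HasLength u lu × HasLength (alt s t i) i × HasLength w (lu + i)
      × w ≈ u ++ alt s t i
      × w' ≈ u ++ alt s t (suc i)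

  R : Word → Word → Set
  R x w = Σ Word λ v → Star RightUpperStar x v × v ≈ w

  I : Word → Word → Word → Set
  I x y w = R x w × R y (inv w)

  IEquals : Word → Word → List Word → Set
  IEquals x y S = ∀ w → (I x y w → Any (λ v → w ≈ v) S) × (Any (λ v → w ≈ v) S → I x y w)

-- index (0-based) into Fin (suc m), clamped (never clamped in our uses)
idx : ∀ {m} → ℕ → Fin (suc m)
idx {zero}  _       = zero
idx {suc m} zero    = zero
idx {suc m} (suc a) = suc (idx {m} a)

-- generator with 1-based label a
lbl : ∀ {m} → ℕ → Fin (suc m)
lbl a = idx (a ∸ 1)

ws : ∀ {m} → List ℕ → List (Fin (suc m))
ws = map lbl

-- path Coxeter matrix on 0-based vertices; e k = weight of the edge between
-- labels k and k+1 (1-based)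
pathRule : (ℕ → ℕ) → ℕ → ℕ → ℕ
pathRule e a b =
  if a ≡ᵇ b then 1
  else if suc a ≡ᵇ b then e (suc a)
  else if suc b ≡ᵇ a then e (suc b)
  else 2

pathM : (n : ℕ) → (ℕ → ℕ) → CoxeterMatrix n
pathM n e i j = pathRule e (toℕ i) (toℕ j)

typeA : (n : ℕ) → CoxeterMatrix n
typeA n = pathM n (λ _ → 3)

typeB : (n : ℕ) → CoxeterMatrix n
typeB n = pathM n (λ k → if k ≡ᵇ 1 then 4 else 3)

-- \tilde C_{n-1}: n generators, m(1,2) = m(n-1,n) = 4
typeCt : (n : ℕ) → CoxeterMatrix n
typeCt n = pathM n (λ k → if (k ≡ᵇ 1) ∨ (k ≡ᵇ (n ∸ 1)) then 4 else 3)

typeF : (n : ℕ) → CoxeterMatrix n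
typeF n = pathM n (λ k → if k ≡ᵇ 2 then 4 else 3)

typeH : (n : ℕ) → CoxeterMatrix n
typeH n = pathM n (λ k → if k ≡ᵇ 1 then 5 else 3)

-- E_{q,r}: vertex j ∈ {-q,…,r} has 0-based index j+q, vertex v has index q+r+1
eRule : ℕ → ℕ → ℕ → ℕ → ℕ
eRule q r a b =
  if a ≡ᵇ b then 1
  else if a ≡ᵇ v then (if b ≡ᵇ q then 3 else 2)
  else if b ≡ᵇ v then (if a ≡ᵇ q then 3 else 2)
  else pathRule (λ _ → 3) a b
  where v = suc (q + r)

typeE : (q r : ℕ) → CoxeterMatrix (2 + q + r)
typeE q r i j = eRule q r (toℕ i) (toℕ j)

eVert : (q r : ℕ) → ℕ → Fin (2 + q + r)
eVert q r j = idx (q + j)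
eNeg : (q r : ℕ) → ℕ → Fin (2 + q + r)
eNeg q r j = idx (q ∸ j)
eV : (q r : ℕ) → Fin (2 + q + r)
eV q r = idx (suc (q + r))

zLabels : ℕ → List ℕ
zLabels n = ups ++ [ n ] ++ reverse ups
  where ups = map (4 +_) (upTo (n ∸ 4))

{-# OPTIONS --safe #-}
module Submission where

-- W acts on functions S → ℤ² by the numbers game. Starting from the constant function 1, the value at s
-- after playing w is the height of the root w(α_s), so its sign decides whether s is a right descent of w.
-- Hence a fully commutative (FC) word is reduced, its right descents are the letters that commutations
-- bring to the end, and a star operation on it appends one letter and yields an FC word again: R_x becomes
-- a question about words up to commutation.
--
-- A word reached from x = ab has at most two right descents, which behave like two particles on the Coxeter
-- graph. A star operation moves one of them along an edge {l , r}, and the move is blocked when the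
-- alternating tail of the word in {l , r} already has length m(l,r) − 1. Two particles with a common
-- neighbour may merge there, and never separate again. If w and w⁻¹ both lie in R_x, then the particles of
-- w are back at a and b; the blocked moves leave this possible only along the listed words. Over light
-- bonds a particle cannot step back at once; a heavy bond lets it bounce.

-- The families are infinite, so nothing is settled by enumeration, and a star operation is defined
-- by a factorization up to equality in the group, with lengths that quantify over all words.
-- `FC-peel` overcomes this: for an FC word the sign test finds the letters of the dihedral factor
-- one at a time by commutations. Hence every star operation is a `Step` on the given word,
-- whichever factorization it came with, and each type needs only an invariant kept by `Step`. Of
-- the condition on the inverse just one consequence is used for the upper bound: the inverse of w
-- begins with ab = ba, so a and b are both right descents of w. Reachable words with these two
-- descents are classified, and each is its own reverse up to commutation, which gives the other
-- inclusion. Invariants record blocked moves, and full words only where a return is possible. In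
-- type F the bounce of one particle also lets the other return over a light bond: it appends the
-- letter 3, behind which the earlier 4 is stuck, so the tail in the letters 4 and 5 is a single 5
-- and the way back to 4 is open.

open import Defs
open import Data.Bool using (true; false; if_then_else_; _∨_)
open import Data.Bool.Properties using (T-≡)
open import Data.Empty using (⊥; ⊥-elim)
open import Data.Fin as Fin using (Fin; toℕ) renaming (_≟_ to _≟ᶠ_)
import Data.Fin.Properties as Finₚ
open import Data.Integer as ℤ using (ℤ; 0ℤ)
import Data.Integer.Properties as ℤₚ
open import Data.Integer.Solver using (module +-*-Solver)
open import Data.List using (List; []; _∷_; _++_; [_]; reverse; length; foldl; map; upTo)
import Data.List.Properties as Listₚ
open import Data.List.Relation.Unary.All as All using (All; []; _∷_)
open import Data.List.Relation.Unary.All.Properties using (all-upTo)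
open import Data.List.Relation.Unary.Any using (Any; here; there)
open import Data.Nat as ℕ using (ℕ; zero; suc; _+_; _∸_; _≤_; _<_; z≤n; s≤s)
import Data.Nat.Properties as ℕₚ
open import Data.Product using (Σ; _×_; _,_; proj₁; proj₂)
open import Data.Sum using (_⊎_; inj₁; inj₂)
open import Function.Bundles using (Equivalence)
open import Relation.Binary using (tri<; tri≈; tri>)
open import Relation.Binary.Construct.Closure.ReflexiveTransitive using (Star; _◅_; _◅◅_) renaming (ε to ε*)
open import Relation.Binary.PropositionalEquality hiding ([_])
open import Relation.Nullary using (¬_; yes; no)
open +-*-Solver using (Polynomial; con; _:+_; :-_; _:=_; solve)

-- The numbers game

-- Stated over any carrier, so that the ring solver's polynomials can be run through the same programs.
module Pairs (R : Set) (_+_ : R → R → R) (-_ : R → R) (0# : R) where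

  infixl 6 _⊕_
  _⊕_ : R × R → R × R → R × R
  (a , b) ⊕ (c , d) = (a + c , b + d)

  infix 8 ⊖_
  ⊖_ : R × R → R × R
  ⊖ (a , b) = (- a , - b)

  𝟎 : R × R
  𝟎 = (0# , 0#)

  -- Multiplication by 2cos(π/m): by 1 for m = 3, by √2 on ℤ[√2] for m = 4, by the golden ratio φ on
  -- ℤ[φ] for m = 5.
  κ : ℕ → R × R → R × R
  κ 3 x = x
  κ 4 (a , b) = (b + b , a)
  κ 5 (a , b) = (b , a + b)
  κ _ _ = 𝟎

  Quad : Set
  Quad = ((R × R) × (R × R)) × ((R × R) × (R × R))

  -- Effect of firing s and then t on the values at s and t; the last two entries
  -- accumulate the amounts fired at s and at t.
  round : ℕ → Quad → Quad
  round m ((a , b) , (A , B)) =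
    let b′ = b ⊕ κ m a in (⊖ a ⊕ κ m b′ , ⊖ b′) , (A ⊕ a , B ⊕ b′)

  rounds : ℕ → ℕ → Quad → Quad
  rounds m zero x = x
  rounds m (suc j) x = rounds m j (round m x)

  -- A Chebyshev recursion for an alternating play whose first letter has value `a` and whose other
  -- letter has value `b`; index j holds the amount fired by the j-th letter played. Index 0 is a
  -- fictitious earlier firing `⊖ b`, which makes the second amount, b plus `κ m a`, an instance of
  -- the same rule.
  fired : ℕ → R × R → R × R → ℕ → R × R
  fired m a b zero = ⊖ b
  fired m a b (suc zero) = a
  fired m a b (suc (suc j)) = ⊖ fired m a b j ⊕ κ m (fired m a b (suc j))

open Pairs ℤ ℤ._+_ ℤ.-_ 0ℤ
module Poly {n} = Pairs (Polynomial n) _:+_ :-_ (con 0ℤ)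

K : Set
K = ℤ × ℤ

pattern quad a b c d e f g h = ((a , b) , (c , d)) , ((e , f) , (g , h))

entry : ∀ {R : Set} → ℕ → ((R × R) × (R × R)) × ((R × R) × (R × R)) → R
entry 0 (quad a b c d e f g h) = a
entry 1 (quad a b c d e f g h) = b
entry 2 (quad a b c d e f g h) = c
entry 3 (quad a b c d e f g h) = d
entry 4 (quad a b c d e f g h) = e
entry 5 (quad a b c d e f g h) = f
entry 6 (quad a b c d e f g h) = g
entry _ (quad a b c d e f g h) = h

entry-ext : (x y : Quad) → (∀ i → entry i x ≡ entry i y) → x ≡ y
entry-ext (quad a b c d e f g h) (quad a' b' c' d' e' f' g' h') eq
  with refl ← eq 0 | refl ← eq 1 | refl ← eq 2 | refl ← eq 3 | refl ← eq 4 | refl ← eq 5 | refl ← eq 6 | refl ← eq 7 = refl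

cyc : ℕ → ℕ → (a b c d : Polynomial 4) → Polynomial 4 × Polynomial 4
cyc m i a b c d = entry i (Poly.rounds m m (((a , b) , (c , d)) , (Poly.𝟎 , Poly.𝟎))) := entry i (((a , b) , (c , d)) , (Poly.𝟎 , Poly.𝟎))

data Bond (m : ℕ) : Set where
  b2 : m ≡ 2 → Bond m
  b3 : m ≡ 3 → Bond m
  b4 : m ≡ 4 → Bond m
  b5 : m ≡ 5 → Bond m

-- The product st acts on the two values as a rotation of order m. The accumulators have to return
-- too: over the full cycle the amounts fired at each letter cancel, and this is what restores the
-- values at all other vertices.
rounds-cycle : ∀ {m} → Bond m → ∀ x y → rounds m m ((x , y) , (𝟎 , 𝟎)) ≡ ((x , y) , (𝟎 , 𝟎))
rounds-cycle e x y = entry-ext _ _ (go e x y)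
  where
  go : ∀ {m} → Bond m → ∀ x y i → entry i (rounds m m ((x , y) , (𝟎 , 𝟎))) ≡ entry i ((x , y) , (𝟎 , 𝟎))
  go (b2 refl) (a , b) (c , d) 0 = solve 4 (cyc 2 0) refl a b c d
  go (b2 refl) (a , b) (c , d) 1 = solve 4 (cyc 2 1) refl a b c d
  go (b2 refl) (a , b) (c , d) 2 = solve 4 (cyc 2 2) refl a b c d
  go (b2 refl) (a , b) (c , d) 3 = solve 4 (cyc 2 3) refl a b c d
  go (b2 refl) (a , b) (c , d) 4 = solve 4 (cyc 2 4) refl a b c d
  go (b2 refl) (a , b) (c , d) 5 = solve 4 (cyc 2 5) refl a b c d
  go (b2 refl) (a , b) (c , d) 6 = solve 4 (cyc 2 6) refl a b c d
  go (b2 refl) (a , b) (c , d) (suc (suc (suc (suc (suc (suc (suc i))))))) = solve 4 (cyc 2 7) refl a b c d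
  go (b3 refl) (a , b) (c , d) 0 = solve 4 (cyc 3 0) refl a b c d
  go (b3 refl) (a , b) (c , d) 1 = solve 4 (cyc 3 1) refl a b c d
  go (b3 refl) (a , b) (c , d) 2 = solve 4 (cyc 3 2) refl a b c d
  go (b3 refl) (a , b) (c , d) 3 = solve 4 (cyc 3 3) refl a b c d
  go (b3 refl) (a , b) (c , d) 4 = solve 4 (cyc 3 4) refl a b c d
  go (b3 refl) (a , b) (c , d) 5 = solve 4 (cyc 3 5) refl a b c d
  go (b3 refl) (a , b) (c , d) 6 = solve 4 (cyc 3 6) refl a b c d
  go (b3 refl) (a , b) (c , d) (suc (suc (suc (suc (suc (suc (suc i))))))) = solve 4 (cyc 3 7) refl a b c d
  go (b4 refl) (a , b) (c , d) 0 = solve 4 (cyc 4 0) refl a b c d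
  go (b4 refl) (a , b) (c , d) 1 = solve 4 (cyc 4 1) refl a b c d
  go (b4 refl) (a , b) (c , d) 2 = solve 4 (cyc 4 2) refl a b c d
  go (b4 refl) (a , b) (c , d) 3 = solve 4 (cyc 4 3) refl a b c d
  go (b4 refl) (a , b) (c , d) 4 = solve 4 (cyc 4 4) refl a b c d
  go (b4 refl) (a , b) (c , d) 5 = solve 4 (cyc 4 5) refl a b c d
  go (b4 refl) (a , b) (c , d) 6 = solve 4 (cyc 4 6) refl a b c d
  go (b4 refl) (a , b) (c , d) (suc (suc (suc (suc (suc (suc (suc i))))))) = solve 4 (cyc 4 7) refl a b c d
  go (b5 refl) (a , b) (c , d) 0 = solve 4 (cyc 5 0) refl a b c d
  go (b5 refl) (a , b) (c , d) 1 = solve 4 (cyc 5 1) refl a b c d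
  go (b5 refl) (a , b) (c , d) 2 = solve 4 (cyc 5 2) refl a b c d
  go (b5 refl) (a , b) (c , d) 3 = solve 4 (cyc 5 3) refl a b c d
  go (b5 refl) (a , b) (c , d) 4 = solve 4 (cyc 5 4) refl a b c d
  go (b5 refl) (a , b) (c , d) 5 = solve 4 (cyc 5 5) refl a b c d
  go (b5 refl) (a , b) (c , d) 6 = solve 4 (cyc 5 6) refl a b c d
  go (b5 refl) (a , b) (c , d) (suc (suc (suc (suc (suc (suc (suc i))))))) = solve 4 (cyc 5 7) refl a b c d

⊕-assoc : ∀ x y z → (x ⊕ y) ⊕ z ≡ x ⊕ (y ⊕ z)
⊕-assoc (a , b) (c , d) (e , f) = cong₂ _,_ (ℤₚ.+-assoc a c e) (ℤₚ.+-assoc b d f)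

⊕-identityʳ : ∀ x → x ⊕ 𝟎 ≡ x
⊕-identityʳ (a , b) = cong₂ _,_ (ℤₚ.+-identityʳ a) (ℤₚ.+-identityʳ b)

⊕-inverseʳ : ∀ x → x ⊕ ⊖ x ≡ 𝟎
⊕-inverseʳ (a , b) = cong₂ _,_ (ℤₚ.+-inverseʳ a) (ℤₚ.+-inverseʳ b)

⊖-involutive : ∀ x → ⊖ ⊖ x ≡ x
⊖-involutive (a , b) = cong₂ _,_ (ℤₚ.neg-involutive a) (ℤₚ.neg-involutive b)

⊕-interchange : ∀ a b c d → (a ⊕ b) ⊕ (c ⊕ d) ≡ (a ⊕ c) ⊕ (b ⊕ d)
⊕-interchange (a , a') (b , b') (c , c') (d , d') = cong₂ _,_ (lem a b c d) (lem a' b' c' d')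
  where
  lem : ∀ a b c d → (a ℤ.+ b) ℤ.+ (c ℤ.+ d) ≡ (a ℤ.+ c) ℤ.+ (b ℤ.+ d)
  lem = solve 4 (λ a b c d → (a :+ b) :+ (c :+ d) := (a :+ c) :+ (b :+ d)) refl

κ-⊕ : ∀ m x y → κ m (x ⊕ y) ≡ κ m x ⊕ κ m y
κ-⊕ 0 x y = refl
κ-⊕ 1 x y = refl
κ-⊕ 2 x y = refl
κ-⊕ 3 x y = refl
κ-⊕ 4 (a , b) (c , d) = cong (_, a ℤ.+ c)
  (solve 2 (λ b d → (b :+ d) :+ (b :+ d) := (b :+ b) :+ (d :+ d)) refl b d)
κ-⊕ 5 (a , b) (c , d) = cong (b ℤ.+ d ,_)
  (solve 4 (λ a b c d → (a :+ c) :+ (b :+ d) := (a :+ b) :+ (c :+ d)) refl a b c d)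
κ-⊕ (suc (suc (suc (suc (suc (suc m)))))) x y = refl

κ-𝟎 : ∀ m → κ m 𝟎 ≡ 𝟎
κ-𝟎 0 = refl
κ-𝟎 1 = refl
κ-𝟎 2 = refl
κ-𝟎 3 = refl
κ-𝟎 4 = refl
κ-𝟎 5 = refl
κ-𝟎 (suc (suc (suc (suc (suc (suc m)))))) = refl

κ-cancel : ∀ m x → κ m x ⊕ κ m (⊖ x) ≡ 𝟎
κ-cancel m x = trans (sym (κ-⊕ m x (⊖ x))) (trans (cong (κ m) (⊕-inverseʳ x)) (κ-𝟎 m))

-- Positivity is asked of the coefficients, so no order on ℤ[√2] or ℤ[φ] is involved. It is stronger
-- than positivity of the real number, yet it is kept by sums and by `κ` over bonds of weight at
-- least 3.
data Pos : K → Set where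
  pos : ∀ m k → 1 ≤ m + k → Pos (ℤ.+ m , ℤ.+ k)

Pos-⊕ : ∀ {x y} → Pos x → Pos y → Pos (x ⊕ y)
Pos-⊕ (pos m k p) (pos m' k' q) = pos (m + m') (k + k')
  (ℕₚ.≤-trans p (ℕₚ.+-mono-≤ (ℕₚ.m≤m+n m m') (ℕₚ.m≤m+n k k')))

Pos-κ : ∀ {m x} → 3 ≤ m → Bond m → Pos x → Pos (κ m x)
Pos-κ (s≤s (s≤s ())) (b2 refl)
Pos-κ _ (b3 refl) p = p
Pos-κ _ (b4 refl) (pos m k p) = pos (k + k) m
  (ℕₚ.≤-trans p (subst (ℕ._≤ k + k + m) (ℕₚ.+-comm k m) (ℕₚ.+-monoˡ-≤ m (ℕₚ.m≤m+n k k))))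
Pos-κ _ (b5 refl) (pos m k p) = pos k (m + k) (ℕₚ.≤-trans p (ℕₚ.m≤n+m (m + k) k))

Pos-⊖ : ∀ {x} → Pos x → ¬ Pos (⊖ x)
Pos-⊖ (pos zero zero ()) q
Pos-⊖ (pos zero (suc k) p) ()
Pos-⊖ (pos (suc m) k p) ()

-- With U_j = sin((j+1)π/m) / sin(π/m), the amount is U_j a + U_(j-1) b. Both coefficients are
-- nonnegative for j < m, and at j = m - 1 the amount has come down to `b`. These are the m positive
-- roots of the dihedral group.
fired-pos : ∀ {m} → Bond m → ∀ {a b} → Pos a → Pos b → ∀ j → j < m → Pos (fired m a b (suc j))
fired-pos e pa pb zero lt = pa
fired-pos (b2 refl) {b = b} pa pb 1 lt =
  subst Pos (sym (trans (⊕-identityʳ _) (⊖-involutive b))) pb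
fired-pos (b2 refl) pa pb (suc (suc j)) (s≤s (s≤s ()))
fired-pos (b3 refl) {a} {b} pa pb 1 lt =
  subst Pos (sym (cong (_⊕ a) (⊖-involutive b))) (Pos-⊕ pb pa)
fired-pos (b3 refl) {a , a'} {b , b'} pa pb 2 lt = subst Pos (cong₂ _,_ (lem a b) (lem a' b')) pb
  where
  lem : ∀ a b → b ≡ ℤ.- a ℤ.+ (ℤ.- ℤ.- b ℤ.+ a)
  lem = solve 2 (λ a b → b := :- a :+ (:- (:- b) :+ a)) refl
fired-pos (b3 refl) pa pb (suc (suc (suc j))) (s≤s (s≤s (s≤s ())))
fired-pos (b4 refl) {a} {b} pa pb 1 lt =
  subst Pos (sym (cong (_⊕ κ 4 a) (⊖-involutive b))) (Pos-⊕ pb (Pos-κ (s≤s (s≤s (s≤s z≤n))) (b4 refl) pa))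
fired-pos (b4 refl) {a , a'} {b , b'} pa pb 2 lt =
  subst Pos (cong₂ _,_ (solve 4 (eq proj₁) refl a a' b b') (solve 4 (eq proj₂) refl a a' b b'))
    (Pos-⊕ pa (Pos-κ (s≤s (s≤s (s≤s z≤n))) (b4 refl) pb))
  where
  eq : (Polynomial 4 × Polynomial 4 → Polynomial 4) → ∀ a a' b b' → Polynomial 4 × Polynomial 4
  eq π a a' b b' = π ((a , a') Poly.⊕ Poly.κ 4 (b , b')) := π (Poly.fired 4 (a , a') (b , b') 3)
fired-pos (b4 refl) {a , a'} {b , b'} pa pb 3 lt =
  subst Pos (cong₂ _,_ (solve 4 (eq proj₁) refl a a' b b') (solve 4 (eq proj₂) refl a a' b b')) pb
  where
  eq : (Polynomial 4 × Polynomial 4 → Polynomial 4) → ∀ a a' b b' → Polynomial 4 × Polynomial 4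
  eq π a a' b b' = π (b , b') := π (Poly.fired 4 (a , a') (b , b') 4)
fired-pos (b4 refl) pa pb (suc (suc (suc (suc j)))) (s≤s (s≤s (s≤s (s≤s ()))))
fired-pos (b5 refl) {a} {b} pa pb 1 lt =
  subst Pos (sym (cong (_⊕ κ 5 a) (⊖-involutive b))) (Pos-⊕ pb (Pos-κ (s≤s (s≤s (s≤s z≤n))) (b5 refl) pa))
fired-pos (b5 refl) {a , a'} {b , b'} pa pb 2 lt =
  subst Pos (cong₂ _,_ (solve 4 (eq proj₁) refl a a' b b') (solve 4 (eq proj₂) refl a a' b b'))
    (Pos-⊕ (Pos-κ (s≤s (s≤s (s≤s z≤n))) (b5 refl) pa) (Pos-κ (s≤s (s≤s (s≤s z≤n))) (b5 refl) pb))
  where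
  eq : (Polynomial 4 × Polynomial 4 → Polynomial 4) → ∀ a a' b b' → Polynomial 4 × Polynomial 4
  eq π a a' b b' = π (Poly.κ 5 (a , a') Poly.⊕ Poly.κ 5 (b , b')) := π (Poly.fired 5 (a , a') (b , b') 3)
fired-pos (b5 refl) {a , a'} {b , b'} pa pb 3 lt =
  subst Pos (cong₂ _,_ (solve 4 (eq proj₁) refl a a' b b') (solve 4 (eq proj₂) refl a a' b b'))
    (Pos-⊕ pa (Pos-κ (s≤s (s≤s (s≤s z≤n))) (b5 refl) pb))
  where
  eq : (Polynomial 4 × Polynomial 4 → Polynomial 4) → ∀ a a' b b' → Polynomial 4 × Polynomial 4
  eq π a a' b b' = π ((a , a') Poly.⊕ Poly.κ 5 (b , b')) := π (Poly.fired 5 (a , a') (b , b') 4)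
fired-pos (b5 refl) {a , a'} {b , b'} pa pb 4 lt =
  subst Pos (cong₂ _,_ (solve 4 (eq proj₁) refl a a' b b') (solve 4 (eq proj₂) refl a a' b b')) pb
  where
  eq : (Polynomial 4 × Polynomial 4 → Polynomial 4) → ∀ a a' b b' → Polynomial 4 × Polynomial 4
  eq π a a' b b' = π (b , b') := π (Poly.fired 5 (a , a') (b , b') 5)
fired-pos (b5 refl) pa pb (suc (suc (suc (suc (suc j))))) (s≤s (s≤s (s≤s (s≤s (s≤s ())))))

-- Words built at the right end, where star operations act

infixl 5 _▸_
data Sn (A : Set) : Set where
  ε   : Sn A
  _▸_ : Sn A → A → Sn A

module _ {A : Set} where

  infixl 5 _⧺_
  _⧺_ : Sn A → Sn A → Sn A
  u ⧺ ε = u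
  u ⧺ (v ▸ s) = (u ⧺ v) ▸ s

  size : Sn A → ℕ
  size ε = 0
  size (u ▸ s) = suc (size u)

  ⟦_⟧ : Sn A → List A
  ⟦ ε ⟧ = []
  ⟦ u ▸ s ⟧ = ⟦ u ⟧ ++ [ s ]

  ⟦⧺⟧ : ∀ u v → ⟦ u ⧺ v ⟧ ≡ ⟦ u ⟧ ++ ⟦ v ⟧
  ⟦⧺⟧ u ε = sym (Listₚ.++-identityʳ ⟦ u ⟧)
  ⟦⧺⟧ u (v ▸ s) = trans (cong (_++ [ s ]) (⟦⧺⟧ u v)) (Listₚ.++-assoc ⟦ u ⟧ ⟦ v ⟧ [ s ])

  ⧺-assoc : ∀ u v w → (u ⧺ v) ⧺ w ≡ u ⧺ (v ⧺ w)
  ⧺-assoc u v ε = refl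
  ⧺-assoc u v (w ▸ s) = cong (_▸ s) (⧺-assoc u v w)

  length-⟦⟧ : ∀ u → length ⟦ u ⟧ ≡ size u
  length-⟦⟧ ε = refl
  length-⟦⟧ (u ▸ s) = trans (Listₚ.length-++ ⟦ u ⟧) (trans (ℕₚ.+-comm _ 1) (cong suc (length-⟦⟧ u)))

  size-⧺ : ∀ u v → size (u ⧺ v) ≡ size u + size v
  size-⧺ u ε = sym (ℕₚ.+-identityʳ _)
  size-⧺ u (v ▸ s) = trans (cong suc (size-⧺ u v)) (sym (ℕₚ.+-suc _ _))

  private
    snoc-view : ∀ w → Σ (Sn A) λ u → ⟦ u ⟧ ≡ reverse w
    snoc-view [] = ε , refl
    snoc-view (s ∷ w) with u , eq ← snoc-view w =
      u ▸ s , trans (cong (_++ [ s ]) eq) (sym (Listₚ.unfold-reverse s w))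

  snoc : ∀ w → Σ (Sn A) λ u → ⟦ u ⟧ ≡ w
  snoc w with u , eq ← snoc-view (reverse w) = u , trans eq (Listₚ.reverse-involutive w)

  -- Indexed by the last letter, where the next letter is appended; `alt` fixes the first letter
  -- instead, and `first` converts between the two.
  altʳ : A → A → ℕ → Sn A
  altʳ l r zero = ε
  altʳ l r (suc i) = altʳ r l i ▸ l

  size-altʳ : ∀ l r i → size (altʳ l r i) ≡ i
  size-altʳ l r zero = refl
  size-altʳ l r (suc i) = cong suc (size-altʳ r l i)

  -- For i = 0 this is the letter that would come next.
  first : A → A → ℕ → A
  first l r zero = r
  first l r (suc i) = first r l i

  first-▸ : ∀ y l r i → (y ▸ first l r (suc i)) ⧺ altʳ l r i ≡ y ⧺ altʳ l r (suc i)
  first-▸ y l r zero = refl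
  first-▸ y l r (suc i) = cong (_▸ l) (first-▸ y r l i)

bond-suc : ∀ {m} → Bond m → Σ ℕ λ k → suc k ≡ m
bond-suc (b2 refl) = 1 , refl
bond-suc (b3 refl) = 2 , refl
bond-suc (b4 refl) = 3 , refl
bond-suc (b5 refl) = 4 , refl

-- Words up to commutation

module Trace {A : Set} (Com : A → A → Set) (Com-sym : ∀ {s t} → Com s t → Com t s) where

  infix 4 _~_
  data _~_ : Sn A → Sn A → Set where
    ~-refl  : ∀ {u} → u ~ u
    ~-trans : ∀ {u v w} → u ~ v → v ~ w → u ~ w
    ~-▸     : ∀ {u v} s → u ~ v → u ▸ s ~ v ▸ s
    ~-swap  : ∀ {u s t} → Com s t → u ▸ s ▸ t ~ u ▸ t ▸ s

  ~-sym : ∀ {u v} → u ~ v → v ~ u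
  ~-sym ~-refl = ~-refl
  ~-sym (~-trans e f) = ~-trans (~-sym f) (~-sym e)
  ~-sym (~-▸ s e) = ~-▸ s (~-sym e)
  ~-sym (~-swap c) = ~-swap (Com-sym c)

  ~-reflexive : ∀ {u v} → u ≡ v → u ~ v
  ~-reflexive refl = ~-refl

  ~-⧺ : ∀ {u v} z → u ~ v → u ⧺ z ~ v ⧺ z
  ~-⧺ ε e = e
  ~-⧺ (z ▸ s) e = ~-▸ s (~-⧺ z e)

  ~-size : ∀ {u v} → u ~ v → size u ≡ size v
  ~-size ~-refl = refl
  ~-size (~-trans e f) = trans (~-size e) (~-size f)
  ~-size (~-▸ s e) = cong suc (~-size e)
  ~-size (~-swap c) = refl

  data LastLetters : Sn A → A → Sn A → A → Set where
    same : ∀ {u v s} → u ~ v → LastLetters u s v s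
    diff : ∀ {u v s t} w → Com s t → u ~ w ▸ t → v ~ w ▸ s → LastLetters u s v t

  -- Levi's lemma for traces. Transitivity is the only case with content: when two exchanges meet,
  -- the middle prefix `v` ends in one letter by the first exchange and in another by the second,
  -- and comparing these two endings is the same question for a shorter word.
  levi : ∀ {u s v t} → u ▸ s ~ v ▸ t → LastLetters u s v t
  levi e = go _ ℕₚ.≤-refl e
    where
    go : ∀ k {u s v t} → size u ≤ k → u ▸ s ~ v ▸ t → LastLetters u s v t
    glue : ∀ k {u s v t x r} → size v ≤ k → LastLetters u s v t → LastLetters v t x r → LastLetters u s x r
    go k le ~-refl = same ~-refl
    go k le (~-▸ s e) = same e
    go k le (~-swap c) = diff _ (Com-sym c) ~-refl ~-refl
    go k le (~-trans {v = ε} e f) with () ← ~-size e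
    go k le (~-trans {v = v ▸ t} e f) = glue k le′ (go k le e) (go k le′ f)
      where le′ = ℕₚ.≤-trans (ℕₚ.≤-reflexive (ℕₚ.suc-injective (sym (~-size e)))) le
    glue k le (same e) (same f) = same (~-trans e f)
    glue k le (same e) (diff w c f g) = diff w c (~-trans e f) g
    glue k le (diff w c e f) (same g) = diff w c e (~-trans (~-sym g) f)
    glue zero le (diff w c e f) (diff w′ c′ e′ f′) with () ← ℕₚ.≤-trans (ℕₚ.≤-reflexive (sym (~-size f))) le
    glue (suc k) le (diff w c e f) (diff w′ c′ e′ f′)
      with go k (ℕₚ.≤-pred (ℕₚ.≤-trans (ℕₚ.≤-reflexive (sym (~-size f))) le)) (~-trans (~-sym f) e′)
    ... | same g = same (~-trans e (~-trans (~-▸ _ g) (~-sym f′)))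
    ... | diff x d g h = diff (x ▸ _) d
            (~-trans e (~-trans (~-▸ _ g) (~-swap (Com-sym c′))))
            (~-trans f′ (~-trans (~-▸ _ h) (~-swap c)))

  D : Sn A → A → Set
  D u s = Σ (Sn A) λ v → u ~ v ▸ s

  D-~ : ∀ {u v s} → u ~ v → D u s → D v s
  D-~ e (w , f) = w , ~-trans (~-sym e) f

  D-▸⁻ : ∀ {u s t} → D (u ▸ s) t → t ≡ s ⊎ (Com s t × D u t)
  D-▸⁻ (v , e) with levi e
  ... | same f = inj₁ refl
  ... | diff w c f g = inj₂ (c , w , f)

  ~-cancel : (∀ {s} → ¬ Com s s) → ∀ {u v s} → u ▸ s ~ v ▸ s → u ~ v
  ~-cancel irr e with levi e
  ... | same f = f
  ... | diff w c f g = ⊥-elim (irr c)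

module _ {A : Set} where

  ε-⧺ : ∀ (u : Sn A) → ε ⧺ u ≡ u
  ε-⧺ ε = refl
  ε-⧺ (u ▸ s) = cong (_▸ s) (ε-⧺ u)

  first-involutive : ∀ i (s t : A) → first (first s t i) (first s t (suc i)) i ≡ s
  first-involutive zero s t = refl
  first-involutive (suc i) s t = first-involutive i s t

  first-elim : ∀ (P : A → A → Set) i {s t} → P s t → P t s → P (first s t i) (first s t (suc i))
  first-elim P zero p q = q
  first-elim P (suc i) p q = first-elim P i q p

bond-long : ∀ {m} → Bond m → m ≡ 2 ⊎ 3 ≤ m
bond-long (b2 e) = inj₁ e
bond-long (b3 refl) = inj₂ (s≤s (s≤s (s≤s z≤n)))
bond-long (b4 refl) = inj₂ (s≤s (s≤s (s≤s z≤n)))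
bond-long (b5 refl) = inj₂ (s≤s (s≤s (s≤s z≤n)))

data Letters {A : Set} (P : A → Set) : Sn A → Set where
  ε   : Letters P ε
  _▸_ : ∀ {u s} → Letters P u → P s → Letters P (u ▸ s)

Letters-map : ∀ {A : Set} {P Q : A → Set} → (∀ {s} → P s → Q s) → ∀ {u} → Letters P u → Letters Q u
Letters-map f ε = ε
Letters-map f (ps ▸ p) = Letters-map f ps ▸ f p

Letters-⧺ : ∀ {A : Set} {P : A → Set} {u v} → Letters P u → Letters P v → Letters P (u ⧺ v)
Letters-⧺ ps ε = ps
Letters-⧺ ps (qs ▸ q) = Letters-⧺ ps qs ▸ q

-- The action of the Coxeter group by the numbers game

module StarOperations {n : ℕ} (M : CoxeterMatrix n)
  (M-sym : ∀ s t → M s t ≡ M t s) (M-diag : ∀ s → M s s ≡ 1) (bond : ∀ {s t} → s ≢ t → Bond (M s t)) where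

  open Coxeter M public

  State : Set
  State = Fin n → K

  fire : State → Fin n → State
  fire c s t with t ≟ᶠ s
  ... | yes _ = ⊖ c s
  ... | no _ = c t ⊕ κ (M s t) (c s)

  fire-same : ∀ c s → fire c s s ≡ ⊖ c s
  fire-same c s with s ≟ᶠ s
  ... | yes _ = refl
  ... | no ne = ⊥-elim (ne refl)

  fire-other : ∀ c {s t} → t ≢ s → fire c s t ≡ c t ⊕ κ (M s t) (c s)
  fire-other c {s} {t} ne with t ≟ᶠ s
  ... | yes eq = ⊥-elim (ne eq)
  ... | no _ = refl

  fire-cong : ∀ {c d} → (∀ t → c t ≡ d t) → ∀ s t → fire c s t ≡ fire d s t
  fire-cong eq s t with t ≟ᶠ s
  ... | yes _ = cong ⊖_ (eq s)
  ... | no _ = cong₂ (λ x y → x ⊕ κ (M s t) y) (eq t) (eq s)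

  run : State → Word → State
  run = foldl fire

  run-cong : ∀ {c d} → (∀ t → c t ≡ d t) → ∀ w t → run c w t ≡ run d w t
  run-cong eq [] = eq
  run-cong eq (s ∷ w) = run-cong (fire-cong eq s) w

  run-++ : ∀ c u v → run c (u ++ v) ≡ run (run c u) v
  run-++ c u v = Listₚ.foldl-++ fire c u v

  -- Since `κ` is additive, a vertex `r` outside the pair feels only the total amounts fired at `s`
  -- and at `t`. So the four values iterated by `rounds` describe the play everywhere, and the maps
  -- `κ` of different bonds never have to commute.
  run-pow : ∀ {m s t} → M s t ≡ m → s ≢ t → ∀ j c q →
    c s ≡ proj₁ (proj₁ q) → c t ≡ proj₂ (proj₁ q) → ∀ r d →
    (r ≢ s → r ≢ t → c r ≡ d ⊕ κ (M s r) (proj₁ (proj₂ q)) ⊕ κ (M t r) (proj₂ (proj₂ q))) →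
    let q′ = rounds m j q ; c′ = run c (pow (s ∷ t ∷ []) j) in
    c′ s ≡ proj₁ (proj₁ q′) × c′ t ≡ proj₂ (proj₁ q′) ×
    (r ≢ s → r ≢ t → c′ r ≡ d ⊕ κ (M s r) (proj₁ (proj₂ q′)) ⊕ κ (M t r) (proj₂ (proj₂ q′)))
  run-pow em ne zero c q es et r d er = es , et , er
  run-pow {m} {s} {t} refl ne (suc j) c ((a , b) , (A , B)) refl refl r d er =
    run-pow refl ne j (fire c₁ t) _ s-val t-val r d r-val
    where
    c₁ = fire c s
    b′ = b ⊕ κ m a
    c₁t : c₁ t ≡ b′
    c₁t = fire-other c (λ eq → ne (sym eq))
    s-val : fire c₁ t s ≡ ⊖ a ⊕ κ m b′
    s-val = trans (fire-other c₁ ne) (cong₂ _⊕_ (fire-same c s) (cong₂ κ (M-sym t s) c₁t))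
    t-val : fire c₁ t t ≡ ⊖ b′
    t-val = trans (fire-same c₁ t) (cong ⊖_ c₁t)
    r-val : r ≢ s → r ≢ t → fire c₁ t r ≡ d ⊕ κ (M s r) (A ⊕ a) ⊕ κ (M t r) (B ⊕ b′)
    r-val rs rt = begin
      fire c₁ t r                                      ≡⟨ fire-other c₁ rt ⟩
      c₁ r ⊕ κ (M t r) (c₁ t)                          ≡⟨ cong₂ (λ x y → x ⊕ κ (M t r) y) (fire-other c rs) c₁t ⟩
      c r ⊕ κ (M s r) a ⊕ κ (M t r) b′                 ≡⟨ cong (λ x → x ⊕ κ (M s r) a ⊕ κ (M t r) b′) (er rs rt) ⟩
      (d ⊕ kA ⊕ kB) ⊕ ka ⊕ kb                         ≡⟨ ⊕-assoc (d ⊕ kA ⊕ kB) ka kb ⟩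
      (d ⊕ kA ⊕ kB) ⊕ (ka ⊕ kb)                       ≡⟨ ⊕-interchange (d ⊕ kA) kB ka kb ⟩
      ((d ⊕ kA) ⊕ ka) ⊕ (kB ⊕ kb)                     ≡⟨ cong (_⊕ (kB ⊕ kb)) (⊕-assoc d kA ka) ⟩
      d ⊕ (kA ⊕ ka) ⊕ (kB ⊕ kb)                       ≡⟨ cong₂ (λ x y → d ⊕ x ⊕ y) (κ-⊕ (M s r) A a) (κ-⊕ (M t r) B b′) ⟨
      d ⊕ κ (M s r) (A ⊕ a) ⊕ κ (M t r) (B ⊕ b′)       ∎
      where
      open ≡-Reasoning
      kA = κ (M s r) A
      kB = κ (M t r) B
      ka = κ (M s r) a
      kb = κ (M t r) b′

  fire-twice : ∀ c s r → fire (fire c s) s r ≡ c r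
  fire-twice c s r with r ≟ᶠ s
  ... | yes refl = trans (cong ⊖_ (fire-same c s)) (⊖-involutive (c s))
  ... | no ne = begin
      fire c s r ⊕ κ (M s r) (fire c s s)            ≡⟨ cong₂ (λ x y → x ⊕ κ (M s r) y) (fire-other c ne) (fire-same c s) ⟩
      c r ⊕ κ (M s r) (c s) ⊕ κ (M s r) (⊖ c s)      ≡⟨ ⊕-assoc (c r) (κ (M s r) (c s)) (κ (M s r) (⊖ c s)) ⟩
      c r ⊕ (κ (M s r) (c s) ⊕ κ (M s r) (⊖ c s))    ≡⟨ cong (c r ⊕_) (κ-cancel (M s r) (c s)) ⟩
      c r ⊕ 𝟎                                        ≡⟨ ⊕-identityʳ (c r) ⟩
      c r                                            ∎
      where open ≡-Reasoning

  run-relator : ∀ c s t r → run c (pow (s ∷ t ∷ []) (M s t)) r ≡ c r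
  run-relator c s t r with s ≟ᶠ t
  ... | yes refl rewrite M-diag s = fire-twice c s r
  ... | no ne with r ≟ᶠ s | r ≟ᶠ t
                 | run-pow refl ne (M s t) c ((c s , c t) , (𝟎 , 𝟎)) refl refl r (c r)
                     (λ _ _ → sym (trans (cong₂ (λ x y → c r ⊕ x ⊕ y) (κ-𝟎 (M s r)) (κ-𝟎 (M t r)))
                                    (trans (⊕-identityʳ _) (⊕-identityʳ _))))
  ... | yes refl | _ | es , _ , _ = trans es (cong (λ q → proj₁ (proj₁ q)) (rounds-cycle (bond ne) (c r) (c t)))
  ... | no _ | yes refl | _ , et , _ = trans et (cong (λ q → proj₂ (proj₁ q)) (rounds-cycle (bond ne) (c s) (c r)))
  ... | no rs | no rt | _ , _ , er = begin
      _   ≡⟨ er rs rt ⟩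
      _   ≡⟨ cong (λ q → c r ⊕ κ (M s r) (proj₁ (proj₂ q)) ⊕ κ (M t r) (proj₂ (proj₂ q))) (rounds-cycle (bond ne) (c s) (c t)) ⟩
      c r ⊕ κ (M s r) 𝟎 ⊕ κ (M t r) 𝟎   ≡⟨ cong₂ (λ x y → c r ⊕ x ⊕ y) (κ-𝟎 (M s r)) (κ-𝟎 (M t r)) ⟩
      c r ⊕ 𝟎 ⊕ 𝟎                       ≡⟨ trans (⊕-identityʳ _) (⊕-identityʳ _) ⟩
      c r                               ∎
      where open ≡-Reasoning

  run-≈ : ∀ {u v} → u ≈ v → ∀ c r → run c u r ≡ run c v r
  run-≈ (rel a b s t) c r = begin
      run c (a ++ p ++ b) r           ≡⟨ cong (λ f → f r) (run-++ c a (p ++ b)) ⟩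
      run (run c a) (p ++ b) r        ≡⟨ cong (λ f → f r) (run-++ (run c a) p b) ⟩
      run (run (run c a) p) b r       ≡⟨ run-cong (run-relator (run c a) s t) b r ⟩
      run (run c a) b r               ≡⟨ cong (λ f → f r) (run-++ c a b) ⟨
      run c (a ++ b) r                ∎
      where
      open ≡-Reasoning
      p = pow (s ∷ t ∷ []) (M s t)
  run-≈ ≈-refl c r = refl
  run-≈ (≈-sym e) c r = sym (run-≈ e c r)
  run-≈ (≈-trans e f) c r = trans (run-≈ e c r) (run-≈ f c r)

  c₀ : State
  c₀ _ = (ℤ.+ 1 , ℤ.+ 0)

  act : Sn (Fin n) → State
  act u = run c₀ ⟦ u ⟧

  act-▸ : ∀ u s t → act (u ▸ s) t ≡ fire (act u) s t
  act-▸ u s t = cong (λ f → f t) (run-++ c₀ ⟦ u ⟧ [ s ])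

  act-last : ∀ u s → act (u ▸ s) s ≡ ⊖ act u s
  act-last u s = trans (act-▸ u s s) (fire-same (act u) s)

  act-other : ∀ u {s t} → t ≢ s → act (u ▸ s) t ≡ act u t ⊕ κ (M s t) (act u s)
  act-other u {s} {t} ne = trans (act-▸ u s t) (fire-other (act u) ne)

  -- `l` has just been fired, so it holds the negative of the last amount; `r` would be played next,
  -- so it holds the next amount.
  act-altʳ : ∀ {m} i l r y → l ≢ r → M l r ≡ m →
    let x = fired m (act y (first l r i)) (act y (first l r (suc i))) in
    act (y ⧺ altʳ l r i) l ≡ ⊖ x i × act (y ⧺ altʳ l r i) r ≡ x (suc i)
  act-altʳ zero l r y ne em = sym (⊖-involutive _) , refl
  act-altʳ (suc i) l r y ne refl
    with el , er ← act-altʳ i r l y (λ eq → ne (sym eq)) (M-sym r l) =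
      trans (act-last u l) (cong ⊖_ er) ,
      trans (act-other u (λ eq → ne (sym eq))) (cong₂ (λ x y → x ⊕ κ (M l r) y) el er)
    where u = y ⧺ altʳ r l i

  act-altʳ-pos : ∀ i l r y → l ≢ r → i < M l r → Pos (act y (first l r i)) → Pos (act y (first l r (suc i))) →
    Pos (act (y ⧺ altʳ l r i) r)
  act-altʳ-pos i l r y ne lt pf pn =
    subst Pos (sym (proj₂ (act-altʳ i l r y ne refl))) (fired-pos (bond ne) pf pn i lt)

  act-first-pos : ∀ i {l r} y → Pos (act y l) → Pos (act y r) → Pos (act y (first l r i))
  act-first-pos zero y pl pr = pr
  act-first-pos (suc i) y pl pr = act-first-pos i y pr pl

  W : Set
  W = Sn (Fin n)

  -- The relation is left open for two uses: equality in the group, where a full braid is rewritten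
  -- and a square cancelled, and commutation of FC words, where a square or a braid of length at
  -- least 3 is a contradiction.
  module Dihedral (_∼_ : W → W → Set) (∼-trans : ∀ {u v w} → u ∼ v → v ∼ w → u ∼ w)
    (∼-▸ : ∀ {u v} s → u ∼ v → (u ▸ s) ∼ (v ▸ s)) (∼-refl : ∀ {u} → u ∼ u) where

    ∼-⧺ : ∀ {u v} z → u ∼ v → (u ⧺ z) ∼ (v ⧺ z)
    ∼-⧺ ε e = e
    ∼-⧺ (z ▸ s) e = ∼-▸ s (∼-⧺ z e)

    ∼-reflexive : ∀ {u v} → u ≡ v → u ∼ v
    ∼-reflexive refl = ∼-refl

    Drop : W → Fin n → Set
    Drop u s = Σ W λ v → (u ∼ (v ▸ s)) × size v < size u

    data Unwound (u : W) (s t : Fin n) : Set where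
      positive : Pos (act u s) → Unwound u s t
      braid    : ∀ y → size y + M s t ≤ size u → u ∼ (y ⧺ altʳ t s (M s t)) → Unwound u s t
      double   : ∀ y j → size y + suc (suc j) ≤ size u →
                 u ∼ ((y ▸ first t s (suc j) ▸ first t s (suc j)) ⧺ altʳ t s j) → Unwound u s t

    -- Strip the alternating tail of u letter by letter: when neither letter is a descent
    -- of what remains, the values there are positive, and so is the value at s.
    unwind : (∀ {u v} → u ∼ v → ∀ r → act u r ≡ act v r) → ∀ u s t → s ≢ t →
      (∀ y z → size y < size u → u ∼ (y ⧺ z) → ∀ r → Pos (act y r) ⊎ Drop y r) →
      ∀ k j y → suc j + k ≡ M s t → size y + suc j ≤ size u → u ∼ (y ⧺ altʳ t s (suc j)) → Unwound u s t
    unwind inv u s t ne drop zero j y ek le e = braid y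
      (subst (λ m → size y + m ≤ size u) m≡ le) (∼-trans e (∼-reflexive (cong (λ m → y ⧺ altʳ t s m) m≡)))
      where m≡ = trans (sym (ℕₚ.+-identityʳ (suc j))) ek
    unwind inv u s t ne drop (suc k) j y ek le e
      -- `first t s (suc j)` is the letter that starts the tail and `first t s (suc (suc j))` is the
      -- other one: if `y` can end in the former, a square appears; if in the latter, the tail grows
      -- by a letter.
      with drop y _ (ℕₚ.≤-trans (ℕₚ.m<m+n (size y) (s≤s z≤n)) le) e (first t s (suc j))
         | drop y _ (ℕₚ.≤-trans (ℕₚ.m<m+n (size y) (s≤s z≤n)) le) e (first t s (suc (suc j)))
    ... | inj₂ (v , ev , lt) | _ = double v j
          (ℕₚ.≤-trans (ℕₚ.≤-trans (ℕₚ.≤-reflexive (ℕₚ.+-suc (size v) (suc j))) (ℕₚ.+-monoˡ-≤ (suc j) lt)) le)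
          (∼-trans e (∼-trans (∼-reflexive (sym (first-▸ y t s j))) (∼-⧺ (altʳ t s j) (∼-▸ _ ev))))
    ... | inj₁ _ | inj₂ (v , ev , lt) = unwind inv u s t ne drop k (suc j) v
          (trans (cong suc (sym (ℕₚ.+-suc j k))) ek)
          (ℕₚ.≤-trans (ℕₚ.≤-trans (ℕₚ.≤-reflexive (ℕₚ.+-suc (size v) (suc j))) (ℕₚ.+-monoˡ-≤ (suc j) lt)) le)
          (∼-trans e (∼-trans (∼-⧺ (altʳ t s (suc j)) ev) (∼-reflexive (first-▸ v t s (suc j)))))
    ... | inj₁ pf | inj₁ pn = positive (subst Pos (sym (inv e s))
          (act-altʳ-pos (suc j) t s y (λ eq → ne (sym eq))
            (subst (suc j <_) (trans ek (M-sym s t)) (ℕₚ.m<m+n (suc j) (s≤s z≤n))) pf pn))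

  -- Equality in the group, descents and length

  ≈-++ : ∀ a {u v} b → u ≈ v → (a ++ u ++ b) ≈ (a ++ v ++ b)
  ≈-++ a b (rel a′ b′ s t) = subst₂ _≈_ (shuffle (pow (s ∷ t ∷ []) (M s t))) (shuffle []) (rel (a ++ a′) (b′ ++ b) s t)
    where
    shuffle : ∀ p → (a ++ a′) ++ p ++ b′ ++ b ≡ a ++ (a′ ++ p ++ b′) ++ b
    shuffle p = begin
      (a ++ a′) ++ p ++ b′ ++ b    ≡⟨ Listₚ.++-assoc a a′ _ ⟩
      a ++ a′ ++ p ++ b′ ++ b      ≡⟨ cong (λ x → a ++ a′ ++ x) (Listₚ.++-assoc p b′ b) ⟨
      a ++ a′ ++ (p ++ b′) ++ b    ≡⟨ cong (a ++_) (Listₚ.++-assoc a′ (p ++ b′) b) ⟨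
      a ++ (a′ ++ p ++ b′) ++ b    ∎
      where open ≡-Reasoning
  ≈-++ a b ≈-refl = ≈-refl
  ≈-++ a b (≈-sym e) = ≈-sym (≈-++ a b e)
  ≈-++ a b (≈-trans e f) = ≈-trans (≈-++ a b e) (≈-++ a b f)

  ≈-reflexive : ∀ {u v} → u ≡ v → u ≈ v
  ≈-reflexive refl = ≈-refl

  ≈-++ʳ : ∀ {u v} b → u ≈ v → (u ++ b) ≈ (v ++ b)
  ≈-++ʳ b = ≈-++ [] b

  ≈-++ˡ : ∀ a {u v} → u ≈ v → (a ++ u) ≈ (a ++ v)
  ≈-++ˡ a {u} {v} e = subst₂ (λ x y → (a ++ x) ≈ (a ++ y)) (Listₚ.++-identityʳ u) (Listₚ.++-identityʳ v) (≈-++ a [] e)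

  ss≈[] : ∀ s → (s ∷ s ∷ []) ≈ []
  ss≈[] s = subst (λ m → (pow (s ∷ s ∷ []) m ++ []) ≈ []) (M-diag s) (rel [] [] s s)

  reverse-inverseˡ : ∀ u → (reverse u ++ u) ≈ []
  reverse-inverseˡ [] = ≈-refl
  reverse-inverseˡ (s ∷ u) = ≈-trans
    (≈-reflexive (trans (cong (_++ s ∷ u) (Listₚ.unfold-reverse s u)) (Listₚ.++-assoc (reverse u) [ s ] (s ∷ u))))
    (≈-trans (≈-++ (reverse u) u (ss≈[] s)) (reverse-inverseˡ u))

  ≈-from-quotient : ∀ u v → (u ++ reverse v) ≈ [] → u ≈ v
  ≈-from-quotient u v e = ≈-trans
    (≈-trans (≈-reflexive (sym (Listₚ.++-identityʳ u)))
      (≈-trans (≈-++ˡ u (≈-sym (reverse-inverseˡ v))) (≈-reflexive (sym (Listₚ.++-assoc u (reverse v) v)))))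
    (≈-++ʳ v e)

  infix 4 _≋_
  -- A record keeps the snoc words visible to unification, which cannot invert `⟦_⟧`.
  record _≋_ (u v : W) : Set where
    constructor mk≋
    field words : ⟦ u ⟧ ≈ ⟦ v ⟧
  open _≋_ public

  ≋-refl : ∀ {u} → u ≋ u
  ≋-refl = mk≋ ≈-refl

  ≋-reflexive : ∀ {u v} → u ≡ v → u ≋ v
  ≋-reflexive refl = ≋-refl

  ≋-sym : ∀ {u v} → u ≋ v → v ≋ u
  ≋-sym (mk≋ e) = mk≋ (≈-sym e)

  ≋-trans : ∀ {u v w} → u ≋ v → v ≋ w → u ≋ w
  ≋-trans (mk≋ e) (mk≋ f) = mk≋ (≈-trans e f)

  ≋-▸ : ∀ {u v} s → u ≋ v → u ▸ s ≋ v ▸ s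
  ≋-▸ s (mk≋ e) = mk≋ (≈-++ʳ [ s ] e)

  ≋-cancel : ∀ u s → u ▸ s ▸ s ≋ u
  ≋-cancel u s = mk≋ (≈-trans (≈-reflexive (Listₚ.++-assoc ⟦ u ⟧ [ s ] [ s ]))
    (≈-trans (≈-++ˡ ⟦ u ⟧ (ss≈[] s)) (≈-reflexive (Listₚ.++-identityʳ ⟦ u ⟧))))

  ≋-flip : ∀ {u v} s → u ▸ s ≋ v → u ≋ v ▸ s
  ≋-flip {u} s e = ≋-trans (≋-sym (≋-cancel u s)) (≋-▸ s e)

  ≋-act : ∀ {u v} → u ≋ v → ∀ r → act u r ≡ act v r
  ≋-act (mk≋ e) = run-≈ e c₀

  private module Group = Dihedral _≋_ ≋-trans ≋-▸ ≋-refl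
  open Group public using () renaming (∼-⧺ to ≋-⧺)

  -- The quotient of the two sides is literally a relator: (st)^m for odd m and (ts)^m for even m,
  -- because `altʳ s t m` starts with `s` exactly when m is odd.
  braid-relation : ∀ {m s t} → Bond m → M s t ≡ m → altʳ s t m ≋ altʳ t s m
  braid-relation {_} {s} {t} (b2 refl) e = mk≋ (≈-from-quotient _ _ (subst (λ m → (pow (t ∷ s ∷ []) m ++ []) ≈ []) (trans (M-sym t s) e) (rel [] [] t s)))
  braid-relation {_} {s} {t} (b3 refl) e = mk≋ (≈-from-quotient _ _ (subst (λ m → (pow (s ∷ t ∷ []) m ++ []) ≈ []) e (rel [] [] s t)))
  braid-relation {_} {s} {t} (b4 refl) e = mk≋ (≈-from-quotient _ _ (subst (λ m → (pow (t ∷ s ∷ []) m ++ []) ≈ []) (trans (M-sym t s) e) (rel [] [] t s)))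
  braid-relation {_} {s} {t} (b5 refl) e = mk≋ (≈-from-quotient _ _ (subst (λ m → (pow (s ∷ t ∷ []) m ++ []) ≈ []) e (rel [] [] s t)))

  ⧺-≋ : ∀ y {u v} → u ≋ v → y ⧺ u ≋ y ⧺ v
  ⧺-≋ y {u} {v} (mk≋ e) = mk≋ (subst₂ _≈_ (sym (⟦⧺⟧ y u)) (sym (⟦⧺⟧ y v)) (≈-++ˡ ⟦ y ⟧ e))

  -- Sign and exchange come out of one induction on size. Unwinding either stops at a prefix with
  -- both values positive, or fills the tail up to length m, where the braid relation makes `s` the
  -- last letter, or meets a square, whose removal leaves a shorter word for the induction.
  descent : ∀ k u → size u ≤ k → ∀ s → Pos (act u s) ⊎ Group.Drop u s
  descent k ε le s = inj₁ (pos 1 0 (s≤s z≤n))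
  descent (suc k) (u ▸ t) (s≤s le) s with s ≟ᶠ t
  ... | yes refl = inj₂ (u , ≋-refl , ℕₚ.≤-refl)
  ... | no ne = finish (Group.unwind ≋-act (u ▸ t) s t ne
                      (λ y _ lt _ r → descent k y (ℕₚ.≤-trans (ℕₚ.≤-pred lt) le) r)
                      m 0 u em (ℕₚ.≤-reflexive (ℕₚ.+-comm (size u) 1)) ≋-refl)
    where
    m = proj₁ (bond-suc (bond ne))
    em = proj₂ (bond-suc (bond ne))
    finish : Group.Unwound (u ▸ t) s t → Pos (act (u ▸ t) s) ⊎ Group.Drop (u ▸ t) s
    finish (Group.positive p) = inj₁ p
    finish (Group.braid y le e) = inj₂ (y ⧺ altʳ t s m ,
      ≋-trans e (≋-trans (⧺-≋ y (≋-sym (braid-relation (bond ne) refl)))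
        (≋-reflexive (cong (λ m → y ⧺ altʳ s t m) (sym em)))) ,
      ℕₚ.≤-trans (ℕₚ.≤-reflexive (trans (cong suc (trans (size-⧺ y (altʳ t s m)) (cong (size y +_) (size-altʳ t s m))))
        (trans (sym (ℕₚ.+-suc (size y) m)) (cong (size y +_) em)))) le)
    finish (Group.double y j le′ e) = shorter
      (descent k v (ℕₚ.≤-trans (ℕₚ.n≤1+n _) (ℕₚ.≤-trans (ℕₚ.≤-pred szv) le)) s)
      where
      v = y ⧺ altʳ t s j
      u≋v : u ▸ t ≋ v
      u≋v = ≋-trans e (≋-⧺ (altʳ t s j) (≋-cancel y (first t s (suc j))))
      szv : suc (suc (size v)) ≤ suc (size u)
      szv = ℕₚ.≤-trans (ℕₚ.≤-reflexive (trans (cong (λ x → suc (suc x)) (trans (size-⧺ y (altʳ t s j)) (cong (size y +_) (size-altʳ t s j))))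
        (sym (trans (ℕₚ.+-suc (size y) (suc j)) (cong suc (ℕₚ.+-suc (size y) j)))))) le′
      shorter : Pos (act v s) ⊎ Group.Drop v s → Pos (act (u ▸ t) s) ⊎ Group.Drop (u ▸ t) s
      shorter (inj₁ p) = inj₁ (subst Pos (sym (≋-act u≋v s)) p)
      shorter (inj₂ (w , e′ , lt)) = inj₂ (w , ≋-trans u≋v e′ , ℕₚ.≤-trans lt (ℕₚ.≤-trans (ℕₚ.≤-trans (ℕₚ.n≤1+n _) (ℕₚ.n≤1+n _)) szv))

  descentʷ : ∀ w s → Pos (run c₀ w s) ⊎ Σ Word λ v → w ≈ v ++ [ s ] × length v < length w
  descentʷ w s with u , refl ← snoc w with descent (size u) u ℕₚ.≤-refl s
  ... | inj₁ p = inj₁ p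
  ... | inj₂ (v , mk≋ e , lt) = inj₂ (⟦ v ⟧ , e , subst₂ _<_ (sym (length-⟦⟧ v)) (sym (length-⟦⟧ u)) lt)

  ≈-cancel : ∀ u s → (u ++ [ s ]) ++ [ s ] ≈ u
  ≈-cancel u s = ≈-trans (≈-reflexive (Listₚ.++-assoc u [ s ] [ s ]))
    (≈-trans (≈-++ˡ u (ss≈[] s)) (≈-reflexive (Listₚ.++-identityʳ u)))

  ≈-flip : ∀ {u v} s → u ≈ v ++ [ s ] → u ++ [ s ] ≈ v
  ≈-flip {v = v} s e = ≈-trans (≈-++ʳ [ s ] e) (≈-cancel v s)

  length-snoc : ∀ (u : Word) s → length (u ++ [ s ]) ≡ suc (length u)
  length-snoc u s = trans (Listₚ.length-++ u) (ℕₚ.+-comm (length u) 1)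

  run-snoc : ∀ u s → run c₀ (u ++ [ s ]) s ≡ ⊖ run c₀ u s
  run-snoc u s = trans (cong (λ f → f s) (run-++ c₀ u [ s ])) (fire-same (run c₀ u) s)

  HasLength-≈ : ∀ {u v k} → u ≈ v → HasLength u k → HasLength v k
  HasLength-≈ e ((w , we , wl) , min) = (w , ≈-trans we e , wl) , λ x xe → min x (≈-trans xe (≈-sym e))

  -- Any word for the product has a negative value at `s`, so by `descentʷ` it can be made to end in
  -- `s` without growing, and what precedes that `s` is a strictly shorter word for `u`.
  HasLength-snoc : ∀ {u k} s → HasLength u k → Pos (run c₀ u s) → HasLength (u ++ [ s ]) (suc k)
  HasLength-snoc {u} {k} s ((w , we , wl) , min) p =
    (w ++ [ s ] , ≈-++ʳ [ s ] we , trans (length-snoc w s) (cong suc wl)) , lower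
    where
    lower : ∀ v → v ≈ u ++ [ s ] → suc k ≤ length v
    lower v e with descentʷ v s
    ... | inj₁ q = ⊥-elim (Pos-⊖ p (subst Pos (trans (run-≈ e c₀ s) (run-snoc u s)) q))
    ... | inj₂ (v′ , e′ , lt) = ℕₚ.≤-trans (s≤s (min v′ (≈-trans (≈-sym (≈-flip s e′)) (≈-trans (≈-++ʳ [ s ] e) (≈-cancel u s))))) lt

  HasLength-drop : ∀ {u k} s → HasLength (u ++ [ s ]) (suc k) → length u ≡ k → Pos (run c₀ u s)
  HasLength-drop {u} s (_ , min) refl with descentʷ u s
  ... | inj₁ p = p
  ... | inj₂ (v , e , lt) = ⊥-elim (ℕₚ.<-asym lt (min v (≈-sym (≈-flip s e))))

  ¬RightDescent⇒Pos : ∀ {u k} s → HasLength u k → ¬ RightDescent u s → Pos (run c₀ u s)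
  ¬RightDescent⇒Pos {u} {k} s hl@((w , we , wl) , min) nd with descentʷ w s
  ... | inj₁ p = subst Pos (run-≈ we c₀ s) p
  ... | inj₂ (v , e , lt) = ⊥-elim (nd (k , length v , hl , ((v , ve , refl) , lower) , lt′))
    where
    lt′ : length v < k
    lt′ = subst (length v <_) wl lt
    ve : v ≈ u ++ [ s ]
    ve = ≈-trans (≈-sym (≈-flip s e)) (≈-++ʳ [ s ] we)
    lower : ∀ x → x ≈ u ++ [ s ] → length v ≤ length x
    lower x xe = ℕₚ.≤-pred (ℕₚ.≤-trans lt′ (ℕₚ.≤-trans (min (x ++ [ s ]) (≈-flip s xe)) (ℕₚ.≤-reflexive (length-snoc x s))))

  Pos⇒¬RightDescent : ∀ {u} s → Pos (run c₀ u s) → ¬ RightDescent u s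
  Pos⇒¬RightDescent s p (a , b , hu , ((v , e , refl) , _) , lt) =
    ℕₚ.<-asym lt (proj₂ (HasLength-snoc s hu p) v e)

  reverse-≈ : ∀ {u v} → u ≈ v → reverse u ≈ reverse v
  reverse-≈ {u} {v} e = ≈-from-quotient (reverse u) (reverse v)
    (≈-trans (≈-++ˡ (reverse u) (≈-trans (≈-reflexive (Listₚ.reverse-involutive v)) (≈-sym e))) (reverse-inverseˡ u))

  HasLength-reverse : ∀ {w k} → HasLength w k → HasLength (reverse w) k
  HasLength-reverse {w} ((v , e , l) , min) =
    (reverse v , reverse-≈ e , trans (Listₚ.length-reverse v) l) ,
    λ x xe → ℕₚ.≤-trans (min (reverse x) (≈-trans (reverse-≈ xe) (≈-reflexive (Listₚ.reverse-involutive w))))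
      (ℕₚ.≤-reflexive (Listₚ.length-reverse x))

  -- Fully commutative words

  Com : Fin n → Fin n → Set
  Com s t = M s t ≡ 2

  Com-sym : ∀ {s t} → Com s t → Com t s
  Com-sym {s} {t} c = trans (M-sym t s) c

  Com-irrefl : ∀ {s} → ¬ Com s s
  Com-irrefl {s} c with () ← trans (sym (M-diag s)) c

  3≤-¬Com : ∀ {s t} → 3 ≤ M s t → ¬ Com s t
  3≤-¬Com le c with s≤s (s≤s ()) ← subst (3 ≤_) c le

  3≤-≢ : ∀ {s t} → 3 ≤ M s t → s ≢ t
  3≤-≢ {s} le refl with s≤s () ← subst (3 ≤_) (M-diag s) le

  3≤-sym : ∀ {s t} → 3 ≤ M s t → 3 ≤ M t s
  3≤-sym {s} {t} = subst (3 ≤_) (M-sym s t)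

  open Trace Com Com-sym hiding (~-cancel) public

  ~-cancel : ∀ {u v s} → u ▸ s ~ v ▸ s → u ~ v
  ~-cancel = Trace.~-cancel Com Com-sym Com-irrefl

  ~⇒≋ : ∀ {u v} → u ~ v → u ≋ v
  ~⇒≋ ~-refl = ≋-refl
  ~⇒≋ (~-trans e f) = ≋-trans (~⇒≋ e) (~⇒≋ f)
  ~⇒≋ (~-▸ s e) = ≋-▸ s (~⇒≋ e)
  ~⇒≋ (~-swap {u} c) = ⧺-≋ u (braid-relation (b2 refl) (Com-sym c))

  ~-pull : ∀ {y t} i l r → Com t l → Com t r → (y ▸ t) ⧺ altʳ l r i ~ (y ⧺ altʳ l r i) ▸ t
  ~-pull zero l r cl cr = ~-refl
  ~-pull (suc i) l r cl cr = ~-trans (~-▸ l (~-pull i r l cr cl)) (~-swap cl)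

  -- `altʳ p p 2` is the square pp, so one predicate forbids squares together with long braids, and
  -- FC includes being reduced.
  data Long (p s : Fin n) : ℕ → Set where
    square : p ≡ s → Long p s 2
    braid  : 3 ≤ M p s → Long p s (M p s)

  FC : W → Set
  FC u = ∀ y p s {k} z → Long p s k → ¬ u ~ (y ⧺ altʳ p s k) ⧺ z

  FC-prefix : ∀ {u v} z → FC u → u ~ v ⧺ z → FC v
  FC-prefix z fc e y p s z′ lg f = fc y p s (z′ ⧺ z) lg
    (~-trans e (~-trans (~-⧺ z f) (~-reflexive (⧺-assoc (y ⧺ altʳ p s _) z′ z))))

  FC-~ : ∀ {u v} → FC u → u ~ v → FC v
  FC-~ = FC-prefix ε

  FC-square : ∀ {u v s} → FC u → ¬ u ~ v ▸ s ▸ s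
  FC-square {v = v} {s} fc = fc v s s ε (square refl)

  private module Traces = Dihedral _~_ ~-trans (λ s → ~-▸ s) ~-refl

  -- The unwinding is that of the group, but squares and braids of length at least 3 contradict FC,
  -- and a braid of length 2 is a commutation. So a descent is always visible by commutations alone.
  FC-descent : ∀ k {u} → size u ≤ k → FC u → ∀ s → Pos (act u s) ⊎ D u s
  FC-descent k {ε} le fc s = inj₁ (pos 1 0 (s≤s z≤n))
  FC-descent (suc k) {u ▸ t} (s≤s le) fc s with s ≟ᶠ t
  ... | yes refl = inj₂ (u , ~-refl)
  ... | no ne = finish (Traces.unwind (λ e → ≋-act (~⇒≋ e)) (u ▸ t) s t ne drop
                  (proj₁ m) 0 u (proj₂ m) (ℕₚ.≤-reflexive (ℕₚ.+-comm (size u) 1)) ~-refl)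
    where
    m = bond-suc (bond ne)
    drop : ∀ y z → size y < suc (size u) → u ▸ t ~ y ⧺ z → ∀ r → Pos (act y r) ⊎ Traces.Drop y r
    drop y z lt e r with FC-descent k (ℕₚ.≤-trans (ℕₚ.≤-pred lt) le) (FC-prefix z fc e) r
    ... | inj₁ p = inj₁ p
    ... | inj₂ (v , f) = inj₂ (v , f , ℕₚ.≤-reflexive (sym (~-size f)))
    finish : Traces.Unwound (u ▸ t) s t → Pos (act (u ▸ t) s) ⊎ D (u ▸ t) s
    finish (Traces.positive p) = inj₁ p
    finish (Traces.double y j _ e) = ⊥-elim (fc y _ _ (altʳ t s j) (square refl) e)
    finish (Traces.braid y _ e) with bond-long (bond ne)
    ... | inj₁ em = inj₂ (y ▸ t , ~-trans (subst (λ m → u ▸ t ~ y ⧺ altʳ t s m) em e) (~-swap em))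
    ... | inj₂ le = ⊥-elim (fc y t s ε (braid (3≤-sym le)) (subst (λ m → u ▸ t ~ y ⧺ altʳ t s m) (M-sym s t) e))

  FC-pos : ∀ {u s} → FC u → ¬ D u s → Pos (act u s)
  FC-pos {u} {s} fc nd with FC-descent (size u) ℕₚ.≤-refl fc s
  ... | inj₁ p = p
  ... | inj₂ d = ⊥-elim (nd d)

  FC-D : ∀ {u s} → FC u → ¬ Pos (act u s) → D u s
  FC-D {u} {s} fc np with FC-descent (size u) ℕₚ.≤-refl fc s
  ... | inj₁ p = ⊥-elim (np p)
  ... | inj₂ d = d

  FC-init : ∀ {u s} → FC (u ▸ s) → FC u
  FC-init {s = s} fc = FC-prefix (ε ▸ s) fc ~-refl

  FC-init-pos : ∀ {u s} → FC (u ▸ s) → Pos (act u s)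
  FC-init-pos fc = FC-pos (FC-init fc) λ { (v , e) → FC-square fc (~-▸ _ e) }

  FC-D-neg : ∀ {u s} → FC u → D u s → ¬ Pos (act u s)
  FC-D-neg {u} {s} fc (v , e) p = Pos-⊖ (FC-init-pos (FC-~ fc e))
    (subst Pos (trans (≋-act (~⇒≋ e) s) (act-last v s)) p)

  FC-reduced : ∀ {u} → FC u → HasLength ⟦ u ⟧ (size u)
  FC-reduced {ε} fc = ([] , ≈-refl , refl) , λ _ _ → z≤n
  FC-reduced {u ▸ s} fc = HasLength-snoc s (FC-reduced (FC-init fc)) (FC-init-pos fc)

  -- The condition under which appending r to u is a star operation.
  record Step (u : W) (l r : Fin n) : Set where
    constructor step
    field
      y     : W
      i     : ℕ
      1≤i   : 1 ≤ i
      i+2≤m : i + 2 ≤ M l r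
      tail  : u ~ y ⧺ altʳ l r i
      ¬l    : ¬ D y l
      ¬r    : ¬ D y r

  Blocked : W → Fin n → Fin n → Set
  Blocked u l r = Σ W λ y → Σ ℕ λ k → suc k ≡ M l r × u ~ y ⧺ altʳ l r k

  Step-D : ∀ {u l r} → Step u l r → D u l
  Step-D (step y (suc i) _ _ e _ _) = _ , e

  Step-3≤ : ∀ {u l r} → Step u l r → 3 ≤ M l r
  Step-3≤ (step y i 1≤i le _ _ _) = ℕₚ.≤-trans (ℕₚ.+-monoˡ-≤ 2 1≤i) le

  -- Cancelling the shorter tail letter by letter leaves `y` equal to a word that ends in the rest
  -- of the longer tail. Hence the tail of a `Step` is maximal, and a tail of length m - 1 excludes
  -- a step.
  tail-overlap : ∀ i d l r {y z} → y ⧺ altʳ l r i ~ z ⧺ altʳ l r (i + suc d) → D y l ⊎ D y r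
  tail-overlap zero d l r e = inj₁ (_ , e)
  tail-overlap (suc i) d l r e with tail-overlap i d r l (~-cancel e)
  ... | inj₁ dr = inj₂ dr
  ... | inj₂ dl = inj₁ dl

  Step-¬Blocked : ∀ {u l r} → Step u l r → ¬ Blocked u l r
  Step-¬Blocked {l = l} {r} (step y i _ le e ¬l ¬r) (z , k , ek , f)
    with d , ed ← ℕₚ.m≤n⇒∃[o]m+o≡n (ℕₚ.≤-pred (subst₂ _≤_ (ℕₚ.+-comm i 2) (sym ek) le))
    with tail-overlap i d l r (~-trans (~-sym e) (~-trans f (~-reflexive (cong (λ k → z ⧺ altʳ l r k) (trans (sym ed) (sym (ℕₚ.+-suc i d)))))))
  ... | inj₁ dl = ¬l dl
  ... | inj₂ dr = ¬r dr

  Blocked-▸ : ∀ {u l r t} → Com t l → Com t r → Blocked u l r → Blocked (u ▸ t) l r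
  Blocked-▸ {t = t} cl cr (y , k , ek , e) =
    y ▸ t , k , ek , ~-trans (~-▸ t e) (~-sym (~-pull k _ _ cl cr))

  Blocked-init : ∀ {u w l r t} → Com t l → Com t r → u ~ w ▸ t → Blocked w l r → Blocked u l r
  Blocked-init cl cr e b with y , k , ek , f ← Blocked-▸ cl cr b = y , k , ek , ~-trans e f

  D-pull : ∀ {y t} i l r → Com l t → Com r t → D (y ⧺ altʳ l r i) t → D y t
  D-pull zero l r cl cr d = d
  D-pull (suc i) l r cl cr d with D-▸⁻ d
  ... | inj₁ refl = ⊥-elim (Com-irrefl cl)
  ... | inj₂ (_ , d′) = D-pull i r l cr cl d′

  -- A forbidden factor must involve the new `r`. If `r` can be exchanged with the end of the
  -- factor, it commutes past all of it, and the factor was in `u` already. A new square would make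
  -- `r` a descent of `u` beside the non-commuting `l`. A long braid ending in the new `r` has the
  -- descent `l` as its letter before, and then `u` carries the blocked tail.
  FC-▸ : ∀ {u l r} → FC u → D u l → 3 ≤ M l r → ¬ Blocked u l r → FC (u ▸ r)
  FC-▸ {u} {l} {r} fc dl le nb y p s (z ▸ t) lg e with levi e
  ... | same f = fc y p s z lg f
  ... | diff w c f g = FC-▸ (FC-init (FC-~ fc f)) dl′ le nb′ y p s z lg (~-sym g)
    where
    commutes : Com t l × D w l
    commutes with D-▸⁻ (D-~ f dl)
    ... | inj₁ refl = ⊥-elim (3≤-¬Com le (Com-sym c))
    ... | inj₂ d = d
    dl′ = proj₂ commutes
    nb′ : ¬ Blocked w l r
    nb′ b = nb (Blocked-init (proj₁ commutes) (Com-sym c) f b)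
  FC-▸ {u} {l} {r} fc dl le nb y p .p ε (square refl) e with levi e
  ... | same f = case-D (D-▸⁻ (D-~ f dl))
    where
    case-D : ¬ (l ≡ r ⊎ (Com r l × D y l))
    case-D (inj₁ eq) = 3≤-≢ le eq
    case-D (inj₂ (c , _)) = 3≤-¬Com le (Com-sym c)
  ... | diff w c f g = case-D (D-▸⁻ (w , g))
    where
    case-D : ¬ (r ≡ p ⊎ (Com p r × D y r))
    case-D (inj₁ refl) = Com-irrefl c
    case-D (inj₂ (c′ , y′ , h)) = FC-square fc (~-trans f (~-▸ p
      (~-cancel (~-trans (~-sym g) (~-trans (~-▸ p h) (~-swap (Com-sym c′)))))))
  FC-▸ {u} {l} {r} fc dl le nb y p s ε (braid ge) e = long (M p s) refl ge e
    where
    long : ∀ m → m ≡ M p s → 3 ≤ m → ¬ u ▸ r ~ y ⧺ altʳ p s m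
    long (suc (suc zero)) em (s≤s (s≤s ())) e
    long (suc (suc (suc k))) em _ e with levi e
    ... | same f = case-D (D-▸⁻ (D-~ f dl))
      where
      case-D : ¬ (l ≡ s ⊎ (Com s l × D (y ⧺ altʳ p s (suc k)) l))
      case-D (inj₁ refl) = nb (y , suc (suc k) , trans em (M-sym r l) , f)
      case-D (inj₂ (_ , d)) with D-▸⁻ d
      ... | inj₁ eq = 3≤-≢ le eq
      ... | inj₂ (c , _) = 3≤-¬Com le (Com-sym c)
    ... | diff w c f g = case-D (D-▸⁻ (w , g))
      where
      case-D : ¬ (r ≡ s ⊎ (Com s r × D (y ⧺ altʳ p s (suc k)) r))
      case-D (inj₁ refl) = 3≤-¬Com ge (Com-sym c)
      case-D (inj₂ (c′ , d)) with y′ , h ← D-pull (suc k) p s (Com-sym c) c′ d =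
        fc y′ p s ε (braid ge) (subst (λ m → u ~ y′ ⧺ altʳ p s m) em
          (~-trans f (~-▸ p (~-cancel (~-trans (~-sym g)
            (~-trans (~-⧺ (altʳ s p (suc (suc k))) h) (~-pull (suc (suc k)) s p (Com-sym c′) c)))))))

  FC-Step : ∀ {u l r} → FC u → Step u l r → FC (u ▸ r)
  FC-Step fc st = FC-▸ fc (Step-D st) (Step-3≤ st) (Step-¬Blocked st)

  altʳ-alt : ∀ i l r → ⟦ altʳ l r i ⟧ ≡ alt (first l r i) (first l r (suc i)) i
  altʳ-alt zero l r = refl
  altʳ-alt (suc i) l r = begin
    ⟦ altʳ l r (suc i) ⟧                                    ≡⟨ cong ⟦_⟧ (ε-⧺ (altʳ l r (suc i))) ⟨
    ⟦ ε ⧺ altʳ l r (suc i) ⟧                                ≡⟨ cong ⟦_⟧ (first-▸ ε l r i) ⟨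
    ⟦ (ε ▸ first l r (suc i)) ⧺ altʳ l r i ⟧                ≡⟨ ⟦⧺⟧ (ε ▸ first l r (suc i)) (altʳ l r i) ⟩
    first l r (suc i) ∷ ⟦ altʳ l r i ⟧                      ≡⟨ cong (first l r (suc i) ∷_) (altʳ-alt i l r) ⟩
    first l r (suc i) ∷ alt (first l r i) (first l r (suc i)) i   ∎
    where open ≡-Reasoning

  alt-altʳ : ∀ i s t → alt s t i ≡ ⟦ altʳ (first s t i) (first s t (suc i)) i ⟧
  alt-altʳ i s t = sym (trans (altʳ-alt i (first s t i) (first s t (suc i)))
    (cong₂ (λ x y → alt x y i) (first-involutive i s t) (first-involutive i t s)))

  altʳ-next : ∀ i l r → ⟦ altʳ l r i ⟧ ++ [ r ] ≡ alt (first l r i) (first l r (suc i)) (suc i)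
  altʳ-next i l r = altʳ-alt (suc i) r l

  -- The value at the last letter of `v ⧺ altʳ l r i` is negative, so an FC word for this element
  -- commutes into one ending in that letter. Peeling letter by letter turns a factorization in the
  -- group into one up to commutation.
  FC-peel : ∀ i {u v l r} → FC u → u ≋ v ⧺ altʳ l r i → l ≢ r → i ≤ M l r →
    Pos (act v l) → Pos (act v r) → Σ W λ y → u ~ y ⧺ altʳ l r i × y ≋ v
  FC-peel zero {u} fc e ne le pl pr = u , ~-refl , e
  FC-peel (suc i) {u} {v} {l} {r} fc e ne le pl pr
    with w , f ← FC-D fc (λ p → Pos-⊖ (act-altʳ-pos i r l v (λ eq → ne (sym eq)) (subst (suc i ≤_) (M-sym l r) le)
                                     (act-first-pos i v pr pl) (act-first-pos (suc i) v pr pl))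
                               (subst Pos (trans (≋-act e l) (act-last (v ⧺ altʳ r l i) l)) p))
    with y , g , h ← FC-peel i (FC-init (FC-~ fc f))
                       (≋-trans (≋-flip l (≋-trans (≋-sym (~⇒≋ f)) e)) (≋-cancel (v ⧺ altʳ r l i) l))
                       (λ eq → ne (sym eq)) (subst (i ≤_) (M-sym l r) (ℕₚ.≤-trans (ℕₚ.n≤1+n i) le)) pr pl
    = y , ~-trans f (~-▸ l g) , h

  -- That the left factor has no descent in the pair becomes positivity of its two values there, and
  -- `FC-peel` then finds the same factorization inside the word `u`.
  star⇒step : ∀ {u w w′} → FC u → w ≈ ⟦ u ⟧ → RightUpperStar w w′ →
    Σ (Fin n) λ l → Σ (Fin n) λ r → Step u l r × w′ ≈ ⟦ u ▸ r ⟧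
  star⇒step {u} {w} {w′} fc e (s , t , x , i , _ , ne , 3≤m , 1≤i , i+2≤m , ¬s , ¬t , hx , _ , _ , we , w′e)
    with v , refl ← snoc x = l , r , step-lr , w′≈
    where
    l = first s t i
    r = first s t (suc i)
    l≢r : l ≢ r
    l≢r = first-elim _≢_ i ne (λ eq → ne (sym eq))
    m≡ : M s t ≡ M l r
    m≡ = first-elim (λ x y → M s t ≡ M x y) i refl (M-sym s t)
    ps : Pos (act v s)
    ps = ¬RightDescent⇒Pos s hx ¬s
    pt : Pos (act v t)
    pt = ¬RightDescent⇒Pos t hx ¬t
    u≋ : u ≋ v ⧺ altʳ l r i
    u≋ = mk≋ (≈-trans (≈-sym e) (≈-trans we (≈-reflexive (trans (cong (⟦ v ⟧ ++_) (alt-altʳ i s t)) (sym (⟦⧺⟧ v (altʳ l r i)))))))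
    i≤m : i ≤ M l r
    i≤m = ℕₚ.≤-trans (ℕₚ.m≤m+n i 2) (subst (i + 2 ≤_) m≡ i+2≤m)
    peeled = FC-peel i fc u≋ l≢r i≤m (act-first-pos i v ps pt) (act-first-pos (suc i) v ps pt)
    y = proj₁ peeled
    u~ = proj₁ (proj₂ peeled)
    y≋ = proj₂ (proj₂ peeled)
    ¬Dy : ∀ {q} → Pos (act v q) → ¬ D y q
    ¬Dy {q} p d = FC-D-neg (FC-prefix (altʳ l r i) fc u~) d (subst Pos (sym (≋-act y≋ q)) p)
    step-lr : Step u l r
    step-lr = step y i 1≤i (subst (i + 2 ≤_) m≡ i+2≤m) u~
      (¬Dy (act-first-pos i v ps pt)) (¬Dy (act-first-pos (suc i) v ps pt))
    w′≈ : w′ ≈ ⟦ u ▸ r ⟧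
    w′≈ = ≈-trans w′e (≈-trans (≈-reflexive (begin
      ⟦ v ⟧ ++ alt s t (suc i)              ≡⟨ cong (⟦ v ⟧ ++_) (alt-altʳ (suc i) s t) ⟩
      ⟦ v ⟧ ++ ⟦ altʳ r l (suc i) ⟧         ≡⟨ ⟦⧺⟧ v (altʳ r l (suc i)) ⟨
      ⟦ (v ⧺ altʳ l r i) ▸ r ⟧              ∎)) (words (≋-▸ r (≋-sym u≋))))
      where open ≡-Reasoning

  step⇒star : ∀ {u l r w} → FC u → Step u l r → w ≈ ⟦ u ⟧ → RightUpperStar w ⟦ u ▸ r ⟧
  step⇒star {u} {l} {r} {w} fc st@(step y i 1≤i i+2≤m e ¬l ¬r) we =
    s , t , ⟦ y ⟧ , i , size y , s≢t , subst (3 ≤_) m≡ (Step-3≤ st) , 1≤i , subst (i + 2 ≤_) m≡ i+2≤m ,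
    Pos⇒¬RightDescent s (act-first-pos i y pl pr) , Pos⇒¬RightDescent t (act-first-pos (suc i) y pl pr) ,
    FC-reduced fc-y , subst (λ x → HasLength x i) (altʳ-alt i l r) (alt-reduced i (Step-≢) (ℕₚ.≤-trans (ℕₚ.m≤m+n i 2) i+2≤m)) ,
    HasLength-≈ (≈-sym we) (subst (HasLength ⟦ u ⟧) size≡ (FC-reduced fc)) ,
    ≈-trans we (≈-trans (words (~⇒≋ e)) (≈-reflexive (trans (⟦⧺⟧ y (altʳ l r i)) (cong (⟦ y ⟧ ++_) (altʳ-alt i l r))))) ,
    ≈-trans (≈-++ʳ [ r ] (words (~⇒≋ e))) (≈-reflexive (trans (⟦⧺⟧ y (altʳ r l (suc i))) (cong (⟦ y ⟧ ++_) (altʳ-next i l r))))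
    where
    s = first l r i
    t = first l r (suc i)
    Step-≢ = 3≤-≢ (Step-3≤ st)
    s≢t : s ≢ t
    s≢t = first-elim _≢_ i Step-≢ (λ eq → Step-≢ (sym eq))
    m≡ : M l r ≡ M s t
    m≡ = first-elim (λ x y → M l r ≡ M x y) i refl (M-sym l r)
    fc-y : FC y
    fc-y = FC-prefix (altʳ l r i) fc e
    pl : Pos (act y l)
    pl = FC-pos fc-y ¬l
    pr : Pos (act y r)
    pr = FC-pos fc-y ¬r
    size≡ : size u ≡ size y + i
    size≡ = trans (~-size e) (trans (size-⧺ y (altʳ l r i)) (cong (size y +_) (size-altʳ l r i)))
    alt-reduced : ∀ i {l r} → l ≢ r → i ≤ M l r → HasLength ⟦ altʳ l r i ⟧ i
    alt-reduced zero ne le = ([] , ≈-refl , refl) , λ _ _ → z≤n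
    alt-reduced (suc i) {l} {r} ne le = HasLength-snoc l
      (alt-reduced i ne′ (ℕₚ.≤-trans (ℕₚ.n≤1+n i) le′))
      (subst (λ x → Pos (act x l)) (ε-⧺ (altʳ r l i)) (act-altʳ-pos i r l ε ne′ le′ (pos 1 0 (s≤s z≤n)) (pos 1 0 (s≤s z≤n))))
      where
      ne′ = λ eq → ne (sym eq)
      le′ = subst (suc i ≤_) (M-sym l r) le

  -- Reachable words and their right descents

  data Reach (x : W) : W → Set where
    start : Reach x x
    _then_ : ∀ {u l r} → Reach x u → Step u l r → Reach x (u ▸ r)

  Reach-FC : ∀ {x u} → FC x → Reach x u → FC u
  Reach-FC fc start = fc
  Reach-FC fc (ρ then st) = FC-Step (Reach-FC fc ρ) st

  Reach-prefix : ∀ {x u} → Reach x u → Σ W λ v → u ≡ x ⧺ v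
  Reach-prefix start = ε , refl
  Reach-prefix (ρ then st) with v , refl ← Reach-prefix ρ = v ▸ _ , refl

  stars⇒Reach : ∀ {x u w w′} → FC x → Reach x u → w ≈ ⟦ u ⟧ → Star RightUpperStar w w′ →
    Σ W λ u′ → Reach x u′ × w′ ≈ ⟦ u′ ⟧
  stars⇒Reach fc ρ e ε* = _ , ρ , e
  stars⇒Reach fc ρ e (σ ◅ σs) with l , r , st , e′ ← star⇒step (Reach-FC fc ρ) e σ = stars⇒Reach fc (ρ then st) e′ σs

  Reach⇒R : ∀ {x u w} → FC x → Reach x u → ⟦ u ⟧ ≈ w → R ⟦ x ⟧ w
  Reach⇒R {x} fc ρ e = _ , stars ρ , e
    where
    stars : ∀ {u} → Reach x u → Star RightUpperStar ⟦ x ⟧ ⟦ u ⟧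
    stars start = ε*
    stars (ρ then st) = stars ρ ◅◅ (step⇒star (Reach-FC fc ρ) st ≈-refl ◅ ε*)

  R⇒Reach : ∀ {x w} → FC x → R ⟦ x ⟧ w → Σ W λ u → Reach x u × w ≈ ⟦ u ⟧
  R⇒Reach fc (v , σs , e) with u , ρ , e′ ← stars⇒Reach fc start ≈-refl σs = u , ρ , ≈-trans (≈-sym e) e′

  ~-letter : ∀ {a b} → ε ▸ a ~ ε ▸ b → a ≡ b
  ~-letter e with levi e
  ... | same _ = refl
  ... | diff w c f _ with () ← ~-size f

  -- Two letters are too few for a long braid, and a square would force a = b.
  FC-pair : ∀ {a b} → Com a b → FC (ε ▸ a ▸ b)
  FC-pair {a} {b} c y p s {k} z lg e = by-size lg y z (trans (~-size e)
    (trans (size-⧺ (y ⧺ altʳ p s k) z) (cong (_+ size z) (trans (size-⧺ y (altʳ p s k)) (cong (size y +_) (size-altʳ p s k)))))) e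
    where
    by-size : ∀ {k} → Long p s k → ∀ y z → 2 ≡ (size y + k) + size z → ¬ ε ▸ a ▸ b ~ (y ⧺ altʳ p s k) ⧺ z
    by-size (braid le) y z eq _ = ℕₚ.<-irrefl eq
      (ℕₚ.≤-trans le (ℕₚ.≤-trans (ℕₚ.m≤n+m (M p s) (size y)) (ℕₚ.m≤m+n _ (size z))))
    by-size (square _) (y ▸ r) z eq _ = ℕₚ.<-irrefl eq
      (s≤s (ℕₚ.≤-trans (ℕₚ.m≤n+m 2 (size y)) (ℕₚ.m≤m+n _ (size z))))
    by-size (square _) ε (z ▸ r) () _
    by-size (square refl) ε ε _ f with levi f
    ... | same g with refl ← ~-letter g = Com-irrefl c
    ... | diff ε d g h with refl ← ~-letter h = Com-irrefl d
    ... | diff (w ▸ r) d g h with () ← ~-size h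

  last-descent : ∀ {u w} v s → FC u → w ≈ ⟦ u ⟧ → w ≈ v ++ [ s ] → HasLength w (suc (length v)) → D u s
  last-descent {u} v s fc e e′ hl = FC-D fc λ p → Pos-⊖ (HasLength-drop s (HasLength-≈ e′ hl) refl)
    (subst Pos (trans (sym (run-≈ e c₀ s)) (trans (run-≈ e′ c₀ s) (run-snoc v s))) p)

  module _ {a b} (c : Com a b) where

    private
      x : W
      x = ε ▸ a ▸ b

      ab≈ba : (a ∷ b ∷ []) ≈ (b ∷ a ∷ [])
      ab≈ba = words (~⇒≋ (~-swap {ε} c))

      -- w⁻¹ begins with both ab and ba, so w ends with both ba and ab.
      ends : ∀ {w u} s t → (a ∷ b ∷ []) ≈ (s ∷ t ∷ []) → Reach x u → reverse w ≈ ⟦ u ⟧ →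
        Σ Word λ v → w ≈ v ++ [ s ] × HasLength w (suc (length v))
      ends {w} {u} s t e ρ we with v , refl ← Reach-prefix ρ =
        reverse (t ∷ ⟦ v ⟧) , w≈ , subst (HasLength w) len (HasLength-≈ w≈′ (HasLength-reverse (FC-reduced (Reach-FC (FC-pair c) ρ))))
        where
        w≈′ : reverse ⟦ x ⧺ v ⟧ ≈ w
        w≈′ = ≈-trans (≈-sym (reverse-≈ we)) (≈-reflexive (Listₚ.reverse-involutive w))
        w≈ : w ≈ reverse (t ∷ ⟦ v ⟧) ++ [ s ]
        w≈ = ≈-trans (≈-sym w≈′) (≈-trans (reverse-≈ (≈-trans (≈-reflexive (⟦⧺⟧ x v)) (≈-++ʳ ⟦ v ⟧ e)))
          (≈-reflexive (Listₚ.unfold-reverse s (t ∷ ⟦ v ⟧))))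
        len : size (x ⧺ v) ≡ suc (length (reverse (t ∷ ⟦ v ⟧)))
        len = trans (size-⧺ x v) (cong suc (trans (cong suc (sym (length-⟦⟧ v))) (sym (Listₚ.length-reverse (t ∷ ⟦ v ⟧)))))

    I⇒Reach : ∀ {w} → I ⟦ x ⟧ ⟦ x ⟧ w → Σ W λ u → Reach x u × w ≈ ⟦ u ⟧ × D u a × D u b
    I⇒Reach {w} (rw , riw)
      with u , ρ , e ← R⇒Reach (FC-pair c) rw | u′ , ρ′ , e′ ← R⇒Reach (FC-pair c) riw
      with v , f , hl ← ends {w} a b ≈-refl ρ′ e′ | v′ , f′ , hl′ ← ends {w} b a ab≈ba ρ′ e′ =
      u , ρ , e , last-descent v a fc e f hl , last-descent v′ b fc e f′ hl′
      where fc = Reach-FC (FC-pair c) ρ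

  Letters-~ : ∀ {P : Fin n → Set} {u v} → u ~ v → Letters P u → Letters P v
  Letters-~ ~-refl ps = ps
  Letters-~ (~-trans e f) ps = Letters-~ f (Letters-~ e ps)
  Letters-~ (~-▸ s e) (ps ▸ p) = Letters-~ e ps ▸ p
  Letters-~ (~-swap c) (ps ▸ p ▸ q) = ps ▸ q ▸ p

  Letters-D : ∀ {P : Fin n → Set} {u s} → Letters P u → D u s → P s
  Letters-D ps (v , e) with _ ▸ p ← Letters-~ e ps = p

  ~-past : ∀ {u v r} → Letters (Com r) v → (u ⧺ v) ▸ r ~ (u ▸ r) ⧺ v
  ~-past ε = ~-refl
  ~-past (cs ▸ c) = ~-trans (~-swap (Com-sym c)) (~-▸ _ (~-past cs))

  ~-⧺-comm : ∀ {u v} → Letters (λ r → Letters (Com r) v) u → v ⧺ u ~ u ⧺ v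
  ~-⧺-comm {v = v} ε = ~-reflexive (sym (ε-⧺ v))
  ~-⧺-comm (cs ▸ c) = ~-trans (~-▸ _ (~-⧺-comm cs)) (~-past c)

  Only : W → Set
  Only u = Σ (Fin n) λ p → ∀ {t} → D u t → t ≡ p

  -- Only an upper bound on the descents. That suffices: a `Step` starts at a descent, and an end
  -- position is refuted by a required descent that is neither `p` nor `q`.
  Pair : W → Fin n → Fin n → Set
  Pair u p q = ∀ {t} → D u t → t ≡ p ⊎ t ≡ q

  Only-≢ : ∀ {u s t} → Only u → s ≢ t → D u s → ¬ D u t
  Only-≢ (p , only) ne ds dt = ne (trans (only ds) (sym (only dt)))

  Only-step : ∀ {u l r} → Only u → Step u l r → Only (u ▸ r)
  Only-step {u} {l} {r} (p , only) st = r , λ d → aux (D-▸⁻ d)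
    where
    aux : ∀ {t} → t ≡ r ⊎ (Com r t × D u t) → t ≡ r
    aux (inj₁ eq) = eq
    aux (inj₂ (c , d)) with refl ← only d | refl ← only (Step-D st) = ⊥-elim (3≤-¬Com (Step-3≤ st) (Com-sym c))

  Pair-swap : ∀ {u p q} → Pair u p q → Pair u q p
  Pair-swap pr d with pr d
  ... | inj₁ eq = inj₂ eq
  ... | inj₂ eq = inj₁ eq

  Pair-move : ∀ {u p q r} → Pair u p q → Step u p r → Pair (u ▸ r) r q
  Pair-move {u} {p} {q} {r} pr st d with D-▸⁻ d
  ... | inj₁ eq = inj₁ eq
  ... | inj₂ (c , d′) with pr d′
  ...   | inj₁ refl = ⊥-elim (3≤-¬Com (Step-3≤ st) (Com-sym c))
  ...   | inj₂ eq = inj₂ eq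

  -- The new letter `r` does not commute with `q`, so it covers `q` and the second descent is lost.
  Pair-collide : ∀ {u p q r} → Pair u p q → Step u p r → 3 ≤ M r q → Only (u ▸ r)
  Pair-collide {u} {p} {q} {r} pr st le = r , λ d → aux (Pair-move pr st d) (D-▸⁻ d)
    where
    aux : ∀ {t} → t ≡ r ⊎ t ≡ q → t ≡ r ⊎ (Com r t × D u t) → t ≡ r
    aux (inj₁ eq) _ = eq
    aux (inj₂ eq) (inj₁ eq′) = eq′
    aux (inj₂ refl) (inj₂ (c , _)) = ⊥-elim (3≤-¬Com le c)

  Pair-start : ∀ {a b} → Pair (ε ▸ a ▸ b) a b
  Pair-start d with D-▸⁻ d
  ... | inj₁ eq = inj₂ eq
  ... | inj₂ (_ , d′) with D-▸⁻ d′
  ...   | inj₁ eq = inj₁ eq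
  ...   | inj₂ (_ , (_ , e)) with () ← ~-size e

  Blocked-3 : ∀ {u v p r} → M p r ≡ 3 → u ~ v ▸ r ▸ p → Blocked u p r
  Blocked-3 {v = v} em e = v , 2 , sym em , e

  -- Over a light bond the step itself leaves the tail `p`, `r`, whose length is already m - 1 = 2.
  -- A particle therefore cannot turn round there unless some later letter separates the two.
  Blocked-new : ∀ {u p r} → M p r ≡ 3 → Step u p r → Blocked (u ▸ r) r p
  Blocked-new {r = r} em st with v , e ← Step-D st = Blocked-3 (trans (M-sym _ _) em) (~-▸ r e)

  -- For the converse inclusion, a listed word and its reverse represent the same element, so one
  -- reachability proof serves for both memberships.
  IEquals-intro : ∀ {a b S} → Com a b →
    (∀ {u} → Reach (ε ▸ a ▸ b) u → D u a → D u b → Any (⟦ u ⟧ ≈_) S) →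
    All (λ v → reverse v ≈ v × Σ W λ u → Reach (ε ▸ a ▸ b) u × ⟦ u ⟧ ≈ v) S →
    IEquals ⟦ ε ▸ a ▸ b ⟧ ⟦ ε ▸ a ▸ b ⟧ S
  IEquals-intro {a} {b} c only all w = to , from all
    where
    x = ε ▸ a ▸ b
    transport : ∀ {u S} → w ≈ u → Any (u ≈_) S → Any (w ≈_) S
    transport e (here f) = here (≈-trans e f)
    transport e (there any) = there (transport e any)
    to : I ⟦ x ⟧ ⟦ x ⟧ w → Any (w ≈_) _
    to i with u , ρ , e , da , db ← I⇒Reach c i = transport e (only ρ da db)
    from : ∀ {S} → All (λ v → reverse v ≈ v × Σ W λ u → Reach x u × ⟦ u ⟧ ≈ v) S → Any (w ≈_) S → I ⟦ x ⟧ ⟦ x ⟧ w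
    from ((e , u , ρ , f) ∷ _) (here g) =
      Reach⇒R (FC-pair c) ρ (≈-trans f (≈-sym g)) ,
      Reach⇒R (FC-pair c) ρ (≈-trans f (≈-trans (≈-sym e) (reverse-≈ (≈-sym g))))
    from (_ ∷ all) (there any) = from all any

  pair-involution : ∀ {a b} → Com a b → reverse ⟦ ε ▸ a ▸ b ⟧ ≈ ⟦ ε ▸ a ▸ b ⟧
  pair-involution c = words (~⇒≋ (~-swap {ε} (Com-sym c)))

  IEquals-trivial : ∀ {a b} → Com a b → (∀ {u} → Reach (ε ▸ a ▸ b) u → D u a → D u b → ⟦ u ⟧ ≈ ⟦ ε ▸ a ▸ b ⟧) →
    IEquals ⟦ ε ▸ a ▸ b ⟧ ⟦ ε ▸ a ▸ b ⟧ (⟦ ε ▸ a ▸ b ⟧ ∷ [])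
  IEquals-trivial c only = IEquals-intro c (λ ρ da db → here (only ρ da db)) ((pair-involution c , _ , start , ≈-refl) ∷ [])

-- Two particles on a path

-- On two successors `pathRule e` computes to `pathRule` for the shifted weights, so the inductions
-- run with `e` varying.
pathRule-diag : ∀ e a → pathRule e a a ≡ 1
pathRule-diag e zero = refl
pathRule-diag e (suc a) = pathRule-diag (λ k → e (suc k)) a

pathRule-suc : ∀ e a → pathRule e a (suc a) ≡ e (suc a)
pathRule-suc e zero = refl
pathRule-suc e (suc a) = pathRule-suc (λ k → e (suc k)) a

pathRule-far : ∀ e {a b} → suc a < b → pathRule e a b ≡ 2
pathRule-far e {zero} (s≤s (s≤s le)) = refl
pathRule-far e {suc a} (s≤s lt) = pathRule-far (λ k → e (suc k)) lt

pathRule-sym : ∀ e a b → pathRule e a b ≡ pathRule e b a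
pathRule-sym e zero zero = refl
pathRule-sym e zero (suc zero) = refl
pathRule-sym e zero (suc (suc b)) = refl
pathRule-sym e (suc zero) zero = refl
pathRule-sym e (suc (suc a)) zero = refl
pathRule-sym e (suc a) (suc b) = pathRule-sym (λ k → e (suc k)) a b

pathRule-bond : ∀ e → (∀ k → Bond (e k)) → ∀ {a b} → a ≢ b → Bond (pathRule e a b)
pathRule-bond e be {zero} {zero} ne = ⊥-elim (ne refl)
pathRule-bond e be {zero} {suc zero} ne = be 1
pathRule-bond e be {zero} {suc (suc b)} ne = b2 refl
pathRule-bond e be {suc zero} {zero} ne = be 1
pathRule-bond e be {suc (suc a)} {zero} ne = b2 refl
pathRule-bond e be {suc a} {suc b} ne = pathRule-bond (λ k → e (suc k)) (λ k → be (suc k)) (λ eq → ne (cong suc eq))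

module Path {n : ℕ} (M : CoxeterMatrix n)
  (M-sym : ∀ s t → M s t ≡ M t s) (M-diag : ∀ s → M s s ≡ 1) (bond : ∀ {s t} → s ≢ t → Bond (M s t))
  (M-far : ∀ {s t} → suc (toℕ s) < toℕ t → M s t ≡ 2) where

  open StarOperations M M-sym M-diag bond public

  infix 4 _⋖_
  _⋖_ : Fin n → Fin n → Set
  s ⋖ t = toℕ t ≡ suc (toℕ s)

  far : ∀ {s t} → 2 + toℕ s ≤ toℕ t → Com s t
  far = M-far

  far′ : ∀ {s t} → 2 + toℕ t ≤ toℕ s → Com s t
  far′ lt = Com-sym (far lt)

  neighbour : ∀ {s t} → 3 ≤ M s t → s ⋖ t ⊎ t ⋖ s
  neighbour {s} {t} le with ℕₚ.<-cmp (toℕ s) (toℕ t)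
  ... | tri≈ _ eq _ = ⊥-elim (3≤-≢ le (Finₚ.toℕ-injective eq))
  ... | tri< lt _ _ with ℕₚ.m≤n⇒m<n∨m≡n lt
  ...   | inj₁ lt′ = ⊥-elim (3≤-¬Com le (far lt′))
  ...   | inj₂ eq = inj₁ (sym eq)
  neighbour {s} {t} le | tri> _ _ gt with ℕₚ.m≤n⇒m<n∨m≡n gt
  ...   | inj₁ gt′ = ⊥-elim (3≤-¬Com le (far′ gt′))
  ...   | inj₂ eq = inj₂ (sym eq)

  ⋖-unique : ∀ {s t t′} → s ⋖ t → s ⋖ t′ → t ≡ t′
  ⋖-unique p q = Finₚ.toℕ-injective (trans p (sym q))

  ⋗-unique : ∀ {s s′ t} → s ⋖ t → s′ ⋖ t → s ≡ s′
  ⋗-unique p q = Finₚ.toℕ-injective (ℕₚ.suc-injective (trans (sym p) q))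

  module Adjacent (adjacent : ∀ {s t} → s ⋖ t → 3 ≤ M s t) where

    adjacent′ : ∀ {s t} → s ⋖ t → 3 ≤ M t s
    adjacent′ s⋖t = 3≤-sym (adjacent s⋖t)

    -- Two particles p < q with p unable to step back.
    Right : ℕ → W → Set
    Right a u = Σ (Fin n) λ p → Σ (Fin n) λ q →
      Pair u p q × a < toℕ p × 2 + toℕ p ≤ toℕ q × (∀ {r} → r ⋖ p → Blocked u p r)

    -- `p` can only walk to the right, where each new bond is light and blocks the return; `q`
    -- either keeps its distance or merges with it. So no particle comes back to vertex a before
    -- they merge.
    Right-step : ∀ {a} → (∀ {s t} → s ⋖ t → a ≤ toℕ s → suc (toℕ t) < n → M s t ≡ 3) →
      ∀ {u l r} → Right a u → Step u l r → Only (u ▸ r) ⊎ Right a (u ▸ r)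
    Right-step {a} inner {u} {l} {r} (p , q , pr , lo , gap , bl) st with pr (Step-D st) | neighbour (Step-3≤ st)
    ... | inj₁ refl | inj₂ r⋖p = ⊥-elim (Step-¬Blocked st (bl r⋖p))
    ... | inj₁ refl | inj₁ p⋖r with ℕₚ.m≤n⇒m<n∨m≡n gap
    ...   | inj₂ eq = inj₁ (Pair-collide pr st (adjacent (trans (sym eq) (cong suc (sym p⋖r)))))
    ...   | inj₁ lt = inj₂ (r , q , Pair-move pr st , subst (a <_) (sym p⋖r) (ℕₚ.m<n⇒m<1+n lo) ,
                        subst (λ x → 2 + x ≤ toℕ q) (sym p⋖r) lt , blocked)
      where
      blocked : ∀ {s} → s ⋖ r → Blocked (u ▸ r) r s
      blocked s⋖r with refl ← ⋗-unique s⋖r p⋖r = Blocked-new (inner p⋖r (ℕₚ.<⇒≤ lo)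
        (ℕₚ.≤-trans (subst (λ x → 2 + x ≤ toℕ q) (sym p⋖r) lt) (ℕₚ.<⇒≤ (Finₚ.toℕ<n q)))) st
    Right-step {a} inner {u} {l} {r} (p , q , pr , lo , gap , bl) st | inj₂ refl | nb with within nb
      where
      within : q ⋖ r ⊎ r ⋖ q → 2 + toℕ p ≤ toℕ r ⊎ p ⋖ r
      within (inj₁ q⋖r) = inj₁ (ℕₚ.≤-trans gap (ℕₚ.≤-trans (ℕₚ.n≤1+n _) (ℕₚ.≤-reflexive (sym q⋖r))))
      within (inj₂ r⋖q) with ℕₚ.m≤n⇒m<n∨m≡n (ℕₚ.≤-pred (subst (2 + toℕ p ≤_) r⋖q gap))
      ... | inj₁ lt = inj₁ lt
      ... | inj₂ eq = inj₂ (sym eq)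
    ... | inj₂ p⋖r = inj₁ (Pair-collide (Pair-swap pr) st (adjacent′ p⋖r))
    ... | inj₁ gap′ = inj₂ (p , r , Pair-swap (Pair-move (Pair-swap pr) st) , lo , gap′ ,
                        λ s⋖p → Blocked-▸ (far′ gap′) (far′ (ℕₚ.≤-trans (s≤s (ℕₚ.≤-trans (ℕₚ.≤-reflexive (sym s⋖p)) (ℕₚ.n≤1+n _))) gap′)) (bl s⋖p))

    data Out (b : ℕ) : W → Fin n → Set where
      base : ∀ {q} → toℕ q ≡ b → Out b (ε ▸ q) q
      up   : ∀ {μ q r} → Out b μ q → q ⋖ r → Out b (μ ▸ r) r

    Out-high⁺ : ∀ {b μ q} → Out b μ q → b ≤ toℕ q
    Out-high⁺ (base eq) = ℕₚ.≤-reflexive (sym eq)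
    Out-high⁺ (up o q⋖r) = ℕₚ.≤-trans (Out-high⁺ o) (ℕₚ.≤-trans (ℕₚ.n≤1+n _) (ℕₚ.≤-reflexive (sym q⋖r)))

    Out-high : ∀ {b μ q} → Out b μ q → Letters (λ t → b ≤ toℕ t) μ
    Out-high (base eq) = ε ▸ ℕₚ.≤-reflexive (sym eq)
    Out-high o@(up o′ _) = Out-high o′ ▸ Out-high⁺ o

    Out-last : ∀ {b μ q} → Out b μ q → Σ W λ ν → μ ≡ ν ▸ q
    Out-last (base _) = _ , refl
    Out-last (up _ _) = _ , refl

    Out-base : ∀ {b μ q} → Out b μ q → toℕ q ≡ b → μ ≡ ε ▸ q
    Out-base (base _) _ = refl
    Out-base (up o q⋖r) eq = ⊥-elim (ℕₚ.<-irrefl refl (ℕₚ.≤-trans (s≤s (Out-high⁺ o)) (ℕₚ.≤-reflexive (trans (sym q⋖r) eq))))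

-- The particles start at a and a + 2, with a + 1 as the vertex where they may merge: a = 0 for type
-- A, a = 1 when the first bond is heavy. `middle` is stated apart from `inner` because the edge
-- from a + 1 to a + 2 can be the last of the path, which `inner` leaves out.
module PathWithEnds {n : ℕ} (M : CoxeterMatrix n)
  (M-sym : ∀ s t → M s t ≡ M t s) (M-diag : ∀ s → M s s ≡ 1) (bond : ∀ {s t} → s ≢ t → Bond (M s t))
  (M-far : ∀ {s t} → suc (toℕ s) < toℕ t → M s t ≡ 2)
  (a : ℕ) (a≤1 : a ≤ 1)
  (adjacent : ∀ {s t : Fin n} → toℕ t ≡ suc (toℕ s) → 3 ≤ M s t)
  (middle : ∀ {s t : Fin n} → toℕ t ≡ suc (toℕ s) → toℕ s ≡ suc a → M s t ≡ 3)
  (inner : ∀ {s t : Fin n} → toℕ t ≡ suc (toℕ s) → a ≤ toℕ s → suc (toℕ t) < n → M s t ≡ 3)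
  (last : ∀ {s t : Fin n} → toℕ t ≡ suc (toℕ s) → a ≤ toℕ s → M s t ≡ 3 ⊎ M s t ≡ 4)
  where

  open Path M M-sym M-diag bond M-far public
  open Adjacent adjacent public

  Low High : Fin n → Set
  Low t = toℕ t ≤ a
  High t = 2 + a ≤ toℕ t

  low-high : ∀ {s t} → Low s → High t → Com s t
  low-high lo hi = far (ℕₚ.≤-trans (s≤s (s≤s lo)) hi)

  -- The right particle walks out from a + 2, and can only turn back at the last vertex, over a bond 4.
  data In : W → Fin n → Set where
    turn : ∀ {μ q r} → Out (2 + a) μ q → r ⋖ q → suc (toℕ q) ≡ n → High r → M q r ≡ 4 → In (μ ▸ r) r
    down : ∀ {μ q r} → In μ q → r ⋖ q → High r → In (μ ▸ r) r

  In-high : ∀ {μ q} → In μ q → Letters High μ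
  In-high (turn o _ _ hi _) = Out-high o ▸ hi
  In-high (down i _ hi) = In-high i ▸ hi

  In-high⁺ : ∀ {μ q} → In μ q → High q
  In-high⁺ (turn _ _ _ hi _) = hi
  In-high⁺ (down _ _ hi) = hi

  In-inner : ∀ {μ q} → In μ q → suc (toℕ q) < n
  In-inner (turn o r⋖q eq _ _) = ℕₚ.≤-reflexive (trans (cong suc (sym r⋖q)) eq)
  In-inner (down i r⋖q _) = ℕₚ.≤-trans (s≤s (ℕₚ.≤-trans (ℕₚ.≤-reflexive (sym r⋖q)) (ℕₚ.n≤1+n _))) (In-inner i)

  In-last : ∀ {μ q} → In μ q → Σ W λ ν → μ ≡ ν ▸ q
  In-last (turn _ _ _ _ _) = _ , refl
  In-last (down _ _ _) = _ , refl

  -- The phases once a particle has stepped on a + 1: both have merged; or it came from the left and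
  -- is cut off from a; or it came from the right while the other was at 0, and then it is blocked
  -- from a + 2 and every further step merges them.
  Dead : W → Set
  Dead u = Only u ⊎ Right a u
    ⊎ (Σ (Fin n) λ p → Σ (Fin n) λ q → Pair u p q × toℕ p < a × toℕ q ≡ suc a × (∀ {r} → q ⋖ r → Blocked u q r))

  Dead-final : ∀ {u s t} → toℕ s ≡ a → toℕ t ≡ 2 + a → Dead u → D u s → ¬ D u t
  Dead-final es et (inj₁ only) ds dt =
    Only-≢ only (λ eq → ℕₚ.m≢1+n+m a (trans (sym es) (trans (cong toℕ eq) et))) ds dt
  Dead-final es et (inj₂ (inj₁ (p , q , pr , lo , gap , _))) ds dt with pr ds
  ... | inj₁ refl = ℕₚ.<-irrefl (sym es) lo
  ... | inj₂ refl = ℕₚ.<-irrefl (sym es) (ℕₚ.≤-trans lo (ℕₚ.≤-trans (ℕₚ.m≤n+m _ 2) gap))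
  Dead-final es et (inj₂ (inj₂ (p , q , pr , lo , eq , _))) ds dt with pr ds
  ... | inj₁ refl = ℕₚ.<-irrefl es lo
  ... | inj₂ refl = ℕₚ.m≢1+n+m a {0} (trans (sym es) eq)

  Dead-step : ∀ {u l r} → Dead u → Step u l r → Dead (u ▸ r)
  Dead-step (inj₁ only) st = inj₁ (Only-step only st)
  Dead-step (inj₂ (inj₁ right)) st with Right-step inner right st
  ... | inj₁ only = inj₁ only
  ... | inj₂ right′ = inj₂ (inj₁ right′)
  Dead-step {u} {l} {r} (inj₂ (inj₂ (p , q , pr , lo , eq , bl))) st with pr (Step-D st) | neighbour (Step-3≤ st)
  ... | inj₂ refl | inj₁ q⋖r = ⊥-elim (Step-¬Blocked st (bl q⋖r))
  ... | inj₂ refl | inj₂ r⋖q = inj₁ (Pair-collide (Pair-swap pr) st (subst (3 ≤_) (M-sym p r)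
          (adjacent (trans (ℕₚ.suc-injective (trans (sym r⋖q) eq)) (below lo)))))
    where
    below : ∀ {p} → p < a → a ≡ suc p
    below lt = ℕₚ.≤-antisym (ℕₚ.≤-trans a≤1 (s≤s z≤n)) lt
  ... | inj₁ refl | inj₁ p⋖r = inj₁ (Pair-collide pr st (adjacent (trans eq (cong suc (trans (below lo) (sym p⋖r))))))
    where
    below : ∀ {p} → p < a → a ≡ suc p
    below lt = ℕₚ.≤-antisym (ℕₚ.≤-trans a≤1 (s≤s z≤n)) lt
  ... | inj₁ refl | inj₂ r⋖p = ⊥-elim (ℕₚ.<-irrefl refl (ℕₚ.≤-trans (ℕₚ.≤-trans (s≤s (ℕₚ.≤-trans (s≤s z≤n) (ℕₚ.≤-reflexive (sym r⋖p)))) lo) a≤1))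

  -- While nobody has stepped on a + 1, the letters played by the two particles commute, and the
  -- word splits into a left and a right factor. Which left factors occur depends on the weight of
  -- the first bond, hence the parameter `L`.
  module Live (L : W → Fin n → Set)
    (L-low : ∀ {λ′ p} → L λ′ p → Low p)
    (L-step : ∀ {u l μ p r} → L l p → Letters High μ → u ~ l ⧺ μ → Step u p r → Low r → L (l ▸ r) r)
    where

    Alive : W → Set
    Alive u = Σ (Fin n) λ p → Σ (Fin n) λ q → Σ W λ l → Σ W λ μ →
      Pair u p q × L l p × (Out (2 + a) μ q ⊎ In μ q) × u ~ l ⧺ μ

    phase-high : ∀ {μ q} → Out (2 + a) μ q ⊎ In μ q → Letters High μ
    phase-high (inj₁ o) = Out-high o
    phase-high (inj₂ i) = In-high i

    phase-high⁺ : ∀ {μ q} → Out (2 + a) μ q ⊎ In μ q → High q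
    phase-high⁺ (inj₁ o) = Out-high⁺ o
    phase-high⁺ (inj₂ i) = In-high⁺ i

    left-step : ∀ {u p q l μ r} → Pair u p q → L l p → Out (2 + a) μ q ⊎ In μ q → u ~ l ⧺ μ → Step u p r →
      Dead (u ▸ r) ⊎ Alive (u ▸ r)
    left-step {u} {p} {q} {l} {μ} {r} pr lp ph e st with ℕₚ.≤-<-connex (toℕ r) a
    ... | inj₁ lo = inj₂ (r , q , l ▸ r , μ , Pair-move pr st , L-step lp (phase-high ph) e st lo , ph ,
            ~-trans (~-▸ r e) (~-past (Letters-map (low-high lo) (phase-high ph))))
    ... | inj₂ hi with neighbour (Step-3≤ st)
    ...   | inj₂ r⋖p = ⊥-elim (ℕₚ.<-irrefl refl (ℕₚ.≤-trans hi (ℕₚ.≤-trans (ℕₚ.n≤1+n _) (subst (_≤ a) r⋖p (L-low lp)))))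
    ...   | inj₁ p⋖r with p≡a ← ℕₚ.≤-antisym (L-low lp) (ℕₚ.≤-pred (subst (a <_) p⋖r hi))
              | ℕₚ.m≤n⇒m<n∨m≡n (phase-high⁺ ph)
    ...     | inj₂ eq = inj₁ (inj₁ (Pair-collide pr st (adjacent (trans (sym eq) (cong suc (trans (cong suc (sym p≡a)) (sym p⋖r)))))))
    ...     | inj₁ gap = inj₁ (inj₂ (inj₁ (r , q , Pair-move pr st , hi , gap′ , blocked)))
      where
      gap′ : 2 + toℕ r ≤ toℕ q
      gap′ = subst (λ x → 2 + x ≤ toℕ q) (trans (cong suc (sym p≡a)) (sym p⋖r)) gap
      blocked : ∀ {s} → s ⋖ r → Blocked (u ▸ r) r s
      blocked s⋖r with refl ← ⋗-unique s⋖r p⋖r = Blocked-new (inner p⋖r (ℕₚ.≤-reflexive (sym p≡a))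
        (ℕₚ.≤-trans gap′ (ℕₚ.<⇒≤ (Finₚ.toℕ<n q)))) st

    -- On the way back in no second turn is possible: just after the first turn the word has a tail
    -- of length 3 over the bond 4, and later a tail of length 2 over a bond 3. So there is a single
    -- excursion out and back.
    outward : ∀ {u q l μ r} → Out (2 + a) μ q ⊎ In μ q → u ~ l ⧺ μ → Step u q r → q ⋖ r → Out (2 + a) (μ ▸ r) r
    outward (inj₁ o) e st q⋖r = up o q⋖r
    outward (inj₂ (turn (base eq) q⋖q₀ _ hi em)) e st q⋖r =
      ⊥-elim (ℕₚ.<-irrefl refl (ℕₚ.≤-trans (s≤s hi) (ℕₚ.≤-reflexive (trans (sym q⋖q₀) eq))))
    outward {l = l} (inj₂ (turn (up o q′⋖q₀) q⋖q₀ _ hi em)) e st q⋖r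
      with refl ← ⋖-unique q⋖r q⋖q₀ | refl ← ⋗-unique q′⋖q₀ q⋖q₀ | ν , refl ← Out-last o =
      ⊥-elim (Step-¬Blocked st (l ⧺ ν , 3 , trans (sym em) (M-sym _ _) , e))
    outward {l = l} (inj₂ (down i q⋖q₀ hi)) e st q⋖r
      with refl ← ⋖-unique q⋖r q⋖q₀ | ν , refl ← In-last i =
      ⊥-elim (Step-¬Blocked st (Blocked-3 (inner q⋖r (ℕₚ.≤-trans (ℕₚ.m≤n+m a 2) hi) (In-inner i)) e))

    inward : ∀ {u q l μ r} → Out (2 + a) μ q ⊎ In μ q → u ~ l ⧺ μ → Step u q r → r ⋖ q → High r → In (μ ▸ r) r
    inward (inj₂ i) e st r⋖q hi = down i r⋖q hi
    inward (inj₁ (base eq)) e st r⋖q hi = ⊥-elim (ℕₚ.<-irrefl refl (ℕₚ.≤-trans (s≤s hi) (ℕₚ.≤-reflexive (trans (sym r⋖q) eq))))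
    inward {u} {q} {l} {r = r} (inj₁ o@(up o′ q′⋖q)) e st r⋖q hi
      with refl ← ⋗-unique q′⋖q r⋖q | ν , refl ← Out-last o′ = by-weight (last r⋖q a≤r) (ℕₚ.m≤n⇒m<n∨m≡n (Finₚ.toℕ<n q))
      where
      a≤r = ℕₚ.≤-trans (ℕₚ.m≤n+m a 2) hi
      absurd : M r q ≡ 3 → ⊥
      absurd em = Step-¬Blocked st (Blocked-3 (trans (M-sym q r) em) e)
      by-weight : M r q ≡ 3 ⊎ M r q ≡ 4 → suc (toℕ q) < n ⊎ suc (toℕ q) ≡ n → In (ν ▸ r ▸ q ▸ r) r
      by-weight (inj₁ em) _ = ⊥-elim (absurd em)
      by-weight (inj₂ _) (inj₁ lt) = ⊥-elim (absurd (inner r⋖q a≤r lt))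
      by-weight (inj₂ em) (inj₂ eq) = turn o r⋖q eq hi (trans (M-sym q r) em)

    right-step : ∀ {u p q l μ r} → Pair u p q → L l p → Out (2 + a) μ q ⊎ In μ q → u ~ l ⧺ μ → Step u q r →
      Dead (u ▸ r) ⊎ Alive (u ▸ r)
    right-step {u} {p} {q} {l} {μ} {r} pr lp ph e st with neighbour (Step-3≤ st)
    ... | inj₁ q⋖r = inj₂ (p , r , l , μ ▸ r , Pair-swap (Pair-move (Pair-swap pr) st) , lp ,
            inj₁ (outward ph e st q⋖r) , ~-▸ r e)
    ... | inj₂ r⋖q with ℕₚ.≤-<-connex (2 + a) (toℕ r)
    ...   | inj₁ hi = inj₂ (p , r , l , μ ▸ r , Pair-swap (Pair-move (Pair-swap pr) st) , lp ,
            inj₂ (inward ph e st r⋖q hi) , ~-▸ r e)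
    ...   | inj₂ lt with r≡ ← ℕₚ.≤-antisym (ℕₚ.≤-pred lt) (ℕₚ.≤-pred (subst (2 + a ≤_) r⋖q (phase-high⁺ ph)))
              | ℕₚ.m≤n⇒m<n∨m≡n (L-low lp)
    ...     | inj₂ eq = inj₁ (inj₁ (Pair-collide (Pair-swap pr) st (adjacent′ (trans r≡ (cong suc (sym eq))))))
    ...     | inj₁ lo = inj₁ (inj₂ (inj₂ (p , r , Pair-swap (Pair-move (Pair-swap pr) st) , lo , r≡ , blocked)))
      where
      blocked : ∀ {s} → r ⋖ s → Blocked (u ▸ r) r s
      blocked r⋖s with refl ← ⋖-unique r⋖s r⋖q = Blocked-new (trans (M-sym q r) (middle r⋖q r≡)) st

    Reach-status : ∀ {s t} → toℕ t ≡ 2 + a → L (ε ▸ s) s → ∀ {u} → Reach (ε ▸ s ▸ t) u → Dead u ⊎ Alive u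
    Reach-status {s} {t} et ls start = inj₂ (s , t , ε ▸ s , ε ▸ t , Pair-start , ls , inj₁ (base et) , ~-refl)
    Reach-status et ls (ρ then st) with Reach-status et ls ρ
    ... | inj₁ dead = inj₁ (Dead-step dead st)
    ... | inj₂ (p , q , l , μ , pr , lp , ph , e) with pr (Step-D st)
    ...   | inj₁ refl = left-step pr lp ph e st
    ...   | inj₂ refl = right-step pr lp ph e st

    Reach-final : ∀ {s t} → toℕ s ≡ a → toℕ t ≡ 2 + a → L (ε ▸ s) s → ∀ {u} → Reach (ε ▸ s ▸ t) u → D u s → D u t →
      Σ W λ l → Σ W λ μ → L l s × (Out (2 + a) μ t ⊎ In μ t) × u ~ l ⧺ μ
    Reach-final es et ls ρ ds dt with Reach-status et ls ρ
    ... | inj₁ dead = ⊥-elim (Dead-final es et dead ds dt)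
    ... | inj₂ (p , q , l , μ , pr , lp , ph , e) with pr ds | pr dt
    ...   | inj₁ refl | inj₂ refl = l , μ , lp , ph , e
    ...   | inj₂ refl | _ = ⊥-elim (ℕₚ.<-irrefl (sym es) (ℕₚ.≤-trans (ℕₚ.n≤1+n _) (phase-high⁺ ph)))
    ...   | _ | inj₁ refl = ⊥-elim (ℕₚ.<-irrefl refl (ℕₚ.≤-trans (subst (suc a <_) (sym et) ℕₚ.≤-refl) (ℕₚ.≤-trans (L-low lp) (ℕₚ.n≤1+n a))))

  In-weight : ∀ {μ q} → In μ q → Σ (Fin n) λ s → Σ (Fin n) λ t → s ⋖ t × a ≤ toℕ s × M t s ≡ 4
  In-weight (turn _ r⋖q _ hi em) = _ , _ , r⋖q , ℕₚ.≤-trans (ℕₚ.m≤n+m a 2) hi , em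
  In-weight (down i _ _) = In-weight i

-- Vertices are numbered from 0, so v₀, v₁, v₃ carry the labels 1, 2, 4. The left particle bounces over the
-- heavy bond {v₀ , v₁}.
module BentPath {n : ℕ} (M : CoxeterMatrix n)
  (M-sym : ∀ s t → M s t ≡ M t s) (M-diag : ∀ s → M s s ≡ 1) (bond : ∀ {s t} → s ≢ t → Bond (M s t))
  (M-far : ∀ {s t} → suc (toℕ s) < toℕ t → M s t ≡ 2)
  (adjacent : ∀ {s t : Fin n} → toℕ t ≡ suc (toℕ s) → 3 ≤ M s t)
  (middle : ∀ {s t : Fin n} → toℕ t ≡ suc (toℕ s) → toℕ s ≡ 2 → M s t ≡ 3)
  (inner : ∀ {s t : Fin n} → toℕ t ≡ suc (toℕ s) → 1 ≤ toℕ s → suc (toℕ t) < n → M s t ≡ 3)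
  (last : ∀ {s t : Fin n} → toℕ t ≡ suc (toℕ s) → 1 ≤ toℕ s → M s t ≡ 3 ⊎ M s t ≡ 4)
  (v₀ v₁ v₃ : Fin n) (e₀ : toℕ v₀ ≡ 0) (e₁ : toℕ v₁ ≡ 1) (e₃ : toℕ v₃ ≡ 3) (4≤m : 4 ≤ M v₁ v₀)
  where

  open PathWithEnds M M-sym M-diag bond M-far 1 (s≤s z≤n) adjacent middle inner last public

  v₁≢v₀ : v₁ ≢ v₀
  v₁≢v₀ eq with () ← trans (sym e₁) (trans (cong toℕ eq) e₀)

  Ends : Fin n → Fin n → Set
  Ends p r = (p ≡ v₀ × r ≡ v₁) ⊎ (p ≡ v₁ × r ≡ v₀)

  -- A tail of length m - 1 blocks the next letter, so `j` stays at most m - 1; `first p r j ≡ v₁`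
  -- records that the bouncing began at `v₁`.
  Bounce : W → Fin n → Set
  Bounce l p = Σ (Fin n) λ r → Σ ℕ λ j → Ends p r × 1 ≤ j × suc j ≤ M p r × first p r j ≡ v₁ × l ≡ altʳ p r j

  low₀ : Low v₀
  low₀ = subst (_≤ 1) (sym e₀) z≤n

  low₁ : Low v₁
  low₁ = ℕₚ.≤-reflexive e₁

  Ends-low : ∀ {p r} → Ends p r → Low p × Low r
  Ends-low (inj₁ (refl , refl)) = low₀ , low₁
  Ends-low (inj₂ (refl , refl)) = low₁ , low₀

  Ends-swap : ∀ {p r} → Ends p r → Ends r p
  Ends-swap (inj₁ (e , f)) = inj₂ (f , e)
  Ends-swap (inj₂ (e , f)) = inj₁ (f , e)

  Ends-other : ∀ {p r r′} → Low r → Ends p r′ → p ⋖ r ⊎ r ⋖ p → r ≡ r′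
  Ends-other lo (inj₁ (refl , refl)) (inj₁ p⋖r) = Finₚ.toℕ-injective (trans p⋖r (trans (cong suc e₀) (sym e₁)))
  Ends-other lo (inj₁ (refl , refl)) (inj₂ r⋖p) with () ← trans (sym e₀) r⋖p
  Ends-other lo (inj₂ (refl , refl)) (inj₁ p⋖r) with s≤s () ← subst (_≤ 1) (trans p⋖r (cong suc e₁)) lo
  Ends-other lo (inj₂ (refl , refl)) (inj₂ r⋖p) = Finₚ.toℕ-injective (trans (ℕₚ.suc-injective (trans (sym r⋖p) e₁)) (sym e₀))

  altʳ-letters : ∀ {P : Fin n → Set} j {p r} → P p → P r → Letters P (altʳ p r j)
  altʳ-letters zero pp pr = ε
  altʳ-letters (suc j) pp pr = altʳ-letters j pr pp ▸ pp

  low-past : ∀ {l μ} → Letters Low l → Letters High μ → μ ⧺ l ~ l ⧺ μ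
  low-past lo hi = ~-⧺-comm (Letters-map (λ p → Letters-map (low-high p) hi) lo)

  Bounce-low : ∀ {l p} → Bounce l p → Low p
  Bounce-low (_ , _ , ends , _) = proj₁ (Ends-low ends)

  Bounce-step : ∀ {u l μ p r} → Bounce l p → Letters High μ → u ~ l ⧺ μ → Step u p r → Low r → Bounce (l ▸ r) r
  Bounce-step {u} {l} {μ} {p} {r} (r′ , j , ends , 1≤j , j<m , f , refl) hi e st lo
    with refl ← Ends-other lo ends (neighbour (Step-3≤ st)) =
    p , suc j , Ends-swap ends , s≤s z≤n , subst (2 + j ≤_) (M-sym p r) bound , f , refl
    where
    bound : suc j < M p r
    bound with ℕₚ.m≤n⇒m<n∨m≡n j<m
    ... | inj₁ lt = lt
    ... | inj₂ eq = ⊥-elim (Step-¬Blocked st (μ , j , eq , ~-trans e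
            (~-sym (low-past (altʳ-letters j (proj₁ (Ends-low ends)) (proj₂ (Ends-low ends))) hi))))

  open Live Bounce Bounce-low Bounce-step

  start-bounce : Bounce (ε ▸ v₁) v₁
  start-bounce = v₀ , 1 , inj₂ (refl , refl) , s≤s z≤n , ℕₚ.≤-trans (s≤s (s≤s z≤n)) 4≤m , refl , refl

  Bond-≤5 : ∀ {m} → Bond m → m ≤ 5
  Bond-≤5 (b2 refl) = s≤s (s≤s z≤n)
  Bond-≤5 (b3 refl) = s≤s (s≤s (s≤s z≤n))
  Bond-≤5 (b4 refl) = s≤s (s≤s (s≤s (s≤s z≤n)))
  Bond-≤5 (b5 refl) = s≤s (s≤s (s≤s (s≤s (s≤s z≤n))))

  -- Beginning and ending in `v₁` forces an odd length, and the length is at most 5 - 1 = 4. So the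
  -- weights 4 and 5 allow the same two words.
  Bounce-final : ∀ {l} → Bounce l v₁ → l ≡ ε ▸ v₁ ⊎ l ≡ ε ▸ v₁ ▸ v₀ ▸ v₁
  Bounce-final (r , j , inj₁ (eq , _) , _) = ⊥-elim (v₁≢v₀ eq)
  Bounce-final (r , 1 , inj₂ (_ , refl) , _ , _ , _ , refl) = inj₁ refl
  Bounce-final (r , 2 , inj₂ (_ , refl) , _ , _ , f , _) = ⊥-elim (v₁≢v₀ (sym f))
  Bounce-final (r , 3 , inj₂ (_ , refl) , _ , _ , _ , refl) = inj₂ refl
  Bounce-final (r , 4 , inj₂ (_ , refl) , _ , _ , f , _) = ⊥-elim (v₁≢v₀ (sym f))
  Bounce-final (r , suc (suc (suc (suc (suc j)))) , inj₂ (_ , refl) , _ , le , _) =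
    ⊥-elim (ℕₚ.<⇒≱ (ℕₚ.≤-trans (ℕₚ.m≤m+n 6 j) le) (Bond-≤5 (bond v₁≢v₀)))

  classification : ∀ {u} → Reach (ε ▸ v₁ ▸ v₃) u → D u v₁ → D u v₃ →
    Σ W λ μ → (Out 3 μ v₃ ⊎ In μ v₃) × (u ~ (ε ▸ v₁) ⧺ μ ⊎ u ~ (ε ▸ v₁ ▸ v₀ ▸ v₁) ⧺ μ)
  classification ρ d₁ d₃ with l , μ , bn , ph , e ← Reach-final e₁ e₃ start-bounce ρ d₁ d₃ | Bounce-final bn
  ... | inj₁ refl = μ , ph , inj₁ e
  ... | inj₂ refl = μ , ph , inj₂ e

  -- The letters of `μ` commute with `v₀` and `v₁`, so the bounce can be played after the whole
  -- excursion of the right particle.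
  bounce : ∀ {x μ} → Letters High μ → Reach x ((ε ▸ v₁) ⧺ μ) → Reach x ((ε ▸ v₁) ⧺ μ ▸ v₀ ▸ v₁)
  bounce {x} {μ} hi ρ = (ρ then st₀) then st₁
    where
    ¬D-low : ∀ {s} → Low s → ¬ D μ s
    ¬D-low lo d = ℕₚ.<⇒≱ (Letters-D hi d) (ℕₚ.≤-trans lo (s≤s z≤n))
    e : (ε ▸ v₁) ⧺ μ ~ μ ▸ v₁
    e = ~-sym (low-past (ε ▸ low₁) hi)
    st₀ : Step ((ε ▸ v₁) ⧺ μ) v₁ v₀
    st₀ = step μ 1 (s≤s z≤n) (ℕₚ.≤-trans (s≤s (s≤s (s≤s z≤n))) 4≤m) e (¬D-low low₁) (¬D-low low₀)
    st₁ : Step ((ε ▸ v₁) ⧺ μ ▸ v₀) v₀ v₁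
    st₁ = step μ 2 (s≤s z≤n) (subst (4 ≤_) (M-sym v₁ v₀) 4≤m) (~-▸ v₀ e) (¬D-low low₀) (¬D-low low₁)

  bounce-~ : ∀ {μ} → Letters High μ → (ε ▸ v₁) ⧺ μ ▸ v₀ ▸ v₁ ~ (ε ▸ v₁ ▸ v₀ ▸ v₁) ⧺ μ
  bounce-~ hi = ~-trans (~-▸ v₁ (~-past (Letters-map (low-high low₀) hi))) (~-past (Letters-map (low-high low₁) hi))

  private
    x : W
    x = ε ▸ v₁ ▸ v₃

  Below : Fin n → Fin n → Set
  Below q t = toℕ t < toℕ q

  Out-below : ∀ {μ q} → Out 3 (μ ▸ q) q → Letters (Below q) μ
  Out-below (base _) = ε
  Out-below (up o q⋖r) with ν , refl ← Out-last o =
    Letters-map (λ lt → ℕₚ.≤-trans (ℕₚ.m<n⇒m<1+n lt) (ℕₚ.≤-reflexive (sym q⋖r))) (Out-below o) ▸ ℕₚ.≤-reflexive (sym q⋖r)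

  v₁-below : ∀ {q} → High q → Below q v₁
  v₁-below hi = subst (_< _) (sym e₁) (ℕₚ.≤-trans (ℕₚ.n≤1+n 2) hi)

  ¬D-below : ∀ {q μ s} → High q → Letters (Below q) μ → toℕ q ≤ toℕ s → ¬ D ((ε ▸ v₁) ⧺ μ) s
  ¬D-below hi ls le d = ℕₚ.<⇒≱ (Letters-D (Letters-⧺ (ε ▸ v₁-below hi) ls) d) le

  Out-reach : ∀ {μ q} → Out 3 μ q → Reach x ((ε ▸ v₁) ⧺ μ) × Pair ((ε ▸ v₁) ⧺ μ) v₁ q
  Out-reach (base eq) with refl ← Finₚ.toℕ-injective (trans eq (sym e₃)) = start , Pair-start
  Out-reach {q = r} (up {q = q} o q⋖r) with ρ , pr ← Out-reach o | ν , refl ← Out-last o =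
    (ρ then st) , Pair-swap (Pair-move (Pair-swap pr) st)
    where
    hi = Out-high⁺ o
    st : Step ((ε ▸ v₁) ⧺ ν ▸ q) q r
    st = step ((ε ▸ v₁) ⧺ ν) 1 (s≤s z≤n) (adjacent q⋖r) ~-refl
      (¬D-below hi (Out-below o) ℕₚ.≤-refl) (¬D-below hi (Out-below o) (ℕₚ.≤-trans (ℕₚ.n≤1+n _) (ℕₚ.≤-reflexive (sym q⋖r))))

  -- The `Pair` of the word before its last letter is carried along because the next step inward
  -- needs that neither end of its edge is a descent of that earlier word.
  In-reach : ∀ {μ q} → In μ q → Reach x ((ε ▸ v₁) ⧺ μ) × Pair ((ε ▸ v₁) ⧺ μ) v₁ q ×
    Σ W λ ν → Σ (Fin n) λ q₀ → μ ≡ ν ▸ q × q ⋖ q₀ × Pair ((ε ▸ v₁) ⧺ ν) v₁ q₀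
  In-reach (turn (base eq) r⋖q _ hi _) = ⊥-elim (ℕₚ.<-irrefl refl (ℕₚ.≤-trans (s≤s hi) (ℕₚ.≤-reflexive (trans (sym r⋖q) eq))))
  In-reach (turn {q = q} {r} o@(up o′ q′⋖q) r⋖q _ hi em)
    with refl ← ⋗-unique q′⋖q r⋖q | ρ , pr ← Out-reach o | ν , refl ← Out-last o′ =
    (ρ then st) , Pair-swap (Pair-move (Pair-swap pr) st) , _ , q , refl , r⋖q , pr
    where
    st : Step ((ε ▸ v₁) ⧺ ν ▸ r ▸ q) q r
    st = step ((ε ▸ v₁) ⧺ ν) 2 (s≤s z≤n) (ℕₚ.≤-reflexive (sym em)) ~-refl
      (¬D-below hi (Out-below o′) (ℕₚ.≤-trans (ℕₚ.n≤1+n _) (ℕₚ.≤-reflexive (sym r⋖q)))) (¬D-below hi (Out-below o′) ℕₚ.≤-refl)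
  In-reach (down {q = q} {r} i r⋖q hi) with ρ , pr , ν , q₀ , refl , q⋖q₀ , pr₀ ← In-reach i =
    (ρ then st) , Pair-swap (Pair-move (Pair-swap pr) st) , _ , q , refl , r⋖q , pr
    where
    before : ∀ {s} → High s → toℕ s < toℕ q₀ → ¬ D ((ε ▸ v₁) ⧺ ν) s
    before hi lt d with pr₀ d
    ... | inj₁ refl = ℕₚ.<⇒≱ hi (ℕₚ.≤-trans low₁ (s≤s z≤n))
    ... | inj₂ refl = ℕₚ.<-irrefl refl lt
    q<q₀ = ℕₚ.≤-reflexive (sym q⋖q₀)
    st : Step ((ε ▸ v₁) ⧺ ν ▸ q) q r
    st = step ((ε ▸ v₁) ⧺ ν) 1 (s≤s z≤n) (subst (3 ≤_) (M-sym r q) (adjacent r⋖q)) ~-refl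
      (before (In-high⁺ i) q<q₀) (before hi (ℕₚ.≤-trans (ℕₚ.≤-reflexive (sym r⋖q)) (ℕₚ.<⇒≤ q<q₀)))

  involution : ∀ {l μ} → Letters Low l → Letters High μ → reverse ⟦ l ⟧ ≡ ⟦ l ⟧ → reverse ⟦ μ ⟧ ≡ ⟦ μ ⟧ →
    reverse ⟦ l ⧺ μ ⟧ ≈ ⟦ l ⧺ μ ⟧
  involution {l} {μ} lo hi el eμ = ≈-trans (≈-reflexive (begin
    reverse ⟦ l ⧺ μ ⟧             ≡⟨ cong reverse (⟦⧺⟧ l μ) ⟩
    reverse (⟦ l ⟧ ++ ⟦ μ ⟧)      ≡⟨ Listₚ.reverse-++ ⟦ l ⟧ ⟦ μ ⟧ ⟩
    reverse ⟦ μ ⟧ ++ reverse ⟦ l ⟧ ≡⟨ cong₂ _++_ eμ el ⟩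
    ⟦ μ ⟧ ++ ⟦ l ⟧                ≡⟨ ⟦⧺⟧ μ l ⟨
    ⟦ μ ⧺ l ⟧                     ∎)) (words (~⇒≋ (low-past lo hi)))
    where open ≡-Reasoning

  private
    l₂ l₂₁₂ μ₄ : W
    l₂ = ε ▸ v₁
    l₂₁₂ = ε ▸ v₁ ▸ v₀ ▸ v₁
    μ₄ = ε ▸ v₃

    high₃ : Letters High μ₄
    high₃ = ε ▸ ℕₚ.≤-reflexive (sym e₃)

  Member : Word → Set
  Member v = reverse v ≈ v × Σ W λ u → Reach x u × ⟦ u ⟧ ≈ v

  member-2 : ∀ {μ} → Letters High μ → reverse ⟦ μ ⟧ ≡ ⟦ μ ⟧ → Reach x (l₂ ⧺ μ) → Member ⟦ l₂ ⧺ μ ⟧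
  member-2 hi eq ρ = involution (ε ▸ low₁) hi refl eq , _ , ρ , ≈-refl

  member-212 : ∀ {μ} → Letters High μ → reverse ⟦ μ ⟧ ≡ ⟦ μ ⟧ → Reach x (l₂ ⧺ μ) → Member ⟦ l₂₁₂ ⧺ μ ⟧
  member-212 hi eq ρ = involution (ε ▸ low₁ ▸ low₀ ▸ low₁) hi refl eq , _ , bounce hi ρ , words (~⇒≋ (bounce-~ hi))

  commuting : Com v₁ v₃
  commuting = low-high low₁ (ℕₚ.≤-reflexive (sym e₃))

  IEquals-bent : (∀ {μ} → ¬ In μ v₃) → IEquals ⟦ x ⟧ ⟦ x ⟧ (⟦ l₂ ⧺ μ₄ ⟧ ∷ ⟦ l₂₁₂ ⧺ μ₄ ⟧ ∷ [])
  IEquals-bent no-turn = IEquals-intro commuting only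
    (member-2 high₃ refl start ∷ member-212 high₃ refl start ∷ [])
    where
    only : ∀ {u} → Reach x u → D u v₁ → D u v₃ → Any (⟦ u ⟧ ≈_) _
    only ρ d₁ d₃ with classification ρ d₁ d₃
    ... | μ , inj₂ i , _ = ⊥-elim (no-turn i)
    ... | μ , inj₁ o , e with refl ← Out-base o e₃ | e
    ...   | inj₁ e₂ = here (words (~⇒≋ e₂))
    ...   | inj₂ e₂₁₂ = there (here (words (~⇒≋ e₂₁₂)))

  IEquals-bent² : ∀ ζ → In ζ v₃ → (∀ {μ} → In μ v₃ → ⟦ μ ⟧ ≡ ⟦ ζ ⟧) → reverse ⟦ ζ ⟧ ≡ ⟦ ζ ⟧ →
    IEquals ⟦ x ⟧ ⟦ x ⟧ (⟦ l₂ ⧺ μ₄ ⟧ ∷ ⟦ l₂₁₂ ⧺ μ₄ ⟧ ∷ ⟦ l₂ ⧺ ζ ⟧ ∷ ⟦ l₂₁₂ ⧺ ζ ⟧ ∷ [])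
  IEquals-bent² ζ iζ unique palindrome = IEquals-intro commuting only
    (member-2 high₃ refl start ∷ member-212 high₃ refl start ∷
     member-2 (In-high iζ) palindrome ρζ ∷ member-212 (In-high iζ) palindrome ρζ ∷ [])
    where
    ρζ = proj₁ (In-reach iζ)
    only : ∀ {u} → Reach x u → D u v₁ → D u v₃ → Any (⟦ u ⟧ ≈_) _
    only ρ d₁ d₃ with classification ρ d₁ d₃
    only ρ d₁ d₃ | μ , inj₁ o , e with refl ← Out-base o e₃ | e
    ... | inj₁ e₂ = here (words (~⇒≋ e₂))
    ... | inj₂ e₂₁₂ = there (here (words (~⇒≋ e₂₁₂)))
    only ρ d₁ d₃ | μ , inj₂ i , e with e
    ... | inj₁ e₂ = there (there (here (≈-trans (words (~⇒≋ e₂)) (≈-reflexive (same-tail l₂)))))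
      where
      same-tail : ∀ l → ⟦ l ⧺ μ ⟧ ≡ ⟦ l ⧺ ζ ⟧
      same-tail l = trans (⟦⧺⟧ l μ) (trans (cong (⟦ l ⟧ ++_) (unique i)) (sym (⟦⧺⟧ l ζ)))
    ... | inj₂ e₂₁₂ = there (there (there (here (≈-trans (words (~⇒≋ e₂₁₂)) (≈-reflexive (same-tail l₂₁₂))))))
      where
      same-tail : ∀ l → ⟦ l ⧺ μ ⟧ ≡ ⟦ l ⧺ ζ ⟧
      same-tail l = trans (⟦⧺⟧ l μ) (trans (cong (⟦ l ⟧ ++_) (unique i)) (sym (⟦⧺⟧ l ζ)))

  Out-exists : ∀ d {q} → toℕ q ≡ 3 + d → Σ W λ μ → Out 3 μ q
  Out-exists zero eq = _ , base eq
  Out-exists (suc d) {q} eq = _ , up (proj₂ (Out-exists d (Finₚ.toℕ-fromℕ< lt))) (trans eq (cong suc (sym (Finₚ.toℕ-fromℕ< lt))))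
    where
    lt : 3 + d < n
    lt = ℕₚ.≤-trans (ℕₚ.≤-reflexive (sym eq)) (ℕₚ.<⇒≤ (Finₚ.toℕ<n q))

  In-exists : (∀ {s t} → s ⋖ t → suc (toℕ t) ≡ n → M t s ≡ 4) →
    ∀ d {q} → High q → suc (suc d) + toℕ q ≡ n → Σ W λ μ → In μ q
  In-exists top d {q} hi eq = from d eq
    where
    lt : suc (toℕ q) < n
    lt = subst (suc (toℕ q) <_) eq (s≤s (s≤s (ℕₚ.m≤n+m (toℕ q) d)))
    r : Fin n
    r = Fin.fromℕ< lt
    q⋖r : q ⋖ r
    q⋖r = Finₚ.toℕ-fromℕ< lt
    high-r : High r
    high-r = ℕₚ.≤-trans hi (ℕₚ.≤-trans (ℕₚ.n≤1+n _) (ℕₚ.≤-reflexive (sym q⋖r)))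
    from : ∀ d → suc (suc d) + toℕ q ≡ n → Σ W λ μ → In μ q
    from zero eq = _ , turn (proj₂ (Out-exists (toℕ r ∸ 3) (sym (ℕₚ.m+[n∸m]≡n high-r)))) q⋖r (trans (cong suc q⋖r) eq) hi
      (top q⋖r (trans (cong suc q⋖r) eq))
    from (suc d) eq = _ , down (proj₂ (In-exists top d high-r
      (trans (cong (suc (suc d) +_) q⋖r) (trans (ℕₚ.+-suc (suc (suc d)) (toℕ q)) eq)))) q⋖r hi

-- Types A, B, H and affine C

toℕ-idx : ∀ {m a} → a ≤ m → toℕ (idx {m} a) ≡ a
toℕ-idx {zero} z≤n = refl
toℕ-idx {suc m} {zero} le = refl
toℕ-idx {suc m} {suc a} (s≤s le) = cong suc (toℕ-idx le)

≡ᵇ-≢ : ∀ {a b} → a ≢ b → (a ℕ.≡ᵇ b) ≡ false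
≡ᵇ-≢ {a} {b} ne with a ℕ.≡ᵇ b in eq
... | false = refl
... | true = ⊥-elim (ne (ℕₚ.≡ᵇ⇒≡ a b (Equivalence.from T-≡ eq)))

≡ᵇ-refl : ∀ a → (a ℕ.≡ᵇ a) ≡ true
≡ᵇ-refl zero = refl
≡ᵇ-refl (suc a) = ≡ᵇ-refl a

module PathMatrix (n : ℕ) (e : ℕ → ℕ) (be : ∀ k → Bond (e k)) where

  M : CoxeterMatrix n
  M = pathM n e

  M-sym : ∀ s t → M s t ≡ M t s
  M-sym s t = pathRule-sym e (toℕ s) (toℕ t)

  M-diag : ∀ s → M s s ≡ 1
  M-diag s = pathRule-diag e (toℕ s)

  M-bond : ∀ {s t} → s ≢ t → Bond (M s t)
  M-bond ne = pathRule-bond e be (λ eq → ne (Finₚ.toℕ-injective eq))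

  M-far : ∀ {s t} → suc (toℕ s) < toℕ t → M s t ≡ 2
  M-far = pathRule-far e

  -- `e` is indexed by the 1-based label of the lower end; for `s` that label is `suc (toℕ s)`,
  -- which is `toℕ t`.
  M-weight : ∀ {s t} → toℕ t ≡ suc (toℕ s) → M s t ≡ e (toℕ t)
  M-weight {s} {t} eq = trans (cong (pathRule e (toℕ s)) eq) (trans (pathRule-suc e (toℕ s)) (cong e (sym eq)))

  M-adjacent : (∀ k → 3 ≤ e k) → ∀ {s t} → toℕ t ≡ suc (toℕ s) → 3 ≤ M s t
  M-adjacent le {s} {t} eq = subst (3 ≤_) (sym (M-weight {s} {t} eq)) (le (toℕ t))

3≤3 : 3 ≤ 3
3≤3 = ℕₚ.≤-refl

-- On three vertices every star operation makes the two particles meet.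
module ShortPath (e : ℕ → ℕ) (be : ∀ k → Bond (e k)) (le : ∀ k → 3 ≤ e k) where

  open PathMatrix 3 e be
  open Path M M-sym M-diag M-bond (λ {s} {t} → M-far {s} {t})

  private
    v₀ v₁ v₂ : Fin 3
    v₀ = Fin.zero
    v₁ = Fin.suc Fin.zero
    v₂ = Fin.suc (Fin.suc Fin.zero)

    x : W
    x = ε ▸ v₀ ▸ v₂

  status : ∀ {u} → Reach x u → u ≡ x ⊎ Only u
  status start = inj₁ refl
  status (ρ then st) with status ρ
  ... | inj₂ only = inj₂ (Only-step only st)
  ... | inj₁ refl = inj₂ (collide (Pair-start {v₀} {v₂} (Step-D st)) st)
    where
    collide : ∀ {l r} → l ≡ v₀ ⊎ l ≡ v₂ → Step x l r → Only (x ▸ r)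
    collide {r = Fin.zero} (inj₁ refl) st with s≤s () ← Step-3≤ st
    collide {r = Fin.suc Fin.zero} (inj₁ refl) st = Pair-collide (Pair-start {v₀} {v₂}) st (le 2)
    collide {r = Fin.suc (Fin.suc Fin.zero)} (inj₁ refl) st with s≤s (s≤s ()) ← Step-3≤ st
    collide {r = Fin.zero} (inj₂ refl) st with s≤s (s≤s ()) ← Step-3≤ st
    collide {r = Fin.suc Fin.zero} (inj₂ refl) st = Pair-collide (Pair-swap (Pair-start {v₀} {v₂})) st (le 1)
    collide {r = Fin.suc (Fin.suc Fin.zero)} (inj₂ refl) st with s≤s () ← Step-3≤ st

  IEquals-short : IEquals ⟦ x ⟧ ⟦ x ⟧ (⟦ x ⟧ ∷ [])
  IEquals-short = IEquals-trivial {v₀} {v₂} refl only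
    where
    only : ∀ {u} → Reach x u → D u v₀ → D u v₂ → ⟦ u ⟧ ≈ ⟦ x ⟧
    only ρ d₀ d₂ with status ρ
    ... | inj₁ refl = ≈-refl
    ... | inj₂ o = ⊥-elim (Only-≢ o (λ ()) d₀ d₂)

typeA-cell : ∀ k → Coxeter.IEquals (typeA (3 + k)) (ws (1 ∷ 3 ∷ [])) (ws (1 ∷ 3 ∷ [])) (ws (1 ∷ 3 ∷ []) ∷ [])
typeA-cell k = IEquals-trivial {v₀} {v₂} com only
  where
  open PathMatrix (3 + k) (λ _ → 3) (λ _ → b3 refl)
  three : ∀ {s t} → toℕ t ≡ suc (toℕ s) → M s t ≡ 3
  three {s} {t} = M-weight {s} {t}
  open PathWithEnds M M-sym M-diag M-bond (λ {s} {t} → M-far {s} {t}) 0 z≤n (λ {s} {t} → M-adjacent (λ _ → 3≤3) {s} {t})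
    (λ {s} {t} eq _ → three {s} {t} eq) (λ {s} {t} eq _ _ → three {s} {t} eq) (λ {s} {t} eq _ → inj₁ (three {s} {t} eq))
  v₀ v₂ : Fin (3 + k)
  v₀ = lbl 1
  v₂ = lbl 3
  e₂ : toℕ v₂ ≡ 2
  e₂ = toℕ-idx {2 + k} (s≤s (s≤s z≤n))
  com : Com v₀ v₂
  com = far {v₀} {v₂} (ℕₚ.≤-reflexive (sym e₂))
  -- With a = 0 the left half is a single vertex, so a left particle that moves at all moves to the
  -- middle.
  Still : W → Fin (3 + k) → Set
  Still l p = toℕ p ≡ 0 × l ≡ ε ▸ p
  still-step : ∀ {u l μ p r} → Still l p → Letters High μ → u ~ l ⧺ μ → Step u p r → Low r → Still (l ▸ r) r
  still-step {p = p} {r} (e , _) _ _ st lo =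
    ⊥-elim (3≤-≢ (Step-3≤ st) (Finₚ.toℕ-injective (trans e (sym (ℕₚ.n≤0⇒n≡0 lo)))))
  only : ∀ {u} → Reach (ε ▸ v₀ ▸ v₂) u → D u v₀ → D u v₂ → ⟦ u ⟧ ≈ ⟦ ε ▸ v₀ ▸ v₂ ⟧
  only ρ d₀ d₂ with Live.Reach-final Still (λ { (e , _) → ℕₚ.≤-reflexive e }) still-step refl e₂ (refl , refl) ρ d₀ d₂
  ... | _ , μ , (_ , refl) , inj₁ o , e with refl ← Out-base o e₂ = words (~⇒≋ e)
  ... | _ , μ , (_ , refl) , inj₂ i , _ with s , t , s⋖t , _ , em ← In-weight i
      with () ← trans (sym em) (trans (M-sym t s) (three {s} {t} s⋖t))

module BentFamily (k : ℕ) (e : ℕ → ℕ) (be : ∀ k → Bond (e k)) (le : ∀ k → 3 ≤ e k) (4≤e₁ : 4 ≤ e 1) (e₃≡3 : e 3 ≡ 3)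
  (inner : ∀ j → 1 ≤ j → suc (suc j) < 4 + k → e (suc j) ≡ 3)
  (last : ∀ j → 1 ≤ j → e (suc j) ≡ 3 ⊎ e (suc j) ≡ 4) where

  open PathMatrix (4 + k) e be public

  v : ℕ → Fin (4 + k)
  v = lbl

  e-v : ∀ {a} → a ≤ 3 + k → toℕ (v (suc a)) ≡ a
  e-v = toℕ-idx

  private
    weight : ∀ {s t} → toℕ t ≡ suc (toℕ s) → M s t ≡ e (suc (toℕ s))
    weight {s} {t} eq = trans (M-weight {s} {t} eq) (cong e eq)

  open BentPath M M-sym M-diag M-bond (λ {s} {t} → M-far {s} {t}) (λ {s} {t} → M-adjacent le {s} {t})
    (λ {s} {t} eq eq₂ → trans (weight {s} {t} eq) (trans (cong (λ j → e (suc j)) eq₂) e₃≡3))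
    (λ {s} {t} eq lo lt → trans (weight {s} {t} eq) (inner (toℕ s) lo (subst (λ x → suc x < 4 + k) eq lt)))
    (λ {s} {t} eq lo → subst (λ m → m ≡ 3 ⊎ m ≡ 4) (sym (weight {s} {t} eq)) (last (toℕ s) lo))
    (v 1) (v 2) (v 4) (e-v z≤n) (e-v (s≤s z≤n)) (e-v (s≤s (s≤s (s≤s z≤n)))) 4≤e₁ public

  -- A right particle turns only over a bond 4 away from the first edge, and among the types treated
  -- here only affine C has one.
  In-4 : ∀ {μ q} → In μ q → Σ ℕ λ j → 1 ≤ j × e (suc j) ≡ 4
  In-4 i with s , t , s⋖t , lo , em ← In-weight i = toℕ s , lo , trans (sym (weight {s} {t} s⋖t)) (trans (M-sym s t) em)

private
  eB eH : ℕ → ℕ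
  eB k = if k ℕ.≡ᵇ 1 then 4 else 3
  eH k = if k ℕ.≡ᵇ 1 then 5 else 3

  eB-bond : ∀ k → Bond (eB k)
  eB-bond zero = b3 refl
  eB-bond (suc zero) = b4 refl
  eB-bond (suc (suc k)) = b3 refl

  eH-bond : ∀ k → Bond (eH k)
  eH-bond zero = b3 refl
  eH-bond (suc zero) = b5 refl
  eH-bond (suc (suc k)) = b3 refl

  eB-3 : ∀ j → 1 ≤ j → eB (suc j) ≡ 3
  eB-3 (suc j) (s≤s _) = refl

  eH-3 : ∀ j → 1 ≤ j → eH (suc j) ≡ 3
  eH-3 (suc j) (s≤s _) = refl

  eB-≥ : ∀ k → 3 ≤ eB k
  eB-≥ zero = ℕₚ.≤-refl
  eB-≥ (suc zero) = ℕₚ.n≤1+n 3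
  eB-≥ (suc (suc k)) = ℕₚ.≤-refl

  eH-≥ : ∀ k → 3 ≤ eH k
  eH-≥ zero = ℕₚ.≤-refl
  eH-≥ (suc zero) = ℕₚ.m≤n+m 3 2
  eH-≥ (suc (suc k)) = ℕₚ.≤-refl

typeB₃-cell : Coxeter.IEquals (typeB 3) (ws (1 ∷ 3 ∷ [])) (ws (1 ∷ 3 ∷ [])) (ws (1 ∷ 3 ∷ []) ∷ [])
typeB₃-cell = ShortPath.IEquals-short eB eB-bond eB-≥

typeH₃-cell : Coxeter.IEquals (typeH 3) (ws (1 ∷ 3 ∷ [])) (ws (1 ∷ 3 ∷ [])) (ws (1 ∷ 3 ∷ []) ∷ [])
typeH₃-cell = ShortPath.IEquals-short eH eH-bond eH-≥

typeB-cell : ∀ k → Coxeter.IEquals (typeB (4 + k)) (ws (2 ∷ 4 ∷ [])) (ws (2 ∷ 4 ∷ []))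
  (ws (2 ∷ 4 ∷ []) ∷ ws (2 ∷ 1 ∷ 2 ∷ 4 ∷ []) ∷ [])
typeB-cell k = IEquals-bent λ i → no-turn (In-4 i)
  where
  open BentFamily k eB eB-bond eB-≥ ℕₚ.≤-refl refl (λ j lo _ → eB-3 j lo) (λ j lo → inj₁ (eB-3 j lo))
  no-turn : ¬ Σ ℕ λ j → 1 ≤ j × eB (suc j) ≡ 4
  no-turn (suc j , _ , ())

typeH-cell : ∀ k → Coxeter.IEquals (typeH (4 + k)) (ws (2 ∷ 4 ∷ [])) (ws (2 ∷ 4 ∷ []))
  (ws (2 ∷ 4 ∷ []) ∷ ws (2 ∷ 1 ∷ 2 ∷ 4 ∷ []) ∷ [])
typeH-cell k = IEquals-bent λ i → no-turn (In-4 i)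
  where
  open BentFamily k eH eH-bond eH-≥ (ℕₚ.n≤1+n 4) refl (λ j lo _ → eH-3 j lo) (λ j lo → inj₁ (eH-3 j lo))
  no-turn : ¬ Σ ℕ λ j → 1 ≤ j × eH (suc j) ≡ 4
  no-turn (suc j , _ , ())

climb : ℕ → List ℕ
climb d = map (3 +_) (upTo d)

climb-suc : ∀ d → climb (suc d) ≡ climb d ++ [ 3 + d ]
climb-suc d = trans (cong (map (3 +_)) (sym (Listₚ.upTo-∷ʳ d))) (Listₚ.map-++ (3 +_) (upTo d) [ d ])

reverse-climb-suc : ∀ d → reverse (climb (suc d)) ≡ (3 + d) ∷ reverse (climb d)
reverse-climb-suc d = trans (cong reverse (climb-suc d)) (Listₚ.reverse-++ (climb d) [ 3 + d ])

module AffineC (k : ℕ) where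

  private
    e : ℕ → ℕ
    e j = if (j ℕ.≡ᵇ 1) ∨ (j ℕ.≡ᵇ 4 + k) then 4 else 3

    e-bond : ∀ j → Bond (e j)
    e-bond j with (j ℕ.≡ᵇ 1) ∨ (j ℕ.≡ᵇ 4 + k)
    ... | true = b4 refl
    ... | false = b3 refl

    e-≥ : ∀ j → 3 ≤ e j
    e-≥ j with (j ℕ.≡ᵇ 1) ∨ (j ℕ.≡ᵇ 4 + k)
    ... | true = ℕₚ.n≤1+n 3
    ... | false = ℕₚ.≤-refl

    e-inner : ∀ j → 1 ≤ j → suc (suc j) < 5 + k → e (suc j) ≡ 3
    e-inner (suc j) _ lt rewrite ≡ᵇ-≢ (λ eq → ℕₚ.<-irrefl eq (ℕₚ.≤-pred lt)) = refl

    e-last : ∀ j → 1 ≤ j → e (suc j) ≡ 3 ⊎ e (suc j) ≡ 4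
    e-last (suc j) _ with (suc (suc j) ℕ.≡ᵇ 4 + k)
    ... | true = inj₂ refl
    ... | false = inj₁ refl

    e-top : e (4 + k) ≡ 4
    e-top rewrite ≡ᵇ-refl k = refl

  open BentFamily (suc k) e e-bond e-≥ ℕₚ.≤-refl refl e-inner e-last

  labels : W → List ℕ
  labels μ = map toℕ ⟦ μ ⟧

  labels-▸ : ∀ μ q → labels (μ ▸ q) ≡ labels μ ++ [ toℕ q ]
  labels-▸ μ q = Listₚ.map-++ toℕ ⟦ μ ⟧ [ q ]

  Out-labels : ∀ {μ q} → Out 3 μ q → ∀ d → toℕ q ≡ 3 + d → labels μ ≡ climb (suc d)
  Out-labels {q = q} (base eq) zero eq′ = cong [_] eq′
  Out-labels (base eq) (suc d) eq′ with () ← trans (sym eq) eq′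
  Out-labels (up o q⋖r) zero eq′ =
    ⊥-elim (ℕₚ.<-irrefl refl (ℕₚ.≤-trans (s≤s (Out-high⁺ o)) (ℕₚ.≤-reflexive (trans (sym q⋖r) eq′))))
  Out-labels {μ ▸ r} (up o q⋖r) (suc d) eq′ = begin
    labels (μ ▸ r)                 ≡⟨ labels-▸ μ r ⟩
    labels μ ++ [ toℕ r ]          ≡⟨ cong₂ (λ x y → x ++ [ y ]) (Out-labels o d (ℕₚ.suc-injective (trans (sym q⋖r) eq′))) eq′ ⟩
    climb (suc d) ++ [ 3 + suc d ] ≡⟨ climb-suc (suc d) ⟨
    climb (suc (suc d))            ∎
    where open ≡-Reasoning

  -- Completed by the part of the way back still to come, the word is the same at every stage. At d
  -- = 0 nothing is missing, and `μ` itself spells `z`.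
  In-labels : ∀ {μ q} → In μ q → ∀ d → toℕ q ≡ 3 + d →
    labels μ ++ reverse (climb d) ≡ climb (2 + k) ++ reverse (climb (1 + k))
  In-labels {μ ▸ r} (turn {q = q} o r⋖q top _ _) d eq = begin
    labels (μ ▸ r) ++ reverse (climb d)            ≡⟨ cong (_++ reverse (climb d)) (labels-▸ μ r) ⟩
    (labels μ ++ [ toℕ r ]) ++ reverse (climb d)   ≡⟨ Listₚ.++-assoc (labels μ) [ toℕ r ] (reverse (climb d)) ⟩
    labels μ ++ toℕ r ∷ reverse (climb d)          ≡⟨ cong₂ _++_ (Out-labels o (suc d) (trans r⋖q (cong suc eq))) (cong (_∷ reverse (climb d)) eq) ⟩
    climb (2 + d) ++ (3 + d) ∷ reverse (climb d)   ≡⟨ cong (climb (2 + d) ++_) (reverse-climb-suc d) ⟨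
    climb (2 + d) ++ reverse (climb (1 + d))       ≡⟨ cong (λ d → climb (2 + d) ++ reverse (climb (1 + d))) d≡k ⟩
    climb (2 + k) ++ reverse (climb (1 + k))       ∎
    where
    open ≡-Reasoning
    d≡k : d ≡ k
    d≡k = ℕₚ.+-cancelˡ-≡ 5 d k (trans (cong suc (sym (trans r⋖q (cong suc eq)))) top)
  In-labels {μ ▸ r} (down {q = q} i r⋖q _) d eq = begin
    labels (μ ▸ r) ++ reverse (climb d)            ≡⟨ cong (_++ reverse (climb d)) (labels-▸ μ r) ⟩
    (labels μ ++ [ toℕ r ]) ++ reverse (climb d)   ≡⟨ Listₚ.++-assoc (labels μ) [ toℕ r ] (reverse (climb d)) ⟩
    labels μ ++ toℕ r ∷ reverse (climb d)          ≡⟨ cong (λ x → labels μ ++ x ∷ reverse (climb d)) eq ⟩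
    labels μ ++ (3 + d) ∷ reverse (climb d)        ≡⟨ cong (labels μ ++_) (reverse-climb-suc d) ⟨
    labels μ ++ reverse (climb (suc d))            ≡⟨ In-labels i (suc d) (trans r⋖q (cong suc eq)) ⟩
    climb (2 + k) ++ reverse (climb (1 + k))       ∎
    where open ≡-Reasoning

  toℕ-lbl : ∀ {i} → i < 1 + k → toℕ (lbl {4 + k} (4 + i)) ≡ 3 + i
  toℕ-lbl lt = toℕ-idx (ℕₚ.≤-trans (ℕₚ.+-monoʳ-≤ 3 (ℕₚ.<⇒≤ lt)) (ℕₚ.≤-reflexive refl))

  z : Word
  z = ws (zLabels (5 + k))

  map-toℕ-z : map toℕ z ≡ climb (2 + k) ++ reverse (climb (1 + k))
  map-toℕ-z = begin
    map toℕ (map lbl (ups ++ [ 5 + k ] ++ reverse ups))             ≡⟨ Listₚ.map-∘ (ups ++ [ 5 + k ] ++ reverse ups) ⟨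
    map f (ups ++ [ 5 + k ] ++ reverse ups)                         ≡⟨ Listₚ.map-++ f ups ([ 5 + k ] ++ reverse ups) ⟩
    map f ups ++ f (5 + k) ∷ map f (reverse ups)                    ≡⟨ cong (λ x → map f ups ++ f (5 + k) ∷ x) (Listₚ.reverse-map f ups) ⟩
    map f ups ++ f (5 + k) ∷ reverse (map f ups)                    ≡⟨ cong₂ (λ x y → x ++ y ∷ reverse x) ups-climb (toℕ-idx {4 + k} ℕₚ.≤-refl) ⟩
    climb (1 + k) ++ (4 + k) ∷ reverse (climb (1 + k))              ≡⟨ Listₚ.++-assoc (climb (1 + k)) [ 4 + k ] _ ⟨
    (climb (1 + k) ++ [ 4 + k ]) ++ reverse (climb (1 + k))         ≡⟨ cong (_++ reverse (climb (1 + k))) (climb-suc (suc k)) ⟨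
    climb (2 + k) ++ reverse (climb (1 + k))                        ∎
    where
    open ≡-Reasoning
    ups = map (4 +_) (upTo (1 + k))
    f : ℕ → ℕ
    f l = toℕ (lbl {4 + k} l)
    ups-climb : map f ups ≡ climb (1 + k)
    ups-climb = trans (sym (Listₚ.map-∘ (upTo (1 + k)))) (Listₚ.map-cong-local (All.map toℕ-lbl (all-upTo (1 + k))))

  z-palindrome : reverse z ≡ z
  z-palindrome = trans (sym (Listₚ.reverse-map lbl (zLabels (5 + k)))) (cong (map lbl) (begin
    reverse (ups ++ [ 5 + k ] ++ reverse ups)         ≡⟨ Listₚ.reverse-++ ups ([ 5 + k ] ++ reverse ups) ⟩
    reverse ([ 5 + k ] ++ reverse ups) ++ reverse ups ≡⟨ cong (_++ reverse ups) (Listₚ.reverse-++ [ 5 + k ] (reverse ups)) ⟩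
    (reverse (reverse ups) ++ [ 5 + k ]) ++ reverse ups ≡⟨ cong (λ x → (x ++ [ 5 + k ]) ++ reverse ups) (Listₚ.reverse-involutive ups) ⟩
    (ups ++ [ 5 + k ]) ++ reverse ups                 ≡⟨ Listₚ.++-assoc ups [ 5 + k ] (reverse ups) ⟩
    ups ++ [ 5 + k ] ++ reverse ups                   ∎))
    where
    open ≡-Reasoning
    ups = map (4 +_) (upTo (1 + k))

  In-z : ∀ {μ} → In μ (v 4) → ⟦ μ ⟧ ≡ z
  In-z {μ} i = Listₚ.map-injective Finₚ.toℕ-injective (begin
    labels μ                                    ≡⟨ Listₚ.++-identityʳ (labels μ) ⟨
    labels μ ++ []                              ≡⟨ In-labels i 0 (e-v (s≤s (s≤s (s≤s z≤n)))) ⟩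
    climb (2 + k) ++ reverse (climb (1 + k))    ≡⟨ map-toℕ-z ⟨
    map toℕ z                                   ∎)
    where open ≡-Reasoning

  cell : IEquals (ws (2 ∷ 4 ∷ [])) (ws (2 ∷ 4 ∷ []))
    (ws (2 ∷ 4 ∷ []) ∷ ws (2 ∷ 1 ∷ 2 ∷ 4 ∷ []) ∷ (v 2 ∷ z) ∷ (v 2 ∷ v 1 ∷ v 2 ∷ z) ∷ [])
  cell = subst₂ (λ p q → IEquals (ws (2 ∷ 4 ∷ [])) (ws (2 ∷ 4 ∷ [])) (ws (2 ∷ 4 ∷ []) ∷ ws (2 ∷ 1 ∷ 2 ∷ 4 ∷ []) ∷ p ∷ q ∷ []))
    (word (ε ▸ v 2)) (word (ε ▸ v 2 ▸ v 1 ▸ v 2))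
    (IEquals-bent² ζ iζ (λ i → trans (In-z i) (sym (In-z iζ))) (trans (cong reverse (In-z iζ)) (trans z-palindrome (sym (In-z iζ)))))
    where
    top : ∀ {s t : Fin (5 + k)} → toℕ t ≡ suc (toℕ s) → suc (toℕ t) ≡ 5 + k → M t s ≡ 4
    top {s} {t} s⋖t eq = trans (M-sym t s) (trans (M-weight {s} {t} s⋖t) (trans (cong e (ℕₚ.suc-injective eq)) e-top))
    v₄≡3 : toℕ (v 4) ≡ 3
    v₄≡3 = e-v (s≤s (s≤s (s≤s z≤n)))
    exists = In-exists (λ {s} {t} → top {s} {t}) k {v 4} (ℕₚ.≤-reflexive (sym v₄≡3)) (trans (cong (2 + k +_) v₄≡3) (ℕₚ.+-comm (2 + k) 3))
    ζ = proj₁ exists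
    iζ = proj₂ exists
    word : ∀ l → ⟦ l ⧺ ζ ⟧ ≡ ⟦ l ⟧ ++ z
    word l = trans (⟦⧺⟧ l ζ) (cong (⟦ l ⟧ ++_) (In-z iζ))

typeC̃-cell : ∀ k → Coxeter.IEquals (typeCt (5 + k)) (ws (2 ∷ 4 ∷ [])) (ws (2 ∷ 4 ∷ []))
  (ws (2 ∷ 4 ∷ []) ∷ ws (2 ∷ 1 ∷ 2 ∷ 4 ∷ []) ∷ ws (2 ∷ zLabels (5 + k)) ∷ ws (2 ∷ 1 ∷ 2 ∷ zLabels (5 + k)) ∷ [])
typeC̃-cell k = AffineC.cell k

-- Vertices are numbered from 0, so v₁, v₂, v₃ carry the labels 2, 3, 4.
module FPath {n : ℕ} (M : CoxeterMatrix n)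
  (M-sym : ∀ s t → M s t ≡ M t s) (M-diag : ∀ s → M s s ≡ 1) (bond : ∀ {s t} → s ≢ t → Bond (M s t))
  (M-far : ∀ {s t} → suc (toℕ s) < toℕ t → M s t ≡ 2)
  (adjacent : ∀ {s t : Fin n} → toℕ t ≡ suc (toℕ s) → 3 ≤ M s t)
  (three : ∀ {s t : Fin n} → toℕ t ≡ suc (toℕ s) → toℕ s ≢ 1 → M s t ≡ 3)
  (v₁ v₂ v₃ : Fin n) (e₁ : toℕ v₁ ≡ 1) (e₂ : toℕ v₂ ≡ 2) (e₃ : toℕ v₃ ≡ 3) (four : M v₁ v₂ ≡ 4)
  where

  open Path M M-sym M-diag bond M-far public
  open Adjacent adjacent public

  is : ∀ {i} {s t : Fin n} → toℕ s ≡ i → toℕ t ≡ i → s ≡ t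
  is p q = Finₚ.toℕ-injective (trans p (sym q))

  three′ : ∀ {s t} → s ⋖ t → toℕ s ≢ 1 → M t s ≡ 3
  three′ {s} {t} eq ne = trans (M-sym t s) (three eq ne)

  commute : ∀ {s t i} → toℕ s ≡ i → 2 + i ≤ toℕ t → Com s t
  commute refl le = far le

  commute′ : ∀ {s t i} → toℕ s ≡ i → 2 + i ≤ toℕ t → Com t s
  commute′ eq le = Com-sym (commute eq le)

  private
    x : W
    x = ε ▸ v₁ ▸ v₃

  -- The heavy bond leads from `v₁` to the vertex `v₂` between the particles, so a bounce interferes
  -- with the right particle and the word no longer splits into commuting halves. Full words are
  -- kept in the last four phases only: from the first four the particles never stand at `v₁` and
  -- `v₃` again.
  data Phase (u : W) : Set where
    lone    : Only u → Phase u
    right   : Right 2 u → Phase u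
    left    : ∀ {p q} → Pair u p q → toℕ p ≡ 0 → toℕ q ≡ 2 → (∀ {r} → q ⋖ r → Blocked u q r) → Phase u
    corner  : ∀ {p q} → Pair u p q → toℕ p ≡ 0 → 3 ≤ toℕ q → Blocked u p v₁ → Phase u
    outward : ∀ {μ q} → Pair u v₁ q → Out 3 μ q → u ~ (ε ▸ v₁) ⧺ μ → Phase u
    at-2    : ∀ {μ q} → Pair u v₂ q → Out 3 μ q → 4 ≤ toℕ q → u ~ (ε ▸ v₁) ⧺ μ ▸ v₂ → Phase u
    back-1  : ∀ {μ q} → Pair u v₁ q → Out 3 μ q → 4 ≤ toℕ q → u ~ (ε ▸ v₁) ⧺ μ ▸ v₂ ▸ v₁ → Phase u
    back    : ∀ {v₄} → Pair u v₁ v₃ → v₃ ⋖ v₄ → u ~ ε ▸ v₁ ▸ v₃ ▸ v₄ ▸ v₂ ▸ v₁ ▸ v₃ → Phase u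

  swapped : ∀ {u p q r} → Pair u p q → Step u q r → Pair (u ▸ r) p r
  swapped pr st = Pair-swap (Pair-move (Pair-swap pr) st)

  suc-≤ : ∀ {q r i} → q ⋖ r → i ≤ toℕ q → i ≤ toℕ r
  suc-≤ q⋖r le = ℕₚ.≤-trans le (ℕₚ.≤-trans (ℕₚ.n≤1+n _) (ℕₚ.≤-reflexive (sym q⋖r)))

  pred-≤ : ∀ {q r i} → r ⋖ q → suc i ≤ toℕ q → i ≤ toℕ r
  pred-≤ {i = i} r⋖q le = ℕₚ.≤-pred (subst (suc i ≤_) r⋖q le)

  pred-≡ : ∀ {q r i} → r ⋖ q → suc i ≡ toℕ q → toℕ r ≡ i
  pred-≡ r⋖q eq = ℕₚ.suc-injective (trans (sym r⋖q) (sym eq))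

  meets : ∀ {u p q r} → Pair u p q → Step u q r → p ⋖ r → Phase (u ▸ r)
  meets pr st p⋖r = lone (Pair-collide (Pair-swap pr) st (adjacent′ p⋖r))

  meets′ : ∀ {u p q r} → Pair u p q → Step u p r → r ⋖ q → Phase (u ▸ r)
  meets′ pr st r⋖q = lone (Pair-collide pr st (adjacent r⋖q))

  to-corner : ∀ {u q r} → Pair u v₁ q → 3 ≤ toℕ q → Step u v₁ r → r ⋖ v₁ → Phase (u ▸ r)
  to-corner pr 3≤q st r⋖v₁ = corner (Pair-move pr st) r≡0 3≤q (Blocked-new (three′ r⋖v₁ (λ eq → ℕₚ.0≢1+n (trans (sym r≡0) eq))) st)
    where r≡0 = pred-≡ r⋖v₁ (sym e₁)

  v₁⋖v₂ : v₁ ⋖ v₂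
  v₁⋖v₂ = trans e₂ (cong suc (sym e₁))

  v₂⋖v₃ : v₂ ⋖ v₃
  v₂⋖v₃ = trans e₃ (cong suc (sym e₂))

  -- `z` holds the letters played by the left particle in the meantime. As long as they commute with
  -- `q` and `r`, the last two letters of `μ` still form a tail, and the light bond stays blocked.
  out-blocked : ∀ {u μ q r} z → Out 3 μ q → r ⋖ q → 3 ≤ toℕ r → Letters (Com r) z → Letters (Com q) z →
    u ~ ((ε ▸ v₁) ⧺ μ) ⧺ z → Blocked u q r
  out-blocked z (base eq) r⋖q 3≤r _ _ e = ⊥-elim (ℕₚ.<-irrefl refl (ℕₚ.≤-trans (s≤s 3≤r) (ℕₚ.≤-reflexive (trans (sym r⋖q) eq))))
  out-blocked {q = q} z (up o q′⋖q) r⋖q 3≤r cr cq e with refl ← ⋗-unique q′⋖q r⋖q | ν , refl ← Out-last o =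
    Blocked-3 (three′ r⋖q (λ eq → ℕₚ.<⇒≱ 3≤r (ℕₚ.≤-trans (ℕₚ.≤-reflexive eq) (s≤s z≤n))))
      (~-trans e (~-trans (~-sym (~-past cq)) (~-▸ q (~-sym (~-past cr)))))

  near : ∀ {s : Fin n} {i j} → toℕ s ≡ i → i ≤ j → toℕ s ≤ j
  near refl le = le

  Near : Fin n → Set
  Near t = toℕ t ≤ 2

  clear : ∀ {t z} → 4 ≤ toℕ t → Letters Near z → Letters (Com t) z
  clear le = Letters-map λ lo → far′ (ℕₚ.≤-trans (s≤s (s≤s lo)) le)

  near₁ : Near v₁
  near₁ = near e₁ (s≤s z≤n)

  near₂ : Near v₂
  near₂ = near e₂ ℕₚ.≤-refl

  1≢3 : v₁ ≢ v₃
  1≢3 eq with () ← trans (sym e₁) (trans (cong toℕ eq) e₃)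

  high-1 : ∀ {μ} → Letters (λ t → 3 ≤ toℕ t) μ → Letters (Com v₁) μ
  high-1 = Letters-map (commute e₁)

  Phase-step : ∀ {u l r} → Phase u → Step u l r → Phase (u ▸ r)
  Phase-step (lone only) st = lone (Only-step only st)
  Phase-step (right rt) st
    with Right-step (λ s⋖t lo _ → three s⋖t (λ eq → ℕₚ.<-irrefl (sym eq) lo)) rt st
  ... | inj₁ only = lone only
  ... | inj₂ rt′ = right rt′
  Phase-step (left pr ep eq bl) st with pr (Step-D st) | neighbour (Step-3≤ st)
  ... | inj₁ refl | inj₁ p⋖r = meets′ pr st (trans eq (cong suc (sym (trans p⋖r (cong suc ep)))))
  ... | inj₁ refl | inj₂ r⋖p with () ← trans (sym ep) r⋖p
  Phase-step (left pr ep eq bl) st | inj₂ refl | inj₁ q⋖r = ⊥-elim (Step-¬Blocked st (bl q⋖r))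
  Phase-step (left pr ep eq bl) st | inj₂ refl | inj₂ r⋖q = meets pr st (trans (pred-≡ r⋖q (sym eq)) (cong suc (sym ep)))
  Phase-step (corner pr ep 3≤q bl) st with pr (Step-D st) | neighbour (Step-3≤ st)
  ... | inj₁ refl | inj₁ p⋖r with refl ← is (trans p⋖r (cong suc ep)) e₁ = ⊥-elim (Step-¬Blocked st bl)
  ... | inj₁ refl | inj₂ r⋖p with () ← trans (sym ep) r⋖p
  Phase-step (corner pr ep 3≤q bl) st | inj₂ refl | inj₁ q⋖r =
    corner (swapped pr st) ep (suc-≤ q⋖r 3≤q) (Blocked-▸ (commute′ ep (suc-≤ q⋖r (ℕₚ.≤-trans (s≤s (s≤s z≤n)) 3≤q))) (commute′ e₁ (suc-≤ q⋖r 3≤q)) bl)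
  Phase-step (corner pr ep 3≤q bl) st | inj₂ refl | inj₂ r⋖q with ℕₚ.m≤n⇒m<n∨m≡n 3≤q
  ...   | inj₁ 4≤q = corner (swapped pr st) ep (pred-≤ r⋖q 4≤q)
            (Blocked-▸ (commute′ ep (ℕₚ.≤-trans (s≤s (s≤s z≤n)) (pred-≤ r⋖q 4≤q))) (commute′ e₁ (pred-≤ r⋖q 4≤q)) bl)
  ...   | inj₂ eq = left (swapped pr st) ep r≡2 blocked
    where
    r≡2 = pred-≡ r⋖q eq
    blocked : ∀ {s} → _ ⋖ s → Blocked _ _ s
    blocked r⋖s with refl ← ⋖-unique r⋖s r⋖q = Blocked-new (three′ r⋖q (λ e → ℕₚ.1+n≢n (trans (sym r≡2) e))) st
  Phase-step (outward {μ} pr o e) st with pr (Step-D st) | neighbour (Step-3≤ st)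
  ... | inj₁ refl | inj₂ r⋖v₁ = to-corner pr (Out-high⁺ o) st r⋖v₁
  ... | inj₁ refl | inj₁ v₁⋖r with refl ← ⋖-unique v₁⋖r v₁⋖v₂ | ℕₚ.m≤n⇒m<n∨m≡n (Out-high⁺ o)
  ...   | inj₁ 4≤q = at-2 (Pair-move pr st) o 4≤q (~-▸ v₂ e)
  ...   | inj₂ eq = meets′ pr st (trans (sym eq) (cong suc (sym e₂)))
  Phase-step {r = r} (outward pr o e) st | inj₂ refl | inj₁ q⋖r = outward (swapped pr st) (up o q⋖r) (~-▸ r e)
  Phase-step {r = r} (outward pr o e) st | inj₂ refl | inj₂ r⋖q with ℕₚ.m≤n⇒m<n∨m≡n (Out-high⁺ o)
  ...   | inj₁ 4≤q = ⊥-elim (Step-¬Blocked st (out-blocked ε o r⋖q (pred-≤ r⋖q 4≤q) ε ε e))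
  ...   | inj₂ eq = meets pr st (trans (pred-≡ r⋖q eq) (cong suc (sym e₁)))
  Phase-step {r = r} (at-2 {μ} pr o 4≤q e) st with pr (Step-D st) | neighbour (Step-3≤ st)
  ... | inj₁ refl | inj₂ r⋖v₂ with refl ← ⋗-unique r⋖v₂ v₁⋖v₂ = back-1 (Pair-move pr st) o 4≤q (~-▸ v₁ e)
  ... | inj₁ refl | inj₁ v₂⋖r with refl ← ⋖-unique v₂⋖r v₂⋖v₃ | ℕₚ.m≤n⇒m<n∨m≡n 4≤q
  ...   | inj₂ eq = meets′ pr st (trans (sym eq) (cong suc (sym e₃)))
  ...   | inj₁ 5≤q = right (v₃ , _ , Pair-move pr st , ℕₚ.≤-reflexive (sym e₃) , subst (λ i → 2 + i ≤ _) (sym e₃) 5≤q , blocked)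
    where
    blocked : ∀ {s} → s ⋖ v₃ → Blocked _ v₃ s
    blocked s⋖v₃ with refl ← ⋗-unique s⋖v₃ v₂⋖v₃ = Blocked-new (three v₂⋖v₃ (λ eq → ℕₚ.1+n≢n (trans (sym e₂) eq))) st
  Phase-step {r = r} (at-2 pr o 4≤q e) st | inj₂ refl | inj₁ q⋖r =
    at-2 (swapped pr st) (up o q⋖r) (suc-≤ q⋖r 4≤q) (~-trans (~-▸ r e) (~-past (clear (suc-≤ q⋖r 4≤q) (ε ▸ near₂))))
  Phase-step {r = r} (at-2 pr o 4≤q e) st | inj₂ refl | inj₂ r⋖q with ℕₚ.m≤n⇒m<n∨m≡n 4≤q
  ...   | inj₂ eq = meets pr st (trans (pred-≡ r⋖q eq) (cong suc (sym e₂)))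
  ...   | inj₁ 5≤q = ⊥-elim (Step-¬Blocked st (out-blocked (ε ▸ v₂) o r⋖q (ℕₚ.≤-trans (ℕₚ.n≤1+n 3) (pred-≤ r⋖q 5≤q))
            (clear (pred-≤ r⋖q 5≤q) (ε ▸ near₂)) (clear 4≤q (ε ▸ near₂)) e))
  Phase-step {r = r} (back-1 {μ} pr o 4≤q e) st with pr (Step-D st) | neighbour (Step-3≤ st)
  ... | inj₁ refl | inj₂ r⋖v₁ = to-corner pr (Out-high⁺ o) st r⋖v₁
  -- The bounce has exhausted the heavy bond: `v₁`, `v₂`, `v₁` is a tail of length 4 - 1.
  ... | inj₁ refl | inj₁ v₁⋖r with refl ← ⋖-unique v₁⋖r v₁⋖v₂ = ⊥-elim (Step-¬Blocked st (μ , 3 , sym four ,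
          ~-trans e (~-▸ v₁ (~-▸ v₂ (~-trans (~-sym (~-past (high-1 (Out-high o)))) (~-▸ v₁ (~-reflexive (ε-⧺ μ))))))))
  Phase-step {r = r} (back-1 pr o 4≤q e) st | inj₂ refl | inj₁ q⋖r =
    back-1 (swapped pr st) (up o q⋖r) (suc-≤ q⋖r 4≤q) (~-trans (~-▸ r e) (~-past (clear (suc-≤ q⋖r 4≤q) (ε ▸ near₂ ▸ near₁))))
  Phase-step {r = r} (back-1 pr o 4≤q e) st | inj₂ refl | inj₂ r⋖q with ℕₚ.m≤n⇒m<n∨m≡n 4≤q
  ...   | inj₁ 5≤q = ⊥-elim (Step-¬Blocked st (out-blocked (ε ▸ v₂ ▸ v₁) o r⋖q (ℕₚ.≤-trans (ℕₚ.n≤1+n 3) (pred-≤ r⋖q 5≤q))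
            (clear (pred-≤ r⋖q 5≤q) (ε ▸ near₂ ▸ near₁)) (clear 4≤q (ε ▸ near₂ ▸ near₁)) e))
  -- With `q` at 4 the block is gone: `v₂` has been played since and does not commute with `v₃`, so
  -- the earlier `v₃` cannot be brought next to the last `v₄`.
  ...   | inj₂ eq = returned o
    where
    r≡3 = pred-≡ r⋖q eq
    returned : Out 3 _ _ → Phase _
    returned (base eq′) = ⊥-elim (ℕₚ.1+n≢n (trans eq eq′))
    returned (up o′ q′⋖q) with refl ← is r≡3 e₃ with refl ← ⋗-unique q′⋖q r⋖q with refl ← Out-base o′ e₃ =
      back (swapped pr st) r⋖q (~-▸ r e)
  Phase-step (back {v₄} pr v₃⋖v₄ e) st with pr (Step-D st) | neighbour (Step-3≤ st)
  ... | inj₁ refl | inj₂ r⋖v₁ = to-corner pr (ℕₚ.≤-reflexive (sym e₃)) st r⋖v₁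
  ... | inj₁ refl | inj₁ v₁⋖r with refl ← ⋖-unique v₁⋖r v₁⋖v₂ = meets′ pr st v₂⋖v₃
  Phase-step (back {v₄} pr v₃⋖v₄ e) st | inj₂ refl | inj₂ r⋖v₃ with refl ← ⋗-unique r⋖v₃ v₂⋖v₃ = meets pr st v₁⋖v₂
  Phase-step (back {v₄} pr v₃⋖v₄ e) st | inj₂ refl | inj₁ v₃⋖r with refl ← ⋖-unique v₃⋖r v₃⋖v₄ = ⊥-elim (Step-¬Blocked st (Blocked-3
          (three v₃⋖r (λ eq → 1≢3 (is e₁ eq)))
          (~-trans e (~-▸ v₃ (~-sym (~-past {u = ε ▸ v₁ ▸ v₃} (clear (ℕₚ.≤-reflexive (sym (trans v₃⋖r (cong suc e₃)))) (ε ▸ near₂ ▸ near₁))))))))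

  Reach-phase : ∀ {u} → Reach x u → Phase u
  Reach-phase start = outward Pair-start (base e₃) ~-refl
  Reach-phase (ρ then st) = Phase-step (Reach-phase ρ) st

  classification : ∀ {u} → Reach x u → D u v₁ → D u v₃ →
    u ~ x ⊎ Σ (Fin n) λ v₄ → v₃ ⋖ v₄ × u ~ ε ▸ v₁ ▸ v₃ ▸ v₄ ▸ v₂ ▸ v₁ ▸ v₃
  classification ρ d₁ d₃ with Reach-phase ρ
  ... | lone only = ⊥-elim (Only-≢ only 1≢3 d₁ d₃)
  ... | right (p , q , pr , lo , gap , _) with pr d₁
  ...   | inj₁ refl = ⊥-elim (ℕₚ.<⇒≱ lo near₁)
  ...   | inj₂ refl = ⊥-elim (ℕₚ.<⇒≱ (ℕₚ.≤-trans lo (ℕₚ.≤-trans (ℕₚ.m≤n+m _ 2) gap)) near₁)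
  classification ρ d₁ d₃ | left pr ep eq _ with pr d₁
  ... | inj₁ refl = ⊥-elim (ℕₚ.0≢1+n (trans (sym ep) e₁))
  ... | inj₂ refl = ⊥-elim (ℕₚ.1+n≢n (trans (sym eq) e₁))
  classification ρ d₁ d₃ | corner pr ep 3≤q _ with pr d₁
  ... | inj₁ refl = ⊥-elim (ℕₚ.0≢1+n (trans (sym ep) e₁))
  ... | inj₂ refl = ⊥-elim (ℕₚ.<⇒≱ 3≤q near₁)
  classification ρ d₁ d₃ | outward pr o e with pr d₃
  ... | inj₁ eq = ⊥-elim (1≢3 (sym eq))
  ... | inj₂ refl with refl ← Out-base o e₃ = inj₁ e
  classification ρ d₁ d₃ | at-2 pr _ 4≤q _ with pr d₃
  ... | inj₁ refl = ⊥-elim (ℕₚ.1+n≢n (trans (sym e₃) e₂))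
  ... | inj₂ refl = ⊥-elim (ℕₚ.<-irrefl (sym e₃) 4≤q)
  classification ρ d₁ d₃ | back-1 pr _ 4≤q _ with pr d₃
  ... | inj₁ eq = ⊥-elim (1≢3 (sym eq))
  ... | inj₂ refl = ⊥-elim (ℕₚ.<-irrefl (sym e₃) 4≤q)
  classification ρ d₁ d₃ | back v₃⋖v₄ pr e = inj₂ (_ , pr , e)

  module Return (v₄ : Fin n) (v₃⋖v₄ : v₃ ⋖ v₄) where

    e₄ : toℕ v₄ ≡ 4
    e₄ = trans v₃⋖v₄ (cong suc e₃)

    c₁₃ : Com v₁ v₃
    c₁₃ = commute e₁ (ℕₚ.≤-reflexive (sym e₃))

    c₁₄ : Com v₁ v₄
    c₁₄ = commute e₁ (ℕₚ.≤-trans (ℕₚ.n≤1+n 3) (ℕₚ.≤-reflexive (sym e₄)))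

    c₂₄ : Com v₂ v₄
    c₂₄ = commute e₂ (ℕₚ.≤-reflexive (sym e₄))

    y : W
    y = ε ▸ v₁ ▸ v₃ ▸ v₄ ▸ v₂ ▸ v₁ ▸ v₃

    ¬D-≥ : ∀ {u s} → Letters (λ t → toℕ t < toℕ s) u → ¬ D u s
    ¬D-≥ ls d = ℕₚ.<-irrefl refl (Letters-D ls d)

    <₄ : ∀ {s : Fin n} {i} → toℕ s ≡ i → i < 4 → toℕ s < toℕ v₄
    <₄ refl lt = subst (_ <_) (sym e₄) lt

    ¬D-34 : ∀ {s} → toℕ s ≤ 2 → ¬ D (ε ▸ v₃ ▸ v₄) s
    ¬D-34 {s} le d = ℕₚ.<⇒≱ (Letters-D {P = λ t → 3 ≤ toℕ t}
      (ε ▸ ℕₚ.≤-reflexive (sym e₃) ▸ ℕₚ.≤-trans (ℕₚ.n≤1+n 3) (ℕₚ.≤-reflexive (sym e₄))) d) le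

    past-1 : ε ▸ v₁ ▸ v₃ ▸ v₄ ~ ε ▸ v₃ ▸ v₄ ▸ v₁
    past-1 = ~-trans (~-▸ v₄ (~-swap c₁₃)) (~-swap c₁₄)

    Reach-y : Reach x y
    Reach-y = (((start then s₁) then s₂) then s₃) then s₄
      where
      s₁ : Step x v₃ v₄
      s₁ = step (ε ▸ v₁) 1 (s≤s z≤n) (adjacent v₃⋖v₄) ~-refl
        (¬D-≥ (ε ▸ subst₂ _<_ (sym e₁) (sym e₃) (s≤s (s≤s z≤n)))) (¬D-≥ (ε ▸ <₄ e₁ (s≤s (s≤s z≤n))))
      s₂ : Step (x ▸ v₄) v₁ v₂
      s₂ = step (ε ▸ v₃ ▸ v₄) 1 (s≤s z≤n) (adjacent v₁⋖v₂) past-1 (¬D-34 near₁) (¬D-34 near₂)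
      s₃ : Step (x ▸ v₄ ▸ v₂) v₂ v₁
      s₃ = step (ε ▸ v₃ ▸ v₄) 2 (s≤s z≤n) (ℕₚ.≤-reflexive (sym (trans (M-sym v₂ v₁) four))) (~-▸ v₂ past-1) (¬D-34 near₂) (¬D-34 near₁)
      ¬D-3 : ¬ D (ε ▸ v₁ ▸ v₃ ▸ v₂ ▸ v₁) v₃
      ¬D-3 d with D-▸⁻ d
      ... | inj₁ eq = 1≢3 (sym eq)
      ... | inj₂ (_ , d′) with D-▸⁻ d′
      ...   | inj₁ eq = 3≤-≢ (adjacent v₂⋖v₃) (sym eq)
      ...   | inj₂ (c , _) = 3≤-¬Com (adjacent v₂⋖v₃) c
      -- `v₄` is pulled to the end past `v₂` and `v₁`. In what remains `v₂` covers `v₃`, so the tail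
      -- over this light bond has length 1 and the step back is allowed.
      s₄ : Step (x ▸ v₄ ▸ v₂ ▸ v₁) v₄ v₃
      s₄ = step (ε ▸ v₁ ▸ v₃ ▸ v₂ ▸ v₁) 1 (s≤s z≤n) (adjacent′ v₃⋖v₄)
        (~-sym (~-past {u = x} (ε ▸ Com-sym c₂₄ ▸ Com-sym c₁₄)))
        (¬D-≥ (ε ▸ <₄ e₁ (s≤s (s≤s z≤n)) ▸ <₄ e₃ ℕₚ.≤-refl ▸ <₄ e₂ (s≤s (s≤s (s≤s z≤n))) ▸ <₄ e₁ (s≤s (s≤s z≤n))))
        ¬D-3

    y-~ : y ~ ε ▸ v₁ ▸ v₃ ▸ v₂ ▸ v₄ ▸ v₁ ▸ v₃
    y-~ = ~-▸ v₃ (~-▸ v₁ (~-swap (Com-sym c₂₄)))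

    reversed : ε ▸ v₃ ▸ v₁ ▸ v₄ ▸ v₂ ▸ v₃ ▸ v₁ ~ ε ▸ v₁ ▸ v₃ ▸ v₂ ▸ v₄ ▸ v₁ ▸ v₃
    reversed = ~-trans (~-swap (Com-sym c₁₃)) (~-▸ v₃ (~-▸ v₁ (~-trans (~-swap (Com-sym c₂₄)) (~-▸ v₄ (~-▸ v₂ (~-swap (Com-sym c₁₃)))))))

    IEquals-long : IEquals ⟦ x ⟧ ⟦ x ⟧ (⟦ x ⟧ ∷ ⟦ ε ▸ v₁ ▸ v₃ ▸ v₂ ▸ v₄ ▸ v₁ ▸ v₃ ⟧ ∷ [])
    IEquals-long = IEquals-intro c₁₃ only
      ((pair-involution c₁₃ , _ , start , ≈-refl) ∷
       (words (~⇒≋ reversed) , _ , Reach-y , words (~⇒≋ y-~)) ∷ [])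
      where
      only : ∀ {u} → Reach x u → D u v₁ → D u v₃ → Any (⟦ u ⟧ ≈_) _
      only ρ d₁ d₃ with classification ρ d₁ d₃
      ... | inj₁ e = here (words (~⇒≋ e))
      ... | inj₂ (_ , v₃⋖v , e) with refl ← ⋖-unique v₃⋖v v₃⋖v₄ = there (here (words (~⇒≋ (~-trans e y-~))))

  IEquals-short : n ≡ 4 → IEquals ⟦ x ⟧ ⟦ x ⟧ (⟦ x ⟧ ∷ [])
  IEquals-short n≡4 = IEquals-trivial (commute e₁ (ℕₚ.≤-reflexive (sym e₃))) only
    where
    only : ∀ {u} → Reach x u → D u v₁ → D u v₃ → ⟦ u ⟧ ≈ ⟦ x ⟧
    only ρ d₁ d₃ with classification ρ d₁ d₃
    ... | inj₁ e = words (~⇒≋ e)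
    ... | inj₂ (v₄ , v₃⋖v₄ , _) = ⊥-elim (ℕₚ.<-irrefl (trans v₃⋖v₄ (cong suc e₃)) (subst (toℕ v₄ <_) n≡4 (Finₚ.toℕ<n v₄)))

module FFamily (k : ℕ) where

  private
    e : ℕ → ℕ
    e j = if j ℕ.≡ᵇ 2 then 4 else 3

    e-bond : ∀ j → Bond (e j)
    e-bond j with j ℕ.≡ᵇ 2
    ... | true = b4 refl
    ... | false = b3 refl

    e-≥ : ∀ j → 3 ≤ e j
    e-≥ j with j ℕ.≡ᵇ 2
    ... | true = ℕₚ.n≤1+n 3
    ... | false = ℕₚ.≤-refl

  open PathMatrix (4 + k) e e-bond

  private
    v : ℕ → Fin (4 + k)
    v = lbl

    three : ∀ {s t} → toℕ t ≡ suc (toℕ s) → toℕ s ≢ 1 → M s t ≡ 3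
    three {s} {t} eq ne = trans (M-weight {s} {t} eq) (trans (cong e eq) (weight-3 ne))
      where
      weight-3 : ∀ {j} → j ≢ 1 → e (suc j) ≡ 3
      weight-3 ne rewrite ≡ᵇ-≢ ne = refl

    e₂ : toℕ (v 3) ≡ 2
    e₂ = toℕ-idx {3 + k} (s≤s (s≤s z≤n))

    v₁⋖v₂ : toℕ (v 3) ≡ suc (toℕ (v 2))
    v₁⋖v₂ = trans e₂ (cong suc (sym (toℕ-idx {3 + k} {1} (s≤s z≤n))))

  open FPath M M-sym M-diag M-bond (λ {s} {t} → M-far {s} {t}) (λ {s} {t} → M-adjacent e-≥ {s} {t}) (λ {s} {t} → three {s} {t})
    (v 2) (v 3) (v 4) (toℕ-idx {3 + k} (s≤s z≤n)) e₂ (toℕ-idx {3 + k} (s≤s (s≤s (s≤s z≤n))))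
    (trans (M-weight {v 2} {v 3} v₁⋖v₂) (cong e e₂)) public hiding (v₁⋖v₂)

typeF₄-cell : Coxeter.IEquals (typeF 4) (ws (2 ∷ 4 ∷ [])) (ws (2 ∷ 4 ∷ [])) (ws (2 ∷ 4 ∷ []) ∷ [])
typeF₄-cell = FFamily.IEquals-short 0 refl

typeF-cell : ∀ k → Coxeter.IEquals (typeF (5 + k)) (ws (2 ∷ 4 ∷ [])) (ws (2 ∷ 4 ∷ []))
  (ws (2 ∷ 4 ∷ []) ∷ ws (2 ∷ 4 ∷ 3 ∷ 5 ∷ 2 ∷ 4 ∷ []) ∷ [])
typeF-cell k = FFamily.Return.IEquals-long (suc k) (lbl 5)
  (trans (toℕ-idx {4 + k} (s≤s (s≤s (s≤s (s≤s z≤n))))) (cong suc (sym (toℕ-idx {4 + k} (s≤s (s≤s (s≤s z≤n)))))))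

-- Two particles on a tripod

-- Vertices of a tripod with one short arm: left i and right i are at distance 1 + i from
-- the centre.
data Vertex : Set where
  left right : ℕ → Vertex
  centre top : Vertex

mirror : Vertex → Vertex
mirror (left i) = right i
mirror (right i) = left i
mirror centre = centre
mirror top = top

mirror-involutive : ∀ v → mirror (mirror v) ≡ v
mirror-involutive (left i) = refl
mirror-involutive (right i) = refl
mirror-involutive centre = refl
mirror-involutive top = refl

data Adj : Vertex → Vertex → Set where
  ll⁺ : ∀ {i} → Adj (left i) (left (suc i))
  ll⁻ : ∀ {i} → Adj (left (suc i)) (left i)
  rr⁺ : ∀ {i} → Adj (right i) (right (suc i))
  rr⁻ : ∀ {i} → Adj (right (suc i)) (right i)
  lc  : Adj (left 0) centre
  cl  : Adj centre (left 0)
  rc  : Adj (right 0) centre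
  cr  : Adj centre (right 0)
  tc  : Adj top centre
  ct  : Adj centre top

data Far : Vertex → Vertex → Set where
  ll⁺ : ∀ {i j} → 2 + i ≤ j → Far (left i) (left j)
  ll⁻ : ∀ {i j} → 2 + j ≤ i → Far (left i) (left j)
  rr⁺ : ∀ {i j} → 2 + i ≤ j → Far (right i) (right j)
  rr⁻ : ∀ {i j} → 2 + j ≤ i → Far (right i) (right j)
  lr  : ∀ {i j} → Far (left i) (right j)
  rl  : ∀ {i j} → Far (right i) (left j)
  lc  : ∀ {i} → Far (left (suc i)) centre
  cl  : ∀ {i} → Far centre (left (suc i))
  rc  : ∀ {i} → Far (right (suc i)) centre
  cr  : ∀ {i} → Far centre (right (suc i))
  l-t : ∀ {i} → Far (left i) top
  t-l : ∀ {i} → Far top (left i)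
  r-t : ∀ {i} → Far (right i) top
  t-r : ∀ {i} → Far top (right i)

mirror-Adj : ∀ {v w} → Adj v w → Adj (mirror v) (mirror w)
mirror-Adj ll⁺ = rr⁺
mirror-Adj ll⁻ = rr⁻
mirror-Adj rr⁺ = ll⁺
mirror-Adj rr⁻ = ll⁻
mirror-Adj lc = rc
mirror-Adj cl = cr
mirror-Adj rc = lc
mirror-Adj cr = cl
mirror-Adj tc = tc
mirror-Adj ct = ct

mirror-Far : ∀ {v w} → Far v w → Far (mirror v) (mirror w)
mirror-Far (ll⁺ le) = rr⁺ le
mirror-Far (ll⁻ le) = rr⁻ le
mirror-Far (rr⁺ le) = ll⁺ le
mirror-Far (rr⁻ le) = ll⁻ le
mirror-Far lr = rl
mirror-Far rl = lr
mirror-Far lc = rc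
mirror-Far cl = cr
mirror-Far rc = lc
mirror-Far cr = cl
mirror-Far l-t = r-t
mirror-Far t-l = t-r
mirror-Far r-t = l-t
mirror-Far t-r = t-l

inward : ℕ → Vertex
inward zero = centre
inward (suc i) = right i

-- Covers only what happens on the right arm and after a crossing from left to right. The opposite
-- side is the same module with `mirror` applied to all positions.
module HalfTripod {n : ℕ} (M : CoxeterMatrix n)
  (M-sym : ∀ s t → M s t ≡ M t s) (M-diag : ∀ s → M s s ≡ 1) (bond : ∀ {s t} → s ≢ t → Bond (M s t))
  (pos : Fin n → Vertex) (pos-injective : ∀ {s t} → pos s ≡ pos t → s ≡ t)
  (link : ∀ {s t} → 3 ≤ M s t → Adj (pos s) (pos t))
  (three : ∀ {s t} → Adj (pos s) (pos t) → M s t ≡ 3)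
  (far-commute : ∀ {s t} → Far (pos s) (pos t) → M s t ≡ 2)
  where

  open StarOperations M M-sym M-diag bond

  At : Fin n → Vertex → Set
  At p v = pos p ≡ v

  data Next (v : Vertex) (r : Fin n) : Set where
    next : ∀ {w} → At r w → Adj v w → Next v r

  neighbour : ∀ {u p r v} → Step u p r → At p v → Next v r
  neighbour st refl = next refl (link (Step-3≤ st))

  same-place : ∀ {s t v} → At s v → At t v → s ≡ t
  same-place p q = pos-injective (trans p (sym q))

  com : ∀ {s t v w} → At s v → At t w → Far v w → Com s t
  com refl refl f = far-commute f

  edge : ∀ {s t v w} → At s v → At t w → Adj v w → M s t ≡ 3
  edge refl refl a = three a

  meet : ∀ {u p q r v w} → Pair u p q → Step u p r → At r v → At q w → Adj v w → Only (u ▸ r)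
  meet pr st ar aq a = Pair-collide pr st (ℕₚ.≤-reflexive (sym (edge ar aq a)))

  swapped : ∀ {u p q r} → Pair u p q → Step u q r → Pair (u ▸ r) p r
  swapped pr st = Pair-swap (Pair-move (Pair-swap pr) st)

  -- Quantified over the generators at `v`: the arms of `Vertex` are infinite, and past the end of
  -- the actual arm the condition holds vacuously. So the ends of the arms need no cases of their
  -- own.
  No : W → Fin n → Vertex → Set
  No u p v = ∀ {s} → At s v → Blocked u p s

  No-back : ∀ {u p r v w} → Step u p r → At p v → At r w → Adj v w → No (u ▸ r) r v
  No-back st ap ar a as with refl ← same-place as ap = Blocked-new (edge ap ar a) st

  No-▸ : ∀ {u p r v w x} → At p v → At r w → Far w v → Far w x → No u p x → No (u ▸ r) p x
  No-▸ ap ar f g bl as = Blocked-▸ (com ar ap f) (com ar as g) (bl as)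

  stop : ∀ {u p r v} {A : Set} → Step u p r → At r v → No u p v → A
  stop st ar bl = ⊥-elim (Step-¬Blocked st (bl ar))

  -- The analogue of `Right` on a path: both particles on one arm, the inner one cut off from the
  -- centre.
  Outer : W → Set
  Outer u = Σ (Fin n) λ p → Σ (Fin n) λ q → Σ ℕ λ i → Σ ℕ λ j →
    Pair u p q × At p (right i) × At q (right j) × 2 + i ≤ j × No u p (inward i)

  far-inward : ∀ {i j} → 2 + i ≤ j → Far (right j) (inward i)
  far-inward {zero} (s≤s le) = rc
  far-inward {suc i} le = rr⁻ (ℕₚ.≤-trans (ℕₚ.n≤1+n _) le)

  Outer-step : ∀ {u l r} → Outer u → Step u l r → Only (u ▸ r) ⊎ Outer (u ▸ r)
  Outer-step {u} {l} {r} (p , q , i , j , pr , ap , aq , le , bl) st with pr (Step-D st)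
  ... | inj₁ refl = p-step i ap le bl (neighbour st ap)
    where
    p-step : ∀ i → At p (right i) → 2 + i ≤ j → No u p (inward i) → Next (right i) r → Only (u ▸ r) ⊎ Outer (u ▸ r)
    p-step zero _ _ bl (next ar rc) = stop st ar bl
    p-step (suc i) _ _ bl (next ar rr⁻) = stop st ar bl
    p-step i ap le _ (next ar rr⁺) with ℕₚ.m≤n⇒m<n∨m≡n le
    ... | inj₁ lt = inj₂ (r , q , suc i , j , Pair-move pr st , ar , aq , lt , No-back st ap ar rr⁺)
    ... | inj₂ refl = inj₁ (meet pr st ar aq rr⁺)
  ... | inj₂ refl = q-step j aq le (neighbour st aq)
    where
    q-step : ∀ j → At q (right j) → 2 + i ≤ j → Next (right j) r → Only (u ▸ r) ⊎ Outer (u ▸ r)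
    q-step j aq le (next ar rr⁺) =
      inj₂ (p , r , i , suc j , swapped pr st , ap , ar , le′ , No-▸ ap ar (rr⁻ le′) (far-inward le′) bl)
      where le′ = ℕₚ.≤-trans le (ℕₚ.n≤1+n _)
    q-step (suc j) aq le (next ar rr⁻) with ℕₚ.m≤n⇒m<n∨m≡n le
    ... | inj₁ (s≤s lt) = inj₂ (p , r , i , j , swapped pr st , ap , ar , lt , No-▸ ap ar (rr⁻ lt) (far-inward lt) bl)
    ... | inj₂ refl = inj₁ (meet (Pair-swap pr) st ar ap rr⁻)

  -- A particle from the left has reached the centre while the other was on the right.
  data Crossed (u : W) : Set where
    lone   : Only u → Crossed u
    outer  : Outer u → Crossed u
    middle : ∀ {p q i} → Pair u p q → At p centre → At q (right (suc i)) → No u p (left 0) → Crossed u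
    up     : ∀ {p q i} → Pair u p q → At p top → At q (right (suc i)) → No u p centre → Crossed u
    stuck  : ∀ {p q} → Pair u p q → At p top → At q (right 0) → No u q (right 1) → Crossed u

  Outer⇒Crossed : ∀ {u} → Only u ⊎ Outer u → Crossed u
  Outer⇒Crossed (inj₁ o) = lone o
  Outer⇒Crossed (inj₂ o) = outer o

  leave-centre : ∀ i {u p q r} → Pair u p q → Step u p r → At p centre → At r (right 0) → At q (right (suc i)) → Crossed (u ▸ r)
  leave-centre zero pr st ap ar aq = lone (meet pr st ar aq rr⁺)
  leave-centre (suc i) pr st ap ar aq = outer (_ , _ , 0 , suc (suc i) , Pair-move pr st , ar , aq , s≤s (s≤s z≤n) , No-back st ap ar cr)

  approach-centre : ∀ i {u p q r} → Pair u p q → Step u q r → At p centre → At r (right i) → No u p (left 0) → Crossed (u ▸ r)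
  approach-centre zero pr st ap ar bl = lone (meet (Pair-swap pr) st ar ap rc)
  approach-centre (suc i) pr st ap ar bl = middle (swapped pr st) ap ar (No-▸ ap ar rc rl bl)

  approach-top : ∀ i {u p q} → Pair u p q → At p top → At q (right i) → (0 < i → No u p centre) → No u q (right (suc i)) → Crossed u
  approach-top zero pr ap aq bl bl′ = stuck pr ap aq bl′
  approach-top (suc i) pr ap aq bl bl′ = up pr ap aq (bl (s≤s z≤n))

  right-centre : ∀ {i} → 0 < i → Far (right i) centre
  right-centre (s≤s _) = rc

  Crossed-step : ∀ {u l r} → Crossed u → Step u l r → Crossed (u ▸ r)
  Crossed-step (lone o) st = lone (Only-step o st)
  Crossed-step (outer o) st = Outer⇒Crossed (Outer-step o st)
  Crossed-step (middle pr ap aq bl) st with pr (Step-D st)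
  Crossed-step (middle pr ap aq bl) st | inj₁ refl with neighbour st ap
  ... | next ar cl = stop st ar bl
  ... | next ar ct = up (Pair-move pr st) ar aq (No-back st ap ar ct)
  ... | next ar cr = leave-centre _ pr st ap ar aq
  Crossed-step (middle pr ap aq bl) st | inj₂ refl with neighbour st aq
  ... | next ar rr⁺ = middle (swapped pr st) ap ar (No-▸ ap ar rc rl bl)
  ... | next ar rr⁻ = approach-centre _ pr st ap ar bl
  Crossed-step (up pr ap aq bl) st with pr (Step-D st)
  Crossed-step (up pr ap aq bl) st | inj₁ refl with neighbour st ap
  ... | next ar tc = stop st ar bl
  Crossed-step (up pr ap aq bl) st | inj₂ refl with neighbour st aq
  ... | next ar rr⁺ = up (swapped pr st) ap ar (No-▸ ap ar r-t rc bl)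
  ... | next ar rr⁻ = approach-top _ (swapped pr st) ap ar (λ lt → No-▸ ap ar r-t (right-centre lt) bl) (No-back st aq ar rr⁻)
  Crossed-step (stuck pr ap aq bl) st with pr (Step-D st)
  Crossed-step (stuck pr ap aq bl) st | inj₁ refl with neighbour st ap
  ... | next ar tc = lone (meet pr st ar aq cr)
  Crossed-step (stuck pr ap aq bl) st | inj₂ refl with neighbour st aq
  ... | next ar rr⁺ = stop st ar bl
  ... | next ar rc = lone (meet (Pair-swap pr) st ar ap ct)

  at-≢ : ∀ {s v w} {A : Set} → At s v → At s w → v ≢ w → A
  at-≢ p q ne = ⊥-elim (ne (trans (sym p) q))

  Outer-right : ∀ {u s} → Outer u → D u s → Σ ℕ λ i → At s (right i)
  Outer-right (p , q , i , j , pr , ap , aq , _) d with pr d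
  ... | inj₁ refl = i , ap
  ... | inj₂ refl = j , aq

  -- In `lone` two different descents are impossible, and in every other phase no particle is on the
  -- left arm.
  Crossed-final : ∀ {u s t} → Crossed u → At s (left 0) → s ≢ t → D u s → ¬ D u t
  Crossed-final (lone o) as ne ds dt = Only-≢ o ne ds dt
  Crossed-final (outer o) as ne ds dt with i , as′ ← Outer-right o ds = at-≢ as as′ λ ()
  Crossed-final (middle pr ap aq _) as ne ds dt with pr ds
  ... | inj₁ refl = at-≢ as ap λ ()
  ... | inj₂ refl = at-≢ as aq λ ()
  Crossed-final (up pr ap aq _) as ne ds dt with pr ds
  ... | inj₁ refl = at-≢ as ap λ ()
  ... | inj₂ refl = at-≢ as aq λ ()
  Crossed-final (stuck pr ap aq _) as ne ds dt with pr ds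
  ... | inj₁ refl = at-≢ as ap λ ()
  ... | inj₂ refl = at-≢ as aq λ ()

module Tripod {n : ℕ} (M : CoxeterMatrix n)
  (M-sym : ∀ s t → M s t ≡ M t s) (M-diag : ∀ s → M s s ≡ 1) (bond : ∀ {s t} → s ≢ t → Bond (M s t))
  (pos : Fin n → Vertex) (pos-injective : ∀ {s t} → pos s ≡ pos t → s ≡ t)
  (link : ∀ {s t} → 3 ≤ M s t → Adj (pos s) (pos t))
  (three : ∀ {s t} → Adj (pos s) (pos t) → M s t ≡ 3)
  (far-commute : ∀ {s t} → Far (pos s) (pos t) → M s t ≡ 2)
  where

  open StarOperations M M-sym M-diag bond
  open HalfTripod M M-sym M-diag bond pos pos-injective link three far-commute

  mirror-injective : ∀ {v w} → mirror v ≡ mirror w → v ≡ w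
  mirror-injective {v} {w} eq = trans (sym (mirror-involutive v)) (trans (cong mirror eq) (mirror-involutive w))

  module Mirror = HalfTripod M M-sym M-diag bond (λ s → mirror (pos s)) (λ eq → pos-injective (mirror-injective eq))
    (λ le → mirror-Adj (link le))
    (λ {s} {t} a → three (subst₂ Adj (mirror-involutive (pos s)) (mirror-involutive (pos t)) (mirror-Adj a)))
    (λ {s} {t} f → far-commute (subst₂ Far (mirror-involutive (pos s)) (mirror-involutive (pos t)) (mirror-Far f)))

  flip : ∀ {s v} → At s v → Mirror.At s (mirror v)
  flip = cong mirror

  -- Before a merger the particle that left the top never returns there: at the centre it is blocked
  -- from going up, on the right arm it is blocked inward, and once the other one is at `left 0`,
  -- reaching the centre merges them. Only the particle from the left arm can visit the top later,
  -- and then that arm is empty. While the top is still occupied, a left particle that has moved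
  -- outward is blocked from `left 0`.
  data TopLeft (u : W) : Set where
    out     : ∀ {p q i} → Pair u p q → At p (left (suc i)) → At q top → No u p (left i) → TopLeft u
    middle  : ∀ {p q i} → Pair u p q → At p (left (suc i)) → At q centre → No u q top → TopLeft u
    across  : ∀ {p q i j} → Pair u p q → At p (left (suc i)) → At q (right j) → No u q (inward j) → TopLeft u
    near    : ∀ {p q j} → Pair u p q → At p (left 0) → At q (right j) → No u p (left 1) → TopLeft u
    crossed : Crossed u → TopLeft u
    behind  : Mirror.Outer u → TopLeft u

  lone′ : ∀ {u} → Only u → TopLeft u
  lone′ o = crossed (lone o)

  far-inward-left : ∀ {i} j → Far (left (suc i)) (inward j)
  far-inward-left zero = lc
  far-inward-left (suc j) = lr

  retreat : ∀ i {u p q r} → Pair u p q → Step u p r → At p (left (suc i)) → At r (left i) → At q centre → No u q top → TopLeft (u ▸ r)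
  retreat zero pr st ap ar aq bl = lone′ (meet pr st ar aq lc)
  retreat (suc i) pr st ap ar aq bl = middle (Pair-move pr st) ar aq (No-▸ aq ar lc l-t bl)

  follow : ∀ i {u p q r} → Pair u p q → Step u q r → At p (left (suc i)) → At q centre → At r (left 0) → TopLeft (u ▸ r)
  follow zero pr st ap aq ar = lone′ (meet (Pair-swap pr) st ar ap ll⁺)
  follow (suc i) pr st ap aq ar = behind (_ , _ , 0 , suc (suc i) , Pair-move (Pair-swap pr) st , flip ar , flip ap , s≤s (s≤s z≤n) ,
    Mirror.No-back st (flip aq) (flip ar) cr)

  come-near : ∀ i {u p q r j} → Pair u p q → Step u p r → At p (left (suc i)) → At r (left i) → At q (right j) → No u q (inward j) → TopLeft (u ▸ r)
  come-near zero pr st ap ar aq bl = near (Pair-move pr st) ar aq (No-back st ap ar ll⁻)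
  come-near (suc i) {j = j} pr st ap ar aq bl = across (Pair-move pr st) ar aq (No-▸ aq ar lr (far-inward-left j) bl)

  go-right : ∀ j {u p q r i} → Pair u p q → Step u q r → At p (left (suc i)) → At q (right j) → No u q (inward j) → Next (right j) r → TopLeft (u ▸ r)
  go-right j pr st ap aq bl (next ar rr⁺) = across (swapped pr st) ap ar (No-back st aq ar rr⁺)
  go-right zero pr st ap aq bl (next ar rc) = stop st ar bl
  go-right (suc j) pr st ap aq bl (next ar rr⁻) = stop st ar bl

  cross : ∀ j {u p q r} → Pair u p q → Step u p r → At p (left 0) → At r centre → At q (right j) → TopLeft (u ▸ r)
  cross zero pr st ap ar aq = lone′ (meet pr st ar aq cr)
  cross (suc j) pr st ap ar aq = crossed (middle (Pair-move pr st) ar aq (No-back st ap ar lc))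

  TopLeft-step : ∀ {u l r} → TopLeft u → Step u l r → TopLeft (u ▸ r)
  TopLeft-step (crossed c) st = crossed (Crossed-step c st)
  TopLeft-step (behind o) st with Mirror.Outer-step o st
  ... | inj₁ only = lone′ only
  ... | inj₂ o′ = behind o′
  TopLeft-step (out pr ap aq bl) st with pr (Step-D st)
  TopLeft-step (out pr ap aq bl) st | inj₁ refl with neighbour st ap
  ... | next ar ll⁺ = out (Pair-move pr st) ar aq (No-back st ap ar ll⁺)
  ... | next ar ll⁻ = stop st ar bl
  TopLeft-step (out pr ap aq bl) st | inj₂ refl with neighbour st aq
  ... | next ar tc = middle (swapped pr st) ap ar (No-back st aq ar tc)
  TopLeft-step (middle pr ap aq bl) st with pr (Step-D st)
  TopLeft-step (middle pr ap aq bl) st | inj₁ refl with neighbour st ap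
  ... | next ar ll⁺ = middle (Pair-move pr st) ar aq (No-▸ aq ar lc l-t bl)
  ... | next ar ll⁻ = retreat _ pr st ap ar aq bl
  TopLeft-step (middle pr ap aq bl) st | inj₂ refl with neighbour st aq
  ... | next ar ct = stop st ar bl
  ... | next ar cl = follow _ pr st ap aq ar
  ... | next ar cr = across (swapped pr st) ap ar (No-back st aq ar cr)
  TopLeft-step (across pr ap aq bl) st with pr (Step-D st)
  TopLeft-step (across {j = j} pr ap aq bl) st | inj₁ refl with neighbour st ap
  ... | next ar ll⁺ = across (Pair-move pr st) ar aq (No-▸ aq ar lr (far-inward-left j) bl)
  ... | next ar ll⁻ = come-near _ pr st ap ar aq bl
  TopLeft-step (across pr ap aq bl) st | inj₂ refl = go-right _ pr st ap aq bl (neighbour st aq)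
  TopLeft-step (near pr ap aq bl) st with pr (Step-D st)
  TopLeft-step (near pr ap aq bl) st | inj₁ refl with neighbour st ap
  ... | next ar ll⁺ = stop st ar bl
  ... | next ar lc = cross _ pr st ap ar aq
  TopLeft-step (near pr ap aq bl) st | inj₂ refl with neighbour st aq
  ... | next ar rr⁺ = near (swapped pr st) ap ar (No-▸ ap ar rl rl bl)
  ... | next ar rr⁻ = near (swapped pr st) ap ar (No-▸ ap ar rl rl bl)
  ... | next ar rc = lone′ (meet (Pair-swap pr) st ar ap cl)

  TopLeft-start : ∀ {s t} → At s (left 0) → At t top → ∀ {l r} → Step (ε ▸ s ▸ t) l r → TopLeft (ε ▸ s ▸ t ▸ r)
  TopLeft-start {s} {t} as at st with Pair-start {s} {t} (Step-D st)
  TopLeft-start as at st | inj₁ refl with neighbour st as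
  ... | next ar ll⁺ = out (Pair-move Pair-start st) ar at (No-back st as ar ll⁺)
  ... | next ar lc = lone′ (meet Pair-start st ar at ct)
  TopLeft-start as at st | inj₂ refl with neighbour st at
  ... | next ar tc = lone′ (meet (Pair-swap Pair-start) st ar as cl)

  TopLeft-final : ∀ {u s t} → TopLeft u → At s (left 0) → At t top → D u s → ¬ D u t
  TopLeft-final (out pr ap aq _) as at ds dt with pr ds
  ... | inj₁ refl = at-≢ as ap λ ()
  ... | inj₂ refl = at-≢ as aq λ ()
  TopLeft-final (middle pr ap aq _) as at ds dt with pr ds
  ... | inj₁ refl = at-≢ as ap λ ()
  ... | inj₂ refl = at-≢ as aq λ ()
  TopLeft-final (across pr ap aq _) as at ds dt with pr ds
  ... | inj₁ refl = at-≢ as ap λ ()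
  ... | inj₂ refl = at-≢ as aq λ ()
  TopLeft-final (near pr ap aq _) as at ds dt with pr dt
  ... | inj₁ refl = at-≢ at ap λ ()
  ... | inj₂ refl = at-≢ at aq λ ()
  TopLeft-final (crossed c) as at ds dt = Crossed-final c as (λ { refl → at-≢ as at λ () }) ds dt
  TopLeft-final (behind o) as at ds dt with i , at′ ← Mirror.Outer-right o dt = Mirror.at-≢ (flip at) at′ λ ()

  top-left : ∀ {s t} → At s (left 0) → At t top → ∀ {u} → Reach (ε ▸ s ▸ t) u → u ≡ ε ▸ s ▸ t ⊎ TopLeft u
  top-left as at start = inj₁ refl
  top-left as at (ρ then st) with top-left as at ρ
  ... | inj₁ refl = inj₂ (TopLeft-start as at st)
  ... | inj₂ φ = inj₂ (TopLeft-step φ st)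

  top-left-cell : ∀ {s t} → At s (left 0) → At t top → IEquals ⟦ ε ▸ s ▸ t ⟧ ⟦ ε ▸ s ▸ t ⟧ (⟦ ε ▸ s ▸ t ⟧ ∷ [])
  top-left-cell {s} {t} as at = IEquals-trivial (com as at l-t) only
    where
    only : ∀ {u} → Reach (ε ▸ s ▸ t) u → D u s → D u t → ⟦ u ⟧ ≈ ⟦ ε ▸ s ▸ t ⟧
    only ρ ds dt with top-left as at ρ
    ... | inj₁ refl = ≈-refl
    ... | inj₂ φ = ⊥-elim (TopLeft-final φ as at ds dt)

  -- `1 ≤ i + j` says that some step has been taken. A particle that has left the first vertex of
  -- its arm is blocked inward, so the starting position does not recur while the two are apart.
  data LeftRight (u : W) : Set where
    apart    : ∀ {p q i j} → Pair u p q → At p (left i) → At q (right j) → 1 ≤ i + j →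
      (∀ {k} → i ≡ suc k → No u p (left k)) → (∀ {k} → j ≡ suc k → No u q (right k)) → LeftRight u
    crossed  : Crossed u → LeftRight u
    crossed′ : Mirror.Crossed u → LeftRight u

  cross-left : ∀ j {u p q r} → Pair u p q → Step u p r → At p (left 0) → At r centre → At q (right j) → LeftRight (u ▸ r)
  cross-left zero pr st ap ar aq = crossed (lone (meet pr st ar aq cr))
  cross-left (suc j) pr st ap ar aq = crossed (middle (Pair-move pr st) ar aq (No-back st ap ar lc))

  cross-right : ∀ i {u p q r} → Pair u p q → Step u q r → At q (right 0) → At r centre → At p (left i) → LeftRight (u ▸ r)
  cross-right zero pr st aq ar ap = crossed (lone (meet (Pair-swap pr) st ar ap cl))
  cross-right (suc i) pr st aq ar ap = crossed′ (Mirror.middle (Pair-move (Pair-swap pr) st) (flip ar) (flip ap)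
    (Mirror.No-back st (flip aq) (flip ar) lc))

  move-left : ∀ i {u p q r j} → Pair u p q → Step u p r → At p (left i) → At q (right j) →
    (∀ {k} → i ≡ suc k → No u p (left k)) → (∀ {k} → j ≡ suc k → No u q (right k)) → Next (left i) r → LeftRight (u ▸ r)
  move-left i pr st ap aq bp bq (next ar ll⁺) = apart (Pair-move pr st) ar aq (s≤s z≤n)
    (λ { refl → No-back st ap ar ll⁺ }) (λ { refl → No-▸ aq ar lr lr (bq refl) })
  move-left (suc i) pr st ap aq bp bq (next ar ll⁻) = stop st ar (bp refl)
  move-left zero pr st ap aq bp bq (next ar lc) = cross-left _ pr st ap ar aq

  move-right : ∀ j {u p q r i} → Pair u p q → Step u q r → At p (left i) → At q (right j) →
    (∀ {k} → i ≡ suc k → No u p (left k)) → (∀ {k} → j ≡ suc k → No u q (right k)) → Next (right j) r → LeftRight (u ▸ r)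
  move-right j {i = i} pr st ap aq bp bq (next ar rr⁺) = apart (swapped pr st) ap ar (subst (1 ≤_) (sym (ℕₚ.+-suc i j)) (s≤s z≤n))
    (λ { refl → No-▸ ap ar rl rl (bp refl) }) (λ { refl → No-back st aq ar rr⁺ })
  move-right (suc j) pr st ap aq bp bq (next ar rr⁻) = stop st ar (bq refl)
  move-right zero pr st ap aq bp bq (next ar rc) = cross-right _ pr st aq ar ap

  LeftRight-step : ∀ {u l r} → LeftRight u → Step u l r → LeftRight (u ▸ r)
  LeftRight-step (crossed c) st = crossed (Crossed-step c st)
  LeftRight-step (crossed′ c) st = crossed′ (Mirror.Crossed-step c st)
  LeftRight-step (apart pr ap aq _ bp bq) st with pr (Step-D st)
  ... | inj₁ refl = move-left _ pr st ap aq bp bq (neighbour st ap)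
  ... | inj₂ refl = move-right _ pr st ap aq bp bq (neighbour st aq)

  left-right : ∀ {s t} → At s (left 0) → At t (right 0) → ∀ {u} → Reach (ε ▸ s ▸ t) u → u ≡ ε ▸ s ▸ t ⊎ LeftRight u
  left-right as at start = inj₁ refl
  left-right {s} {t} as at (ρ then st) with left-right as at ρ
  ... | inj₂ φ = inj₂ (LeftRight-step φ st)
  ... | inj₁ refl with Pair-start {s} {t} (Step-D st)
  ...   | inj₁ refl = inj₂ (move-left 0 Pair-start st as at (λ ()) (λ ()) (neighbour st as))
  ...   | inj₂ refl = inj₂ (move-right 0 Pair-start st as at (λ ()) (λ ()) (neighbour st at))

  LeftRight-final : ∀ {u s t} → LeftRight u → At s (left 0) → At t (right 0) → D u s → ¬ D u t
  LeftRight-final (crossed c) as at ds dt = Crossed-final c as (λ { refl → at-≢ as at λ () }) ds dt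
  LeftRight-final (crossed′ c) as at ds dt = Mirror.Crossed-final c (flip at) (λ { refl → at-≢ as at λ () }) dt ds
  LeftRight-final (apart pr ap aq 1≤ _ _) as at ds dt with pr ds | pr dt
  ... | inj₂ refl | _ = at-≢ as aq λ ()
  ... | inj₁ refl | inj₁ refl = at-≢ at ap λ ()
  ... | inj₁ refl | inj₂ refl with refl ← trans (sym as) ap | refl ← trans (sym at) aq with () ← 1≤

  left-right-cell : ∀ {s t} → At s (left 0) → At t (right 0) → IEquals ⟦ ε ▸ s ▸ t ⟧ ⟦ ε ▸ s ▸ t ⟧ (⟦ ε ▸ s ▸ t ⟧ ∷ [])
  left-right-cell {s} {t} as at = IEquals-trivial (com as at lr) only
    where
    only : ∀ {u} → Reach (ε ▸ s ▸ t) u → D u s → D u t → ⟦ u ⟧ ≈ ⟦ ε ▸ s ▸ t ⟧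
    only ρ ds dt with left-right as at ρ
    ... | inj₁ refl = ≈-refl
    ... | inj₂ φ = ⊥-elim (LeftRight-final φ as at ds dt)

-- The tree of type E as a tripod

module ETree (q r : ℕ) where

  tip : ℕ
  tip = suc (q + r)

  -- Left vertices are counted downward from `q`, right ones upward, and the short arm has the last
  -- index. As a relation it can be matched on, while `place-unique` identifies the position that
  -- `locate` computes for a given generator.
  data Place (a : ℕ) : Vertex → Set where
    left   : ∀ {i} → a + suc i ≡ q → Place a (left i)
    centre : a ≡ q → Place a centre
    right  : ∀ {j} → a ≡ suc (q + j) → j < r → Place a (right j)
    top    : a ≡ tip → Place a top

  locate : ∀ {a} → a ≤ tip → Σ Vertex (Place a)
  locate {a} le with ℕₚ.<-cmp a q
  ... | tri≈ _ eq _ = centre , centre eq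
  ... | tri< lt _ _ with i , eq ← ℕₚ.m≤n⇒∃[o]m+o≡n lt = left i , left (trans (ℕₚ.+-suc a i) eq)
  ... | tri> _ _ gt with ℕₚ.m≤n⇒m<n∨m≡n le
  ...   | inj₂ eq = top , top eq
  ...   | inj₁ lt with j , refl ← ℕₚ.m≤n⇒∃[o]m+o≡n gt = right j , right refl (ℕₚ.+-cancelˡ-< q j r (ℕₚ.≤-pred lt))

  data Inner : Vertex → Set where
    left   : ∀ {i} → Inner (left i)
    centre : Inner centre
    right  : ∀ {j} → Inner (right j)

  q<tip : q < tip
  q<tip = s≤s (ℕₚ.m≤m+n q r)

  inner-≢ : ∀ {a x} → Inner x → Place a x → a ≢ tip
  inner-≢ _ (left {i} eq) refl = ℕₚ.<-irrefl refl (ℕₚ.≤-trans (s≤s (ℕₚ.m≤m+n tip (suc i))) (ℕₚ.≤-trans (ℕₚ.≤-reflexive (cong suc eq)) q<tip))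
  inner-≢ _ (centre eq) refl = ℕₚ.<-irrefl (sym eq) q<tip
  inner-≢ _ (right refl lt) eq = ℕₚ.<-irrefl (ℕₚ.+-cancelˡ-≡ (suc q) _ _ eq) lt

  rule : ℕ → ℕ → ℕ
  rule = eRule q r

  rule-path : ∀ {a b} → a ≢ tip → b ≢ tip → rule a b ≡ pathRule (λ _ → 3) a b
  rule-path {a} {b} na nb with a ℕ.≡ᵇ b
  ... | true = refl
  ... | false rewrite ≡ᵇ-≢ na | ≡ᵇ-≢ nb = refl

  rule-diag : ∀ a → rule a a ≡ 1
  rule-diag a rewrite ≡ᵇ-refl a = refl

  rule-tipˡ : ∀ {a} → a ≢ tip → rule tip a ≡ (if a ℕ.≡ᵇ q then 3 else 2)
  rule-tipˡ na rewrite ≡ᵇ-≢ (λ eq → na (sym eq)) | ≡ᵇ-refl (q + r) = refl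

  rule-tipʳ : ∀ {a} → a ≢ tip → rule a tip ≡ (if a ℕ.≡ᵇ q then 3 else 2)
  rule-tipʳ na rewrite ≡ᵇ-≢ na | ≡ᵇ-refl (q + r) = refl

  rule-sym : ∀ a b → rule a b ≡ rule b a
  rule-sym a b with a ℕₚ.≟ tip | b ℕₚ.≟ tip
  ... | yes refl | yes refl = refl
  ... | yes refl | no nb = trans (rule-tipˡ nb) (sym (rule-tipʳ nb))
  ... | no na | yes refl = trans (rule-tipʳ na) (sym (rule-tipˡ na))
  ... | no na | no nb = trans (rule-path na nb) (trans (pathRule-sym (λ _ → 3) a b) (sym (rule-path nb na)))

  tip-bond : ∀ c → Bond (if c then 3 else 2)
  tip-bond true = b3 refl
  tip-bond false = b2 refl

  rule-bond : ∀ {a b} → a ≢ b → Bond (rule a b)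
  rule-bond {a} {b} ne with a ℕₚ.≟ tip | b ℕₚ.≟ tip
  ... | yes refl | yes refl = ⊥-elim (ne refl)
  ... | yes refl | no nb = subst Bond (sym (rule-tipˡ nb)) (tip-bond (b ℕ.≡ᵇ q))
  ... | no na | yes refl = subst Bond (sym (rule-tipʳ na)) (tip-bond (a ℕ.≡ᵇ q))
  ... | no na | no nb = subst Bond (sym (rule-path na nb)) (pathRule-bond (λ _ → 3) (λ _ → b3 refl) ne)

  rule-suc : ∀ {a b} → a ≢ tip → b ≢ tip → b ≡ suc a → rule a b ≡ 3
  rule-suc {a} na nb refl = trans (rule-path na nb) (pathRule-suc (λ _ → 3) a)

  rule-far : ∀ {a b} → a ≢ tip → b ≢ tip → 2 + a ≤ b → rule a b ≡ 2
  rule-far na nb le = trans (rule-path na nb) (pathRule-far (λ _ → 3) le)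

  rule-tip-far : ∀ {a} → a ≢ tip → a ≢ q → rule tip a ≡ 2
  rule-tip-far na nq = trans (rule-tipˡ na) (cong (if_then 3 else 2) (≡ᵇ-≢ nq))

  left-≢ : ∀ {a i} → a + suc i ≡ q → a ≢ q
  left-≢ {a} {i} eq refl = ℕₚ.m≢1+m+n a (trans (sym eq) (ℕₚ.+-suc a i))

  right-≢ : ∀ {a j} → a ≡ suc (q + j) → a ≢ q
  right-≢ {j = j} eq refl = ℕₚ.m≢1+m+n q eq

  rule-tip-centre : rule tip q ≡ 3
  rule-tip-centre = trans (rule-tipˡ (inner-≢ centre (centre refl))) (cong (if_then 3 else 2) (≡ᵇ-refl q))

  next-left : ∀ {a b i} → a + suc i ≡ q → b + suc (suc i) ≡ q → a ≡ suc b
  next-left {a} {b} {i} p p′ = ℕₚ.+-cancelʳ-≡ (suc i) a (suc b) (trans p (trans (sym p′) (ℕₚ.+-suc b (suc i))))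

  Adj-inner : ∀ {a b x y} → Inner x → Inner y → Place a x → Place b y → Adj x y → b ≡ suc a ⊎ a ≡ suc b
  Adj-inner _ _ (left p) (left p′) ll⁺ = inj₂ (next-left p p′)
  Adj-inner _ _ (left p) (left p′) ll⁻ = inj₁ (next-left p′ p)
  Adj-inner _ _ (right p _) (right p′ _) rr⁺ = inj₁ (trans p′ (cong suc (trans (ℕₚ.+-suc q _) (sym p))))
  Adj-inner _ _ (right p _) (right p′ _) rr⁻ = inj₂ (trans p (cong suc (trans (ℕₚ.+-suc q _) (sym p′))))
  Adj-inner {a} _ _ (left p) (centre p′) lc = inj₁ (trans p′ (trans (sym p) (ℕₚ.+-comm a 1)))
  Adj-inner {b = b} _ _ (centre p) (left p′) cl = inj₂ (trans p (trans (sym p′) (ℕₚ.+-comm b 1)))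
  Adj-inner _ _ (right p _) (centre p′) rc = inj₂ (trans p (cong suc (trans (ℕₚ.+-identityʳ q) (sym p′))))
  Adj-inner _ _ (centre p) (right p′ _) cr = inj₁ (trans p′ (cong suc (trans (ℕₚ.+-identityʳ q) (sym p))))

  neighbours : ∀ {a b} → a ≢ tip → b ≢ tip → b ≡ suc a ⊎ a ≡ suc b → rule a b ≡ 3
  neighbours na nb (inj₁ eq) = rule-suc na nb eq
  neighbours {a} {b} na nb (inj₂ eq) = trans (rule-sym a b) (rule-suc nb na eq)

  inner-three : ∀ {a b x y} → Inner x → Inner y → Place a x → Place b y → Adj x y → rule a b ≡ 3
  inner-three ix iy pa pb adj = neighbours (inner-≢ ix pa) (inner-≢ iy pb) (Adj-inner ix iy pa pb adj)

  rule-three : ∀ {a b x y} → Place a x → Place b y → Adj x y → rule a b ≡ 3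
  rule-three (top refl) (centre refl) tc = rule-tip-centre
  rule-three (centre refl) (top refl) ct = trans (rule-sym q tip) rule-tip-centre
  rule-three pa pb ll⁺ = inner-three left left pa pb ll⁺
  rule-three pa pb ll⁻ = inner-three left left pa pb ll⁻
  rule-three pa pb rr⁺ = inner-three right right pa pb rr⁺
  rule-three pa pb rr⁻ = inner-three right right pa pb rr⁻
  rule-three pa pb lc = inner-three left centre pa pb lc
  rule-three pa pb cl = inner-three centre left pa pb cl
  rule-three pa pb rc = inner-three right centre pa pb rc
  rule-three pa pb cr = inner-three centre right pa pb cr

  left-gap : ∀ {a b i j} → a + suc i ≡ q → b + suc j ≡ q → 2 + i ≤ j → 2 + b ≤ a
  left-gap {a} {b} {i} {j} p p′ le = ℕₚ.+-cancelʳ-≤ (suc i) (2 + b) a (begin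
    2 + b + suc i       ≡⟨ ℕₚ.+-suc (2 + b) i ⟩
    suc (2 + b + i)     ≡⟨ cong suc (trans (cong (_+ i) (ℕₚ.+-comm 2 b)) (ℕₚ.+-assoc b 2 i)) ⟩
    suc (b + (2 + i))   ≡⟨ ℕₚ.+-suc b (2 + i) ⟨
    b + suc (2 + i)     ≤⟨ ℕₚ.+-monoʳ-≤ b (s≤s le) ⟩
    b + suc j           ≡⟨ trans p′ (sym p) ⟩
    a + suc i           ∎)
    where open ℕₚ.≤-Reasoning

  right-gap : ∀ {a b i j} → a ≡ suc (q + i) → b ≡ suc (q + j) → 2 + i ≤ j → 2 + a ≤ b
  right-gap {i = i} refl refl le = s≤s (ℕₚ.≤-trans (ℕₚ.≤-reflexive (trans (cong suc (sym (ℕₚ.+-suc q i))) (sym (ℕₚ.+-suc q (suc i))))) (ℕₚ.+-monoʳ-≤ q le))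

  left-suc : ∀ {a i} → a + suc i ≡ q → suc a + i ≡ q
  left-suc {a} {i} p = trans (sym (ℕₚ.+-suc a i)) p

  Far-inner : ∀ {a b x y} → Inner x → Inner y → Place a x → Place b y → Far x y → 2 + a ≤ b ⊎ 2 + b ≤ a
  Far-inner _ _ (left p) (left p′) (ll⁺ le) = inj₂ (left-gap p p′ le)
  Far-inner _ _ (left p) (left p′) (ll⁻ le) = inj₁ (left-gap p′ p le)
  Far-inner _ _ (right p _) (right p′ _) (rr⁺ le) = inj₁ (right-gap p p′ le)
  Far-inner _ _ (right p _) (right p′ _) (rr⁻ le) = inj₂ (right-gap p′ p le)
  Far-inner _ _ (left p) (right refl _) lr = inj₁ (s≤s (ℕₚ.≤-trans (ℕₚ.m+n≤o⇒m≤o _ (ℕₚ.≤-reflexive (left-suc p))) (ℕₚ.m≤m+n q _)))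
  Far-inner _ _ (right refl _) (left p) rl = inj₂ (s≤s (ℕₚ.≤-trans (ℕₚ.m+n≤o⇒m≤o _ (ℕₚ.≤-reflexive (left-suc p))) (ℕₚ.m≤m+n q _)))
  Far-inner _ _ (left p) (centre refl) lc = inj₁ (ℕₚ.m+n≤o⇒m≤o _ (ℕₚ.≤-reflexive (left-suc {suc _} (left-suc p))))
  Far-inner _ _ (centre refl) (left p) cl = inj₂ (ℕₚ.m+n≤o⇒m≤o _ (ℕₚ.≤-reflexive (left-suc {suc _} (left-suc p))))
  Far-inner _ _ (right refl _) (centre refl) rc = inj₂ (s≤s (ℕₚ.≤-trans (s≤s (ℕₚ.m≤m+n q _)) (ℕₚ.≤-reflexive (sym (ℕₚ.+-suc q _)))))
  Far-inner _ _ (centre refl) (right refl _) cr = inj₁ (s≤s (ℕₚ.≤-trans (s≤s (ℕₚ.m≤m+n q _)) (ℕₚ.≤-reflexive (sym (ℕₚ.+-suc q _)))))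

  inner-far : ∀ {a b x y} → Inner x → Inner y → Place a x → Place b y → Far x y → rule a b ≡ 2
  inner-far {a} {b} ix iy pa pb f with Far-inner ix iy pa pb f
  ... | inj₁ le = rule-far (inner-≢ ix pa) (inner-≢ iy pb) le
  ... | inj₂ le = trans (rule-sym a b) (rule-far (inner-≢ iy pb) (inner-≢ ix pa) le)

  rule-apart : ∀ {a b x y} → Place a x → Place b y → Far x y → rule a b ≡ 2
  rule-apart {a} pa@(left p) (top refl) l-t = trans (rule-sym a tip) (rule-tip-far (inner-≢ left pa) (left-≢ p))
  rule-apart (top refl) pb@(left p) t-l = rule-tip-far (inner-≢ left pb) (left-≢ p)
  rule-apart {a} pa@(right p _) (top refl) r-t = trans (rule-sym a tip) (rule-tip-far (inner-≢ right pa) (right-≢ p))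
  rule-apart (top refl) pb@(right p _) t-r = rule-tip-far (inner-≢ right pb) (right-≢ p)
  rule-apart pa pb f@(ll⁺ _) = inner-far left left pa pb f
  rule-apart pa pb f@(ll⁻ _) = inner-far left left pa pb f
  rule-apart pa pb f@(rr⁺ _) = inner-far right right pa pb f
  rule-apart pa pb f@(rr⁻ _) = inner-far right right pa pb f
  rule-apart pa pb lr = inner-far left right pa pb lr
  rule-apart pa pb rl = inner-far right left pa pb rl
  rule-apart pa pb lc = inner-far left centre pa pb lc
  rule-apart pa pb cl = inner-far centre left pa pb cl
  rule-apart pa pb rc = inner-far right centre pa pb rc
  rule-apart pa pb cr = inner-far centre right pa pb cr

  -- The converse of `Adj-inner`, from which an edge of the matrix is traced back to an edge of the
  -- tripod. Comparison with `q` rules out every pair of places that are not adjacent.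
  successive : ∀ {a x y} → Inner x → Inner y → Place a x → Place (suc a) y → Adj x y × Adj y x
  successive {a} _ _ (left {i} p) (left {k} p′) with refl ← ℕₚ.suc-injective (ℕₚ.+-cancelˡ-≡ a _ _ (trans p (trans (sym p′) (sym (ℕₚ.+-suc a (suc k)))))) = ll⁻ , ll⁺
  successive {a} _ _ (left p) (centre refl) with refl ← ℕₚ.suc-injective (ℕₚ.+-cancelˡ-≡ a _ 1 (trans p (ℕₚ.+-comm 1 a))) = lc , cl
  successive _ _ (left {i} p) (right {j} refl _) = ⊥-elim (ℕₚ.m≢1+m+n q (trans (sym p) (trans (ℕₚ.+-suc _ i) (cong suc (ℕₚ.+-assoc q j i)))))
  successive _ _ (centre refl) (left {k} p) = ⊥-elim (ℕₚ.m≢1+m+n q (sym p))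
  successive _ _ (centre refl) (centre p) = ⊥-elim (ℕₚ.1+n≢n p)
  successive _ _ (centre refl) (right {j} p _) with refl ← ℕₚ.+-cancelˡ-≡ q 0 j (trans (ℕₚ.+-identityʳ q) (ℕₚ.suc-injective p)) = cr , rc
  successive _ _ (right {j} refl _) (left {k} p) = ⊥-elim (ℕₚ.m≢1+m+n q (trans (sym p) (cong suc (trans (cong (λ x → suc x) (ℕₚ.+-assoc q j (suc k))) (sym (ℕₚ.+-suc q _))))))
  successive _ _ (right {j} refl _) (centre p) = ⊥-elim (ℕₚ.m≢1+m+n q (trans (sym p) (cong suc (sym (ℕₚ.+-suc q j)))))
  successive _ _ (right {j} refl _) (right {k} p _) with refl ← ℕₚ.+-cancelˡ-≡ q (suc j) k (trans (ℕₚ.+-suc q j) (ℕₚ.suc-injective p)) = rr⁺ , rr⁻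

  not-3≤ : ∀ {l m} → l ≡ m → m ≤ 2 → ¬ 3 ≤ l
  not-3≤ eq m≤2 le = ℕₚ.<⇒≱ le (subst (_≤ 2) (sym eq) m≤2)

  inner-link : ∀ {a b x y} → Inner x → Inner y → Place a x → Place b y → 3 ≤ rule a b → Adj x y
  inner-link {a} {b} ix iy pa pb le with ℕₚ.<-cmp a b
  ... | tri≈ _ refl _ = ⊥-elim (not-3≤ (rule-diag a) (s≤s z≤n) le)
  ... | tri< lt _ _ with ℕₚ.m≤n⇒m<n∨m≡n lt
  ...   | inj₁ lt′ = ⊥-elim (not-3≤ (rule-far (inner-≢ ix pa) (inner-≢ iy pb) lt′) ℕₚ.≤-refl le)
  ...   | inj₂ refl = proj₁ (successive ix iy pa pb)
  inner-link {a} {b} ix iy pa pb le | tri> _ _ gt with ℕₚ.m≤n⇒m<n∨m≡n gt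
  ...   | inj₁ gt′ = ⊥-elim (not-3≤ (trans (rule-sym a b) (rule-far (inner-≢ iy pb) (inner-≢ ix pa) gt′)) ℕₚ.≤-refl le)
  ...   | inj₂ refl = proj₂ (successive iy ix pb pa)

  tip-link : ∀ {a x} → Place a x → 3 ≤ rule tip a → Adj top x × Adj x top
  tip-link (centre refl) _ = tc , ct
  tip-link (top refl) le = ⊥-elim (not-3≤ (rule-diag tip) (s≤s z≤n) le)
  tip-link pa@(left p) le = ⊥-elim (not-3≤ (rule-tip-far (inner-≢ left pa) (left-≢ p)) ℕₚ.≤-refl le)
  tip-link pa@(right p _) le = ⊥-elim (not-3≤ (rule-tip-far (inner-≢ right pa) (right-≢ p)) ℕₚ.≤-refl le)

  inner? : ∀ x → Inner x ⊎ x ≡ top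
  inner? (left i) = inj₁ left
  inner? (right i) = inj₁ right
  inner? centre = inj₁ centre
  inner? top = inj₂ refl

  rule-link : ∀ {a b x y} → Place a x → Place b y → 3 ≤ rule a b → Adj x y
  rule-link {a} {b} {x} {y} pa pb le with inner? x | inner? y | pa | pb
  ... | inj₁ ix | inj₁ iy | _ | _ = inner-link ix iy pa pb le
  ... | inj₂ refl | _ | top refl | _ = proj₁ (tip-link pb le)
  ... | _ | inj₂ refl | _ | top refl = proj₂ (tip-link pa (subst (3 ≤_) (rule-sym a tip) le))

  place-injective : ∀ {a b x} → Place a x → Place b x → a ≡ b
  place-injective (left {i} p) (left p′) = ℕₚ.+-cancelʳ-≡ (suc i) _ _ (trans p (sym p′))
  place-injective (centre p) (centre p′) = trans p (sym p′)
  place-injective (right p _) (right p′ _) = trans p (sym p′)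
  place-injective (top p) (top p′) = trans p (sym p′)

  left-< : ∀ {a i} → a + suc i ≡ q → a < q
  left-< {a} {i} p = ℕₚ.m+n≤o⇒m≤o (suc a) (ℕₚ.≤-reflexive (left-suc p))

  right-> : ∀ {a j} → a ≡ suc (q + j) → q < a
  right-> {j = j} refl = s≤s (ℕₚ.m≤m+n q j)

  place-unique : ∀ {a x y} → Place a x → Place a y → x ≡ y
  place-unique {a} (left p) (left p′) = cong left (ℕₚ.suc-injective (ℕₚ.+-cancelˡ-≡ a _ _ (trans p (sym p′))))
  place-unique (centre p) (centre p′) = refl
  place-unique (right p _) (right p′ _) = cong right (ℕₚ.+-cancelˡ-≡ (suc q) _ _ (trans (sym p) p′))
  place-unique (top p) (top p′) = refl
  place-unique (left p) (centre p′) = ⊥-elim (left-≢ p p′)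
  place-unique (centre p) (left p′) = ⊥-elim (left-≢ p′ p)
  place-unique (left p) (right p′ _) = ⊥-elim (ℕₚ.<-asym (left-< p) (right-> p′))
  place-unique (right p _) (left p′) = ⊥-elim (ℕₚ.<-asym (left-< p′) (right-> p))
  place-unique (centre p) (right p′ _) = ⊥-elim (right-≢ p′ p)
  place-unique (right p _) (centre p′) = ⊥-elim (right-≢ p p′)
  place-unique pa@(left _) (top p) = ⊥-elim (inner-≢ left pa p)
  place-unique pa@(centre _) (top p) = ⊥-elim (inner-≢ centre pa p)
  place-unique pa@(right _ _) (top p) = ⊥-elim (inner-≢ right pa p)
  place-unique (top p) pa@(left _) = ⊥-elim (inner-≢ left pa p)
  place-unique (top p) pa@(centre _) = ⊥-elim (inner-≢ centre pa p)
  place-unique (top p) pa@(right _ _) = ⊥-elim (inner-≢ right pa p)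

  M : CoxeterMatrix (2 + q + r)
  M = typeE q r

  position : Fin (2 + q + r) → Vertex
  position s = proj₁ (locate (ℕₚ.≤-pred (Finₚ.toℕ<n s)))

  place : ∀ s → Place (toℕ s) (position s)
  place s = proj₂ (locate (ℕₚ.≤-pred (Finₚ.toℕ<n s)))

  at : ∀ {s x} → Place (toℕ s) x → position s ≡ x
  at {s} = place-unique (place s)

  M-bond : ∀ {s t} → s ≢ t → Bond (M s t)
  M-bond ne = rule-bond λ eq → ne (Finₚ.toℕ-injective eq)

  position-injective : ∀ {s t} → position s ≡ position t → s ≡ t
  position-injective {s} {t} eq = Finₚ.toℕ-injective (place-injective (place s) (subst (Place (toℕ t)) (sym eq) (place t)))

  module Standard = Tripod M (λ s t → rule-sym (toℕ s) (toℕ t)) (λ s → rule-diag (toℕ s)) M-bond position position-injective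
    (λ {s} {t} → rule-link (place s) (place t)) (λ {s} {t} → rule-three (place s) (place t)) (λ {s} {t} → rule-apart (place s) (place t))

  unmirror : (_R_ : Vertex → Vertex → Set) → (∀ {x y} → x R y → mirror x R mirror y) → ∀ {x y} → mirror x R mirror y → x R y
  unmirror _R_ f {x} {y} e = subst₂ _R_ (mirror-involutive x) (mirror-involutive y) (f e)

  module Mirrored = Tripod M (λ s t → rule-sym (toℕ s) (toℕ t)) (λ s → rule-diag (toℕ s)) M-bond
    (λ s → mirror (position s)) (λ eq → position-injective (Standard.mirror-injective eq))
    (λ {s} {t} le → mirror-Adj (rule-link (place s) (place t) le))
    (λ {s} {t} adj → rule-three (place s) (place t) (unmirror Adj mirror-Adj adj))
    (λ {s} {t} f → rule-apart (place s) (place t) (unmirror Far mirror-Far f))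

  module _ (1≤q : 1 ≤ q) (1≤r : 1 ≤ r) where

    at-left : position (eNeg q r 1) ≡ left 0
    at-left = at {eNeg q r 1} (left (trans (cong (_+ 1) (toℕ-idx {1 + q + r} (ℕₚ.≤-trans (ℕₚ.m∸n≤m q 1) (ℕₚ.<⇒≤ q<tip)))) (ℕₚ.m∸n+n≡m 1≤q)))

    at-right : position (eVert q r 1) ≡ right 0
    at-right = at {eVert q r 1} (right (trans (toℕ-idx {1 + q + r} (ℕₚ.≤-trans (ℕₚ.+-monoʳ-≤ q 1≤r) (ℕₚ.n≤1+n (q + r)))) (ℕₚ.+-suc q 0)) 1≤r)

    at-top : position (eV q r) ≡ top
    at-top = at {eV q r} (top (toℕ-idx {1 + q + r} ℕₚ.≤-refl))

    cells : let open Coxeter M in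
      IEquals (eNeg q r 1 ∷ eV q r ∷ []) (eNeg q r 1 ∷ eV q r ∷ []) ((eNeg q r 1 ∷ eV q r ∷ []) ∷ [])
      × IEquals (eVert q r 1 ∷ eV q r ∷ []) (eVert q r 1 ∷ eV q r ∷ []) ((eVert q r 1 ∷ eV q r ∷ []) ∷ [])
      × IEquals (eNeg q r 1 ∷ eVert q r 1 ∷ []) (eNeg q r 1 ∷ eVert q r 1 ∷ []) ((eNeg q r 1 ∷ eVert q r 1 ∷ []) ∷ [])
    cells =
      Standard.top-left-cell {eNeg q r 1} {eV q r} at-left at-top ,
      -- In the reflected tripod the right arm plays the role of the left one, so the same analysis
      -- applies.
      Mirrored.top-left-cell {eVert q r 1} {eV q r} (cong mirror at-right) (cong mirror at-top) ,
      Standard.left-right-cell {eNeg q r 1} {eVert q r 1} at-left at-right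

theorem4p17 : ((k : ℕ) → Coxeter.IEquals (typeA (3 + k)) (ws (1 ∷ 3 ∷ [])) (ws (1 ∷ 3 ∷ [])) (ws (1 ∷ 3 ∷ []) ∷ []))
    × Coxeter.IEquals (typeB 3) (ws (1 ∷ 3 ∷ [])) (ws (1 ∷ 3 ∷ [])) (ws (1 ∷ 3 ∷ []) ∷ [])
    × ((k : ℕ) → Coxeter.IEquals (typeB (4 + k)) (ws (2 ∷ 4 ∷ [])) (ws (2 ∷ 4 ∷ []))
    (ws (2 ∷ 4 ∷ []) ∷ ws (2 ∷ 1 ∷ 2 ∷ 4 ∷ []) ∷ []))
    × ((k : ℕ) → Coxeter.IEquals (typeCt (5 + k)) (ws (2 ∷ 4 ∷ [])) (ws (2 ∷ 4 ∷ []))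
    (ws (2 ∷ 4 ∷ []) ∷ ws (2 ∷ 1 ∷ 2 ∷ 4 ∷ []) ∷ ws (2 ∷ zLabels (5 + k))
    ∷ ws (2 ∷ 1 ∷ 2 ∷ zLabels (5 + k)) ∷ []))
    × ((q r : ℕ) → 1 ≤ q → q ≤ r →
    Coxeter.IEquals (typeE q r) (eNeg q r 1 ∷ eV q r ∷ []) (eNeg q r 1 ∷ eV q r ∷ [])
    ((eNeg q r 1 ∷ eV q r ∷ []) ∷ [])
    × Coxeter.IEquals (typeE q r) (eVert q r 1 ∷ eV q r ∷ []) (eVert q r 1 ∷ eV q r ∷ [])
    ((eVert q r 1 ∷ eV q r ∷ []) ∷ [])
    × Coxeter.IEquals (typeE q r) (eNeg q r 1 ∷ eVert q r 1 ∷ []) (eNeg q r 1 ∷ eVert q r 1 ∷ [])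
    ((eNeg q r 1 ∷ eVert q r 1 ∷ []) ∷ []))
    × Coxeter.IEquals (typeF 4) (ws (2 ∷ 4 ∷ [])) (ws (2 ∷ 4 ∷ [])) (ws (2 ∷ 4 ∷ []) ∷ [])
    × ((k : ℕ) → Coxeter.IEquals (typeF (5 + k)) (ws (2 ∷ 4 ∷ [])) (ws (2 ∷ 4 ∷ []))
    (ws (2 ∷ 4 ∷ []) ∷ ws (2 ∷ 4 ∷ 3 ∷ 5 ∷ 2 ∷ 4 ∷ []) ∷ []))
    × Coxeter.IEquals (typeH 3) (ws (1 ∷ 3 ∷ [])) (ws (1 ∷ 3 ∷ [])) (ws (1 ∷ 3 ∷ []) ∷ [])
    × ((k : ℕ) → Coxeter.IEquals (typeH (4 + k)) (ws (2 ∷ 4 ∷ [])) (ws (2 ∷ 4 ∷ []))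
    (ws (2 ∷ 4 ∷ []) ∷ ws (2 ∷ 1 ∷ 2 ∷ 4 ∷ []) ∷ []))
theorem4p17 =
  typeA-cell , typeB₃-cell , typeB-cell , typeC̃-cell ,
  (λ q r 1≤q q≤r → ETree.cells q r 1≤q (ℕₚ.≤-trans 1≤q q≤r)) ,
  typeF₄-cell , typeF-cell , typeH₃-cell , typeH-cell
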